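{- For all $j\in\mathbb{Z}$ and $k\ge -1$, $$F_{j,k}=\sum_{I\in J(P_k)}\ \prod_{(r,s,t)\in I}y_{3r+s+j}.$$
   Context: Let $y_j$ ($j\in\mathbb{Z}$) be indeterminates with $y_{j+2n}=y_j$ for a fixed $n\ge1$. $F_{j,k}\in\mathbb{Q}(y_1,\dots,y_{2n})$ is defined by $F_{j,-1}=F_{j,0}=1$ for all $j$ and, for $k\ge0$, $F_{j,k+1}=\dfrac{F_{j-3,k}F_{j+3,k}+\left(\prod_{i=-k}^{k}y_{j+3i}\right)F_{j-1,k}F_{j+1,k}}{F_{j,k-1}}$. For an integer $k$, $Q_k$ is the set of $(r,s,t)\in\mathbb{Z}^3$ with $2|s|-(k-2)\le t\le k-2-2|r|$ and $2|s|-(k-2)\equiv t\equiv k-2-2|r|\pmod 4$; $P_k=Q_{k+1}\cup Q_k$, with the partial order generated by: $(r',s',t')$ covers $(r,s,t)$ iff $t'=t+1$ and $|r'-r|+|s'-s|=1$. $J(P_k)$ is the set of order ideals (down-closed subsets, including $\emptyset$) of $P_k$. -}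

module Defs where

open import Level using (Level; _⊔_)
open import Data.Bool using (Bool; true; false; if_then_else_)
open import Data.Nat as ℕ using (ℕ)
open import Data.Integer as ℤ using (ℤ; +_; ∣_∣; _-_; _*_; _≤_; _≤?_)
open import Data.Integer.Base using (_%_)
open import Data.Product using (_×_; _,_; proj₁; proj₂)
open import Data.Sum using (_⊎_)
open import Data.List using (List; []; _∷_; map; concatMap; upTo; filter; length; lookup; foldr; allFin)
open import Data.Fin using (Fin)
open import Data.Fin.Subset using (Subset; _∈_)
open import Relation.Binary.PropositionalEquality using (_≡_)
open import Relation.Binary.Construct.Closure.ReflexiveTransitive using (Star)
open import Relation.Nullary using (¬_; Dec)
open import Relation.Nullary.Decidable using (_×-dec_; _⊎-dec_)
open import Algebra.Bundles using (CommutativeRing)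
import Data.Nat.Properties as ℕP
import Data.Vec

record IsFieldOn {c ℓ : Level} (K : CommutativeRing c ℓ) : Set (c ⊔ ℓ) where
  open CommutativeRing K using (Carrier; _≈_; 0#; 1#) renaming (_*_ to _·_)
  field
    1≉0    : ¬ (1# ≈ 0#)
    inv    : (x : Carrier) → ¬ (x ≈ 0#) → Carrier
    inv-ʳ  : (x : Carrier) (p : ¬ (x ≈ 0#)) → (x · inv x p) ≈ 1#

Triple : Set
Triple = ℤ × ℤ × ℤ

lowQ : ℤ → Triple → ℤ
lowQ k (r , s , t) = (+ 2) * (+ ∣ s ∣) - (k - + 2)

highQ : ℤ → Triple → ℤ
highQ k (r , s , t) = (k - + 2) - (+ 2) * (+ ∣ r ∣)

tOf : Triple → ℤ
tOf (r , s , t) = t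

InQ : ℤ → Triple → Set
InQ k x = (lowQ k x ≤ tOf x) × (tOf x ≤ highQ k x)
          × ((lowQ k x % + 4) ≡ (tOf x % + 4)) × ((tOf x % + 4) ≡ (highQ k x % + 4))

InQ? : (k : ℤ) (x : Triple) → Dec (InQ k x)
InQ? k x = (lowQ k x ≤? tOf x) ×-dec (tOf x ≤? highQ k x)
           ×-dec ((lowQ k x % + 4) ℕP.≟ (tOf x % + 4)) ×-dec ((tOf x % + 4) ℕP.≟ (highQ k x % + 4))

-- P_k = Q_{k+1} ∪ Q_k  (the union is disjoint: the parities of t differ).
InP : ℤ → Triple → Set
InP k x = InQ (k ℤ.+ + 1) x ⊎ InQ k x

InP? : (k : ℤ) (x : Triple) → Dec (InP k x)
InP? k x = InQ? (k ℤ.+ + 1) x ⊎-dec InQ? k x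

range : ℕ → List ℤ
range B = map (λ i → + i - + B) (upTo (ℕ.suc (2 ℕ.* B)))

box : ℕ → List Triple
box B = concatMap (λ r → concatMap (λ s → map (λ t → (r , s , t)) (range B)) (range B)) (range B)

-- Explicit duplicate-free enumeration of the finite set P_k: every element
-- of P_k has |r|, |s|, |t| ≤ |k| + 3.
PList : ℤ → List Triple
PList k = filter (InP? k) (box (∣ k ∣ ℕ.+ 3))

size : ℤ → ℕ
size k = length (PList k)

elem : (k : ℤ) → Fin (size k) → Triple
elem k = lookup (PList k)

Covers : Triple → Triple → Set
Covers (r' , s' , t') (r , s , t) = (t' ≡ t ℤ.+ + 1) × ((∣ r' - r ∣ ℕ.+ ∣ s' - s ∣) ≡ 1)

Below : (k : ℤ) → Fin (size k) → Fin (size k) → Set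
Below k = Star (λ a b → Covers (elem k b) (elem k a))

IsOrderIdeal : (k : ℤ) → Subset (size k) → Set
IsOrderIdeal k I = ∀ a b → Below k a b → b ∈ I → a ∈ I

module _ {c ℓ : Level} (K : CommutativeRing c ℓ) where
  open CommutativeRing K using (Carrier; 0#; 1#) renaming (_*_ to _·_; _+_ to _⊕_)

  prodK : List Carrier → Carrier
  prodK = foldr _·_ 1#

  sumK : List Carrier → Carrier
  sumK = foldr _⊕_ 0#

  coeffProd : (ℤ → Carrier) → ℤ → ℕ → Carrier
  coeffProd y j k = prodK (map (λ i → y (j ℤ.+ (+ 3) * (+ i - + k))) (upTo (ℕ.suc (2 ℕ.* k))))

  weight : (ℤ → Carrier) → ℤ → (k : ℤ) → Subset (size k) → Carrier
  weight y j k I = prodK (map (λ a → if Data.Vec.lookup I a then w (elem k a) else 1#) (allFin (size k)))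
    where
      w : Triple → Carrier
      w (r , s , t) = y ((+ 3) * r ℤ.+ s ℤ.+ j)

module Submission where

-- Q_n is the set of quadruples of naturals (a₁ , a₂ , b₁ , b₂) with sum n − 2, and P_n consists of
-- the two layers Q_{n+1} and Q_n.  For weights a, b let Z n a b be the sum over the order ideals
-- S ∪ T of P_n (S ⊆ Q_{n+1}, T ⊆ Q_n) of the product over v ∈ S of a v or b v, according as the
-- upper neighbour of v in direction r is in T or not.  Fix the part of an ideal of P_{n+1} in
-- Q_{n+1} and sum over the part in Q_{n+2}; fix the part of an ideal of P_n in Q_{n+1} and sum over
-- the part in Q_n.  Both sums are products of local factors, and for suitable new weights a′, b′
-- they agree up to a constant (urban renewal), so Z (n+1) a b is a constant times Z n a′ b′.  The
-- recurrence for F says that 1 + b is a quotient of values of F at every stage of this process,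
-- and the constants telescope to F_{j,n}.  Keeping two weights a and b, instead of one weight per
-- element, avoids dividing by y, which may vanish.

open import Defs
open import Level using (Level)
open import Data.Bool using (Bool; true; false; if_then_else_; _∧_; _∨_; not)
open import Data.Bool.Properties using (∨-assoc; ∨-identityʳ)
open import Data.Empty using (⊥; ⊥-elim)
import Data.Fin as Fin
open import Data.Fin.Subset as Subset using (Subset)
open import Data.Nat as ℕ using (ℕ; zero; suc)
import Data.Nat.Properties as ℕP
import Data.Nat.Tactic.RingSolver as ℕSolver
open import Data.Integer as ℤ using (ℤ; +_; -[1+_]; ∣_∣)
open import Data.Integer.Base using (_%_; _/_)
import Data.Integer.Properties as ℤP
import Data.Integer.DivMod as ℤD
open import Data.Integer.Tactic.RingSolver using (solve-∀)
open import Data.List as List using (List; []; _∷_; map; concatMap; filter; _++_; upTo; applyUpTo; allFin; cartesianProduct; length)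
import Data.List.Properties as ListP
open import Data.List.Membership.Propositional using (_∈_; _∉_; lose; find)
open import Data.List.Membership.Propositional.Properties
open import Data.List.Membership.Propositional.Properties.WithK using (unique∧set⇒bag)
open import Data.List.Relation.Binary.BagAndSetEquality using (∼bag⇒↭)
open import Data.List.Relation.Binary.Permutation.Propositional as Perm using (_↭_; ↭-sym)
open import Data.List.Relation.Binary.Permutation.Propositional.Properties using (∈-resp-↭)
open import Data.List.Relation.Unary.All as All using ([]; _∷_)
open import Data.List.Relation.Unary.AllPairs using ([]; _∷_)
open import Data.List.Relation.Unary.Any as Any using (here; there)
import Data.List.Relation.Unary.Any.Properties as AnyP
open import Data.List.Relation.Unary.Unique.Propositional using (Unique)
import Data.List.Relation.Unary.Unique.Propositional.Properties as UniqueP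
open import Data.Product using (_×_; _,_; proj₁; proj₂; ∃; ∃₂)
import Data.Product.Properties as ×P
open import Data.Sum using (_⊎_; inj₁; inj₂)
open import Data.Vec as Vec using (Vec; []; _∷_)
import Data.Vec.Properties as VecP
open import Function using (_∘_; id)
open import Function.Bundles using (_⇔_; mk⇔; Equivalence)
open import Relation.Nullary using (¬_; Dec; yes; no; does)
open import Relation.Nullary.Decidable using (dec-true; dec-false; ¬?)
open import Relation.Binary.Construct.Closure.ReflexiveTransitive using (Star; ε; _◅_)
open import Relation.Binary.Definitions using (DecidableEquality; tri<; tri≈; tri>)
open import Relation.Binary.PropositionalEquality as ≡ using (_≡_; _≢_; cong; cong₂; subst; module ≡-Reasoning)
open import Algebra.Bundles using (CommutativeRing; CommutativeMonoid)
open import Algebra.Properties.AbelianGroup ℤP.+-0-abelianGroup using (∙-cancelʳ)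

-- Lists, layers, and sums over subsets

-- Why the two sums agree: if `v′ < v` in Q_{n+1} differ by one step in r and one in s, then `v` is
-- `inc₃ z` or `inc₄ z` and `v′` is `inc₁ z` or `inc₂ z` for some z in Q_n, and both are neighbours
-- of one x in Q_{n+2}. Hence the subsets of Q_{n+1} that extend to an ideal downwards or upwards
-- are the same. For such a subset every local factor splits into a part that sees only r-neighbours
-- and a part that sees only s-neighbours. The r-parts are compared at `x = inc₂ (inc₁ z)`, the
-- s-parts at `x = inc₄ (inc₃ z)`. What remains unmatched is `1 + b` at the x with b₁ = b₂ = 0: a
-- row of Q_{n+2}, and the constant of the step. The new weights follow the mutation rule for
-- coefficients. With one weight per element, the elements of Q_n would carry `1 / b` after a step;
-- the pair a = (weight of v)(weight of its r-neighbour), b = (weight of v) stays polynomial in the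
-- y. The only inverses are those of values of F. Rows telescope because shifting a row by one step
-- left and right gives the next longer row together with the next shorter one.

unique-↭ : {X : Set} {L M : List X} → Unique L → Unique M →
           (∀ {x} → x ∈ L → x ∈ M) → (∀ {x} → x ∈ M → x ∈ L) → L ↭ M
unique-↭ uL uM f g = ∼bag⇒↭ (unique∧set⇒bag uL uM (mk⇔ f g))

-- Quad (a₁ , a₂ , b₁ , b₂) with 2 + a₁ + a₂ + b₁ + b₂ = n stands for the element
-- (a₂ − a₁ , b₂ − b₁ , b₁ + b₂ − a₁ − a₂) of Q_n.  The elements of Q_{n+1} below z ∈ Q_n
-- are inc₁ z and inc₂ z, and those above it are inc₃ z and inc₄ z.
Quad : Set
Quad = ℕ × ℕ × ℕ × ℕ

_≟Q_ : DecidableEquality Quad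
_≟Q_ = ×P.≡-dec ℕP._≟_ (×P.≡-dec ℕP._≟_ (×P.≡-dec ℕP._≟_ ℕP._≟_))

total : Quad → ℕ
total (a₁ , a₂ , b₁ , b₂) = (a₁ ℕ.+ a₂) ℕ.+ (b₁ ℕ.+ b₂)

inc₁ inc₂ inc₃ inc₄ : Quad → Quad
inc₁ (a₁ , a₂ , b₁ , b₂) = suc a₁ , a₂ , b₁ , b₂
inc₂ (a₁ , a₂ , b₁ , b₂) = a₁ , suc a₂ , b₁ , b₂
inc₃ (a₁ , a₂ , b₁ , b₂) = a₁ , a₂ , suc b₁ , b₂
inc₄ (a₁ , a₂ , b₁ , b₂) = a₁ , a₂ , b₁ , suc b₂

module _ {ℓ} {X : Set ℓ} where

  -- decᵢ e h x is h at the predecessor of x in direction i, and e if there is none.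
  dec₁ dec₂ dec₃ dec₄ : X → (Quad → X) → Quad → X
  dec₁ e h (zero , _) = e
  dec₁ e h (suc a₁ , a₂ , b₁ , b₂) = h (a₁ , a₂ , b₁ , b₂)
  dec₂ e h (_ , zero , _) = e
  dec₂ e h (a₁ , suc a₂ , b₁ , b₂) = h (a₁ , a₂ , b₁ , b₂)
  dec₃ e h (_ , _ , zero , _) = e
  dec₃ e h (a₁ , a₂ , suc b₁ , b₂) = h (a₁ , a₂ , b₁ , b₂)
  dec₄ e h (_ , _ , _ , zero) = e
  dec₄ e h (a₁ , a₂ , b₁ , suc b₂) = h (a₁ , a₂ , b₁ , b₂)

  a₁=0 b=0 : X → (Quad → X) → Quad → X
  a₁=0 e h x@(zero , _) = h x
  a₁=0 e h (suc _ , _) = e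
  b=0 e h x@(_ , _ , zero , zero) = h x
  b=0 e h (_ , _ , zero , suc _) = e
  b=0 e h (_ , _ , suc _ , _) = e

Split : (Quad → Quad) → Set
Split inc = ∀ x → Dec (∃ λ v → x ≡ inc v)

split₁ : Split inc₁
split₁ (zero , _) = no λ ()
split₁ (suc a₁ , a₂ , b₁ , b₂) = yes (_ , ≡.refl)
split₂ : Split inc₂
split₂ (_ , zero , _) = no λ ()
split₂ (a₁ , suc a₂ , b₁ , b₂) = yes (_ , ≡.refl)
split₃ : Split inc₃
split₃ (_ , _ , zero , _) = no λ ()
split₃ (a₁ , a₂ , suc b₁ , b₂) = yes (_ , ≡.refl)
split₄ : Split inc₄
split₄ (_ , _ , _ , zero) = no λ ()
split₄ (a₁ , a₂ , b₁ , suc b₂) = yes (_ , ≡.refl)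

total-inc₁ : ∀ q → total (inc₁ q) ≡ suc (total q)
total-inc₁ q = ≡.refl
total-inc₂ : ∀ q → total (inc₂ q) ≡ suc (total q)
total-inc₂ (a₁ , a₂ , b₁ , b₂) = cong (ℕ._+ (b₁ ℕ.+ b₂)) (ℕP.+-suc a₁ a₂)
total-inc₃ : ∀ q → total (inc₃ q) ≡ suc (total q)
total-inc₃ (a₁ , a₂ , b₁ , b₂) = ℕP.+-suc (a₁ ℕ.+ a₂) (b₁ ℕ.+ b₂)
total-inc₄ : ∀ q → total (inc₄ q) ≡ suc (total q)
total-inc₄ (a₁ , a₂ , b₁ , b₂) =
  ≡.trans (cong ((a₁ ℕ.+ a₂) ℕ.+_) (ℕP.+-suc b₁ b₂)) (ℕP.+-suc (a₁ ℕ.+ a₂) (b₁ ℕ.+ b₂))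

abstract

  cube : ℕ → List Quad
  cube n = cartesianProduct (upTo n) (cartesianProduct (upTo n) (cartesianProduct (upTo n) (upTo n)))

  inLayer? : ∀ n q → Dec (2 ℕ.+ total q ≡ n)
  inLayer? n q = 2 ℕ.+ total q ℕP.≟ n

  -- Coordinates below `n` suffice, since they sum to `n - 2`. Layers 0 and 1 are empty and layer 2
  -- is the origin.
  layer : ℕ → List Quad
  layer n = filter (inLayer? n) (cube n)

  layer-unique : ∀ n → Unique (layer n)
  layer-unique n = UniqueP.filter⁺ (inLayer? n)
    (UniqueP.cartesianProduct⁺ u (UniqueP.cartesianProduct⁺ u (UniqueP.cartesianProduct⁺ u u)))
    where
    u : Unique (upTo n)
    u = UniqueP.upTo⁺ n

  ∈-layer⁻ : ∀ {n q} → q ∈ layer n → 2 ℕ.+ total q ≡ n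
  ∈-layer⁻ {n} q∈ = proj₂ (∈-filter⁻ (inLayer? n) {xs = cube n} q∈)

  ∈-layer⁺ : ∀ {n q} → 2 ℕ.+ total q ≡ n → q ∈ layer n
  ∈-layer⁺ {n} {q@(a₁ , a₂ , b₁ , b₂)} eq = ∈-filter⁺ (inLayer? n)
    (∈-cartesianProduct⁺ (bd (ℕP.≤-trans (ℕP.m≤m+n a₁ a₂) l))
      (∈-cartesianProduct⁺ (bd (ℕP.≤-trans (ℕP.m≤n+m a₂ a₁) l))
        (∈-cartesianProduct⁺ (bd (ℕP.≤-trans (ℕP.m≤m+n b₁ b₂) r)) (bd (ℕP.≤-trans (ℕP.m≤n+m b₂ b₁) r))))) eq
    where
    l : a₁ ℕ.+ a₂ ℕ.≤ total q
    l = ℕP.m≤m+n _ _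
    r : b₁ ℕ.+ b₂ ℕ.≤ total q
    r = ℕP.m≤n+m _ (a₁ ℕ.+ a₂)
    bd : ∀ {i} → i ℕ.≤ total q → i ∈ upTo n
    bd i≤ = ∈-upTo⁺ (subst (_ ℕ.<_) eq (ℕ.s≤s (ℕP.m≤n⇒m≤1+n i≤)))

  layer-0 : layer 0 ≡ []
  layer-0 = ≡.refl
  layer-1 : layer 1 ≡ []
  layer-1 = ≡.refl
  layer-2 : layer 2 ≡ (0 , 0 , 0 , 0) ∷ []
  layer-2 = ≡.refl

module _ (inc : Quad → Quad) (total-inc : ∀ q → total (inc q) ≡ suc (total q)) where

  ∈-layer-inc⁺ : ∀ {n q} → q ∈ layer n → inc q ∈ layer (suc n)
  ∈-layer-inc⁺ q∈ = ∈-layer⁺ (≡.trans (cong (λ t → suc (suc t)) (total-inc _)) (cong suc (∈-layer⁻ q∈)))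

  ∈-layer-inc⁻ : ∀ {n q} → inc q ∈ layer (suc n) → q ∈ layer n
  ∈-layer-inc⁻ q∈ = ∈-layer⁺ (ℕP.suc-injective (≡.trans (cong (λ t → suc (suc t)) (≡.sym (total-inc _))) (∈-layer⁻ q∈)))

_⇒_ : Bool → Bool → Bool
true ⇒ b = b
false ⇒ _ = true

⇒-true : ∀ b → (b ⇒ true) ≡ true
⇒-true true = ≡.refl
⇒-true false = ≡.refl

findFalse : {X : Set} (L : List X) (β : X → Bool) →
            (∀ {x} → x ∈ L → β x ≡ true) ⊎ (∃ λ x → x ∈ L × β x ≡ false)
findFalse [] β = inj₁ λ ()
findFalse (x ∷ L) β with β x in eq | findFalse L β
... | false | _ = inj₂ (x , here ≡.refl , eq)
... | true  | inj₂ (y , y∈ , e) = inj₂ (y , there y∈ , e)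
... | true  | inj₁ h = inj₁ λ { (here ≡.refl) → eq ; (there y∈) → h y∈ }

_==V_ : ∀ {n} → Vec Bool n → Vec Bool n → Bool
[] ==V [] = true
(true ∷ I) ==V (true ∷ J) = I ==V J
(true ∷ I) ==V (false ∷ J) = false
(false ∷ I) ==V (true ∷ J) = false
(false ∷ I) ==V (false ∷ J) = I ==V J

==V-refl : ∀ {n} (I : Vec Bool n) → I ==V I ≡ true
==V-refl [] = ≡.refl
==V-refl (true ∷ I) = ==V-refl I
==V-refl (false ∷ I) = ==V-refl I

==V-sound : ∀ {n} (I J : Vec Bool n) → I ==V J ≡ true → I ≡ J
==V-sound [] [] _ = ≡.refl
==V-sound (true ∷ I) (true ∷ J) e = cong (true ∷_) (==V-sound I J e)
==V-sound (false ∷ I) (false ∷ J) e = cong (false ∷_) (==V-sound I J e)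

-- Being an order ideal is not decided directly; membership in a complete list of ideals serves as
-- its Boolean indicator.
member : ∀ {n} → Vec Bool n → List (Vec Bool n) → Bool
member I [] = false
member I (J ∷ Js) = (I ==V J) ∨ member I Js

member-sound : ∀ {n} (I : Vec Bool n) Js → member I Js ≡ true → I ∈ Js
member-sound I (J ∷ Js) e with I ==V J in eq
... | true = here (==V-sound I J eq)
... | false = there (member-sound I Js e)

member-complete : ∀ {n} (I : Vec Bool n) {Js} → I ∈ Js → member I Js ≡ true
member-complete I {J ∷ Js} (here ≡.refl) = cong (_∨ member I Js) (==V-refl I)
member-complete I {J ∷ Js} (there I∈) with I ==V J
... | true = ≡.refl
... | false = member-complete I I∈

-- Products over lists, and sums over bit vectors and subsets

module ProductsAndSums {c ℓ : Level} (K : CommutativeRing c ℓ) where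

  open CommutativeRing K hiding (zero)
  open import Relation.Binary.Reasoning.Setoid setoid
  open import Algebra.Properties.CommutativeSemigroup *-commutativeSemigroup
    using (x∙yz≈y∙xz) renaming (interchange to *-interchange)
  open import Algebra.Properties.CommutativeSemigroup (CommutativeMonoid.commutativeSemigroup +-commutativeMonoid)
    using () renaming (interchange to +-interchange)

  ∏ : {X : Set} → List X → (X → Carrier) → Carrier
  ∏ L h = prodK K (map h L)

  ∏-cong : {X : Set} (L : List X) {g h : X → Carrier} → (∀ {x} → x ∈ L → g x ≈ h x) → ∏ L g ≈ ∏ L h
  ∏-cong [] e = refl
  ∏-cong (x ∷ L) e = *-cong (e (here ≡.refl)) (∏-cong L (e ∘ there))

  ∏-* : {X : Set} (L : List X) {g h : X → Carrier} → ∏ L (λ x → g x * h x) ≈ ∏ L g * ∏ L h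
  ∏-* [] = sym (*-identityˡ 1#)
  ∏-* (x ∷ L) {g} {h} = begin
    (g x * h x) * ∏ L (λ x → g x * h x) ≈⟨ *-congˡ (∏-* L) ⟩
    (g x * h x) * (∏ L g * ∏ L h)       ≈⟨ *-interchange _ _ _ _ ⟩
    (g x * ∏ L g) * (h x * ∏ L h)       ∎

  ∏-1 : {X : Set} (L : List X) {h : X → Carrier} → (∀ {x} → x ∈ L → h x ≈ 1#) → ∏ L h ≈ 1#
  ∏-1 [] e = refl
  ∏-1 (x ∷ L) e = trans (*-cong (e (here ≡.refl)) (∏-1 L (e ∘ there))) (*-identityˡ 1#)

  ∏-0 : {X : Set} {L : List X} {x : X} {h : X → Carrier} → x ∈ L → h x ≈ 0# → ∏ L h ≈ 0#
  ∏-0 (here ≡.refl) e = trans (*-congʳ e) (zeroˡ _)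
  ∏-0 (there x∈) e = trans (*-congˡ (∏-0 x∈ e)) (zeroʳ _)

  ∏-++ : {X : Set} (L M : List X) {h : X → Carrier} → ∏ (L ++ M) h ≈ ∏ L h * ∏ M h
  ∏-++ [] M = sym (*-identityˡ _)
  ∏-++ (x ∷ L) M = trans (*-congˡ (∏-++ L M)) (sym (*-assoc _ _ _))

  ∏-map : {X Y : Set} (φ : X → Y) (L : List X) {h : Y → Carrier} → ∏ (map φ L) h ≡ ∏ L (h ∘ φ)
  ∏-map φ L = cong (prodK K) (≡.sym (ListP.map-∘ L))

  ∏-↭ : {X : Set} {L M : List X} {h : X → Carrier} → L ↭ M → ∏ L h ≈ ∏ M h
  ∏-↭ Perm.refl = refl
  ∏-↭ (Perm.prep x p) = *-congˡ (∏-↭ p)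
  ∏-↭ (Perm.swap x y p) = trans (*-congˡ (*-congˡ (∏-↭ p))) (x∙yz≈y∙xz _ _ _)
  ∏-↭ (Perm.trans p q) = trans (∏-↭ p) (∏-↭ q)

  -- The layer `suc n` consists of the image of `inc` and of a boundary on which `h′` is 1. Through
  -- this, products over Q_n, Q_{n+1} and Q_{n+2} all become products over one layer, where they are
  -- compared factor by factor.
  ∏-pull : {inc : Quad → Quad} → Split inc → (∀ q → total (inc q) ≡ suc (total q)) →
           (∀ {u v} → inc u ≡ inc v → u ≡ v) → ∀ n {h h′ : Quad → Carrier} →
           (∀ v → h′ (inc v) ≡ h v) → (∀ x → ¬ (∃ λ v → x ≡ inc v) → h′ x ≡ 1#) →
           ∏ (layer n) h ≈ ∏ (layer (suc n)) h′
  ∏-pull {inc} split total-inc inc-inj n {h} {h′} on off = begin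
    ∏ (layer n) h                              ≈⟨ ∏-cong (layer n) (λ _ → reflexive (≡.sym (on _))) ⟩
    ∏ (layer n) (h′ ∘ inc)                     ≡⟨ ∏-map inc (layer n) ⟨
    ∏ (map inc (layer n)) h′                   ≈⟨ *-identityʳ _ ⟨
    ∏ (map inc (layer n)) h′ * 1#              ≈⟨ *-congˡ (∏-1 rest (λ {x} x∈ → reflexive (off x (proj₂ (∈-filter⁻ out? {xs = layer (suc n)} x∈))))) ⟨
    ∏ (map inc (layer n)) h′ * ∏ rest h′       ≈⟨ ∏-++ (map inc (layer n)) rest ⟨
    ∏ (map inc (layer n) ++ rest) h′           ≈⟨ ∏-↭ (unique-↭ uniq (layer-unique (suc n)) to from) ⟩
    ∏ (layer (suc n)) h′                       ∎
    where
    out? = λ x → ¬? (split x)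
    rest = filter out? (layer (suc n))
    uniq : Unique (map inc (layer n) ++ rest)
    uniq = UniqueP.++⁺ (UniqueP.map⁺ inc-inj (layer-unique n)) (UniqueP.filter⁺ out? (layer-unique (suc n)))
      λ { (x∈ , y∈) → let v , _ , e = ∈-map⁻ inc x∈ in proj₂ (∈-filter⁻ out? {xs = layer (suc n)} y∈) (v , e) }
    to : ∀ {x} → x ∈ map inc (layer n) ++ rest → x ∈ layer (suc n)
    to x∈ with ∈-++⁻ (map inc (layer n)) x∈
    ... | inj₂ y∈ = proj₁ (∈-filter⁻ out? {xs = layer (suc n)} y∈)
    ... | inj₁ y∈ with ∈-map⁻ inc y∈
    ... | v , v∈ , ≡.refl = ∈-layer-inc⁺ inc total-inc v∈
    from : ∀ {x} → x ∈ layer (suc n) → x ∈ map inc (layer n) ++ rest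
    from {x} x∈ with split x
    ... | yes (v , ≡.refl) = ∈-++⁺ˡ (∈-map⁺ inc (∈-layer-inc⁻ inc total-inc x∈))
    ... | no ¬v = ∈-++⁺ʳ (map inc (layer n)) (∈-filter⁺ out? x∈ ¬v)

  ∏-dec₁ : ∀ n (h : Quad → Carrier) → ∏ (layer n) h ≈ ∏ (layer (suc n)) (dec₁ 1# h)
  ∏-dec₁ n h = ∏-pull split₁ total-inc₁ (λ { ≡.refl → ≡.refl }) n (λ _ → ≡.refl)
    λ { (zero , _) _ → ≡.refl ; (suc _ , _) ¬v → ⊥-elim (¬v (_ , ≡.refl)) }
  ∏-dec₂ : ∀ n (h : Quad → Carrier) → ∏ (layer n) h ≈ ∏ (layer (suc n)) (dec₂ 1# h)
  ∏-dec₂ n h = ∏-pull split₂ total-inc₂ (λ { ≡.refl → ≡.refl }) n (λ _ → ≡.refl)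
    λ { (_ , zero , _) _ → ≡.refl ; (_ , suc _ , _) ¬v → ⊥-elim (¬v (_ , ≡.refl)) }
  ∏-dec₃ : ∀ n (h : Quad → Carrier) → ∏ (layer n) h ≈ ∏ (layer (suc n)) (dec₃ 1# h)
  ∏-dec₃ n h = ∏-pull split₃ total-inc₃ (λ { ≡.refl → ≡.refl }) n (λ _ → ≡.refl)
    λ { (_ , _ , zero , _) _ → ≡.refl ; (_ , _ , suc _ , _) ¬v → ⊥-elim (¬v (_ , ≡.refl)) }
  ∏-dec₄ : ∀ n (h : Quad → Carrier) → ∏ (layer n) h ≈ ∏ (layer (suc n)) (dec₄ 1# h)
  ∏-dec₄ n h = ∏-pull split₄ total-inc₄ (λ { ≡.refl → ≡.refl }) n (λ _ → ≡.refl)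
    λ { (_ , _ , _ , zero) _ → ≡.refl ; (_ , _ , _ , suc _) ¬v → ⊥-elim (¬v (_ , ≡.refl)) }

  ∑V : ∀ n → (Vec Bool n → Carrier) → Carrier
  ∑V zero Φ = Φ []
  ∑V (suc n) Φ = ∑V n (Φ ∘ (false ∷_)) + ∑V n (Φ ∘ (true ∷_))

  ∑V-cong : ∀ n {Φ Ψ : Vec Bool n → Carrier} → (∀ I → Φ I ≈ Ψ I) → ∑V n Φ ≈ ∑V n Ψ
  ∑V-cong zero e = e []
  ∑V-cong (suc n) e = +-cong (∑V-cong n (e ∘ (false ∷_))) (∑V-cong n (e ∘ (true ∷_)))

  ∑V-+ : ∀ n (Φ Ψ : Vec Bool n → Carrier) → ∑V n (λ I → Φ I + Ψ I) ≈ ∑V n Φ + ∑V n Ψ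
  ∑V-+ zero Φ Ψ = refl
  ∑V-+ (suc n) Φ Ψ = trans (+-cong (∑V-+ n _ _) (∑V-+ n _ _)) (+-interchange _ _ _ _)

  ∑V-0 : ∀ n → ∑V n (λ _ → 0#) ≈ 0#
  ∑V-0 zero = refl
  ∑V-0 (suc n) = trans (+-cong (∑V-0 n) (∑V-0 n)) (+-identityˡ 0#)

  ∑V-single : ∀ {n} (I₀ : Vec Bool n) (W : Vec Bool n → Carrier) →
              ∑V n (λ I → if I ==V I₀ then W I else 0#) ≈ W I₀
  ∑V-single [] W = refl
  ∑V-single {suc n} (true ∷ I₀) W = trans (+-cong (∑V-0 n) (∑V-single I₀ (W ∘ (true ∷_)))) (+-identityˡ _)
  ∑V-single {suc n} (false ∷ I₀) W = trans (+-cong (∑V-single I₀ (W ∘ (false ∷_))) (∑V-0 n)) (+-identityʳ _)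

  -- Without repetitions at most one entry of `xs` equals a given `I`, so the indicators of the head
  -- and of the tail are never both true and add up to that of the whole list.
  ∑V-unique : ∀ {n} {xs : List (Vec Bool n)} → Unique xs → (W : Vec Bool n → Carrier) →
              sumK K (map W xs) ≈ ∑V n (λ I → if member I xs then W I else 0#)
  ∑V-unique {n} [] W = sym (∑V-0 n)
  ∑V-unique {n} {x ∷ xs} (x∉ ∷ u) W = begin
    W x + sumK K (map W xs)
      ≈⟨ +-cong (sym (∑V-single x W)) (∑V-unique u W) ⟩
    ∑V n (λ I → if I ==V x then W I else 0#) + ∑V n (λ I → if member I xs then W I else 0#)
      ≈⟨ ∑V-+ n _ _ ⟨
    ∑V n (λ I → (if I ==V x then W I else 0#) + (if member I xs then W I else 0#))
      ≈⟨ ∑V-cong n (λ I → merge (W I) (I ==V x) (member I xs) (disjoint I)) ⟩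
    ∑V n (λ I → if member I (x ∷ xs) then W I else 0#) ∎
    where
    disjoint : ∀ I → I ==V x ≡ true → member I xs ≡ true → ⊥
    disjoint I e m with ≡.refl ← ==V-sound I x e = All.lookup x∉ (member-sound I xs m) ≡.refl
    merge : ∀ w p q → (p ≡ true → q ≡ true → ⊥) →
            (if p then w else 0#) + (if q then w else 0#) ≈ (if p ∨ q then w else 0#)
    merge w true true d = ⊥-elim (d ≡.refl ≡.refl)
    merge w true false d = +-identityʳ w
    merge w false q d = +-identityˡ _

  module Subsets {X : Set} (_≟_ : DecidableEquality X) where

    insert : X → (X → Bool) → X → Bool
    insert x S y = does (y ≟ x) ∨ S y

    -- Subsets are Boolean functions on all of `X`, so that they can be evaluated at any neighbour
    -- of an element, inside the list or not.
    ∑⊆ : List X → ((X → Bool) → Carrier) → Carrier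
    ∑⊆ [] Φ = Φ (λ _ → false)
    ∑⊆ (x ∷ L) Φ = ∑⊆ L Φ + ∑⊆ L (Φ ∘ insert x)

    Supported : List X → (X → Bool) → Set
    Supported L S = ∀ {x} → x ∉ L → S x ≡ false

    insert-supported : ∀ {x L} S → Supported L S → Supported (x ∷ L) (insert x S)
    insert-supported {x} {L} S supp {y} y∉ with y ≟ x
    ... | yes y≡x = ⊥-elim (y∉ (here y≡x))
    ... | no _ = supp (y∉ ∘ there)

    insert-other : ∀ {x y S} → y ≢ x → insert x S y ≡ S y
    insert-other {x} {y} {S} y≢x = cong (_∨ S y) (dec-false (y ≟ x) y≢x)

    insert-self : ∀ {x S} → insert x S x ≡ true
    insert-self {x} {S} = cong (_∨ S x) (dec-true (x ≟ x) ≡.refl)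

    -- Only functions that vanish off `L` occur in the sum. This is what later recovers S and T from
    -- their union when they live on disjoint layers.
    ∑⊆-cong : ∀ L {Φ Ψ : (X → Bool) → Carrier} →
              (∀ S → Supported L S → Φ S ≈ Ψ S) → ∑⊆ L Φ ≈ ∑⊆ L Ψ
    ∑⊆-cong [] e = e _ (λ _ → ≡.refl)
    ∑⊆-cong (x ∷ L) e = +-cong (∑⊆-cong L λ S supp → e S (λ y∉ → supp (y∉ ∘ there)))
                               (∑⊆-cong L λ S supp → e _ (insert-supported S supp))

    ∑⊆-*ˡ : ∀ L k (Φ : (X → Bool) → Carrier) → ∑⊆ L (λ S → k * Φ S) ≈ k * ∑⊆ L Φ
    ∑⊆-*ˡ [] k Φ = refl
    ∑⊆-*ˡ (x ∷ L) k Φ = trans (+-cong (∑⊆-*ˡ L k Φ) (∑⊆-*ˡ L k _)) (sym (distribˡ _ _ _))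

    ∑⊆-+ : ∀ L (Φ Ψ : (X → Bool) → Carrier) → ∑⊆ L (λ S → Φ S + Ψ S) ≈ ∑⊆ L Φ + ∑⊆ L Ψ
    ∑⊆-+ [] Φ Ψ = refl
    ∑⊆-+ (x ∷ L) Φ Ψ = trans (+-cong (∑⊆-+ L Φ Ψ) (∑⊆-+ L _ _)) (+-interchange _ _ _ _)

    ∑⊆-swap : ∀ L M (Φ : (X → Bool) → (X → Bool) → Carrier) →
              ∑⊆ L (λ S → ∑⊆ M (Φ S)) ≈ ∑⊆ M (λ T → ∑⊆ L (λ S → Φ S T))
    ∑⊆-swap [] M Φ = refl
    ∑⊆-swap (x ∷ L) M Φ = trans (+-cong (∑⊆-swap L M Φ) (∑⊆-swap L M _)) (sym (∑⊆-+ M _ _))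

    -- Expanding the product on the right chooses, for each x, whether it lies in S. Uniqueness
    -- ensures that inserting x changes no other factor.
    ∑⊆-∏ : ∀ {L} → Unique L → (ζ : X → Bool → Carrier) →
           ∑⊆ L (λ S → ∏ L (λ x → ζ x (S x))) ≈ ∏ L (λ x → ζ x false + ζ x true)
    ∑⊆-∏ [] ζ = refl
    ∑⊆-∏ {x ∷ L} (x∉ ∷ uL) ζ = begin
      ∑⊆ L (λ S → ζ x (S x) * ∏L S) + ∑⊆ L (λ S → ζ x (insert x S x) * ∏L (insert x S))
        ≈⟨ +-cong (∑⊆-cong L λ S supp → *-congʳ (reflexive (cong (ζ x) (supp x∉L))))
                  (∑⊆-cong L λ S supp → *-cong (reflexive (cong (ζ x) (insert-self {S = S})))
                    (∏-cong L λ y∈ → reflexive (cong (ζ _) (insert-other {S = S} λ { ≡.refl → x∉L y∈ })))) ⟩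
      ∑⊆ L (λ S → ζ x false * ∏L S) + ∑⊆ L (λ S → ζ x true * ∏L S)
        ≈⟨ +-cong (∑⊆-*ˡ L _ _) (∑⊆-*ˡ L _ _) ⟩
      ζ x false * ∑⊆ L ∏L + ζ x true * ∑⊆ L ∏L
        ≈⟨ distribʳ _ _ _ ⟨
      (ζ x false + ζ x true) * ∑⊆ L ∏L
        ≈⟨ *-congˡ (∑⊆-∏ uL ζ) ⟩
      (ζ x false + ζ x true) * ∏ L (λ x → ζ x false + ζ x true) ∎
      where
      x∉L : x ∉ L
      x∉L x∈ = All.lookup x∉ x∈ ≡.refl
      ∏L : (X → Bool) → Carrier
      ∏L S = ∏ L (λ y → ζ y (S y))

    Respects : ((X → Bool) → Carrier) → Set ℓ
    Respects Φ = ∀ {S S′} → (∀ x → S x ≡ S′ x) → Φ S ≈ Φ S′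

    insert-respects : ∀ {Φ} x → Respects Φ → Respects (Φ ∘ insert x)
    insert-respects x resp e = resp (λ y → cong (does (y ≟ x) ∨_) (e y))

    ∑⊆-↭ : ∀ {L M} → L ↭ M → ∀ {Φ} → Respects Φ → ∑⊆ L Φ ≈ ∑⊆ M Φ
    ∑⊆-↭ Perm.refl resp = refl
    ∑⊆-↭ (Perm.prep x p) {Φ} resp = +-cong (∑⊆-↭ p resp) (∑⊆-↭ p (insert-respects {Φ} x resp))
    ∑⊆-↭ (Perm.swap {_} {M} x y p) {Φ} resp = trans (+-interchange _ _ _ _) (+-cong
      (+-cong (∑⊆-↭ p resp) (∑⊆-↭ p (insert-respects {Φ} x resp)))
      (+-cong (∑⊆-↭ p (insert-respects {Φ} y resp))
        (trans (∑⊆-↭ p (insert-respects {Φ ∘ insert x} y (insert-respects {Φ} x resp)))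
               (∑⊆-cong M λ S _ → resp λ z → ∨-swap (does (z ≟ x)) (does (z ≟ y)) (S z)))))
      where
      ∨-swap : ∀ p q r → p ∨ (q ∨ r) ≡ q ∨ (p ∨ r)
      ∨-swap true true r = ≡.refl
      ∨-swap true false r = ≡.refl
      ∨-swap false q r = ≡.refl
    ∑⊆-↭ (Perm.trans p q) resp = trans (∑⊆-↭ p resp) (∑⊆-↭ q resp)

    ∑⊆-++ : ∀ L M {Φ} → Respects Φ → ∑⊆ (L ++ M) Φ ≈ ∑⊆ L (λ S → ∑⊆ M (λ T → Φ (λ x → S x ∨ T x)))
    ∑⊆-++ [] M resp = refl
    ∑⊆-++ (x ∷ L) M {Φ} resp = +-cong (∑⊆-++ L M resp) (trans (∑⊆-++ L M (insert-respects {Φ} x resp))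
      (∑⊆-cong L λ S _ → ∑⊆-cong M λ T _ → resp λ y → ≡.sym (∨-assoc (does (y ≟ x)) (S y) (T y))))

    subsetOf : (L : List X) → Vec Bool (length L) → X → Bool
    subsetOf [] [] = λ _ → false
    subsetOf (x ∷ L) (true ∷ I) = insert x (subsetOf L I)
    subsetOf (x ∷ L) (false ∷ I) = subsetOf L I

    subsetOf-supported : ∀ L I → Supported L (subsetOf L I)
    subsetOf-supported [] [] _ = ≡.refl
    subsetOf-supported (x ∷ L) (true ∷ I) = insert-supported (subsetOf L I) (subsetOf-supported L I)
    subsetOf-supported (x ∷ L) (false ∷ I) y∉ = subsetOf-supported L I (y∉ ∘ there)

    subsetOf-lookup : ∀ {L} → Unique L → ∀ I a → subsetOf L I (List.lookup L a) ≡ Vec.lookup I a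
    subsetOf-lookup {x ∷ L} _ (true ∷ I) Fin.zero = insert-self {S = subsetOf L I}
    subsetOf-lookup {x ∷ L} (x∉ ∷ _) (false ∷ I) Fin.zero = subsetOf-supported L I (λ x∈ → All.lookup x∉ x∈ ≡.refl)
    subsetOf-lookup {x ∷ L} (x∉ ∷ u) (true ∷ I) (Fin.suc a) =
      ≡.trans (insert-other {S = subsetOf L I} (λ e → All.lookup x∉ (∈-lookup a) (≡.sym e))) (subsetOf-lookup u I a)
    subsetOf-lookup {x ∷ L} (_ ∷ u) (false ∷ I) (Fin.suc a) = subsetOf-lookup u I a

    ∑V-subsetOf : ∀ L (Φ : (X → Bool) → Carrier) → ∑V (length L) (Φ ∘ subsetOf L) ≈ ∑⊆ L Φ
    ∑V-subsetOf [] Φ = refl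
    ∑V-subsetOf (x ∷ L) Φ = +-cong (∑V-subsetOf L Φ) (∑V-subsetOf L (Φ ∘ insert x))

-- Urban renewal

⇒-∧ : ∀ s p q → (s ⇒ (p ∧ q)) ≡ (s ⇒ p) ∧ (s ⇒ q)
⇒-∧ true p q = ≡.refl
⇒-∧ false p q = ≡.refl

∨-⇒ : ∀ p q s → ((p ∨ q) ⇒ s) ≡ (p ⇒ s) ∧ (q ⇒ s)
∨-⇒ true true true = ≡.refl
∨-⇒ true true false = ≡.refl
∨-⇒ true false true = ≡.refl
∨-⇒ true false false = ≡.refl
∨-⇒ false q s = ≡.refl

module Weights {c ℓ : Level} (K : CommutativeRing c ℓ) where
  open CommutativeRing K hiding (zero)
  open ProductsAndSums K
  open Subsets _≟Q_
  open import Relation.Binary.Reasoning.Setoid setoid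
  open import Algebra.Solver.Ring.NaturalCoefficients.Default commutativeSemiring
    using (solve; _:+_; _:*_; _:=_; con)

  ind : Bool → Carrier
  ind true = 1#
  ind false = 0#

  infixr 8 _when_
  _when_ : Carrier → Bool → Carrier
  x when true = x
  x when false = 1#

  ind-∧ : ∀ p q → ind (p ∧ q) ≈ ind p * ind q
  ind-∧ true q = sym (*-identityˡ _)
  ind-∧ false q = sym (zeroˡ _)

  -- Closedness at an element is one implication per covering relation at that element, so its
  -- indicator is a product over the four neighbours.
  ind-closed : ∀ s p q r t → ind ((s ⇒ (p ∧ q)) ∧ ((r ∨ t) ⇒ s)) ≈
               (ind (s ⇒ p) * ind (s ⇒ q)) * (ind (r ⇒ s) * ind (t ⇒ s))
  ind-closed s p q r t = begin
    ind ((s ⇒ (p ∧ q)) ∧ ((r ∨ t) ⇒ s))                       ≡⟨ cong₂ (λ i j → ind (i ∧ j)) (⇒-∧ s p q) (∨-⇒ r t s) ⟩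
    ind (((s ⇒ p) ∧ (s ⇒ q)) ∧ ((r ⇒ s) ∧ (t ⇒ s)))           ≈⟨ ind-∧ ((s ⇒ p) ∧ (s ⇒ q)) _ ⟩
    ind ((s ⇒ p) ∧ (s ⇒ q)) * ind ((r ⇒ s) ∧ (t ⇒ s))         ≈⟨ *-cong (ind-∧ (s ⇒ p) _) (ind-∧ (r ⇒ s) _) ⟩
    (ind (s ⇒ p) * ind (s ⇒ q)) * (ind (r ⇒ s) * ind (t ⇒ s)) ∎

  -- S ∪ T, with S ⊆ Q_{n+1} and T ⊆ Q_n, is an order ideal iff every z ∈ Q_n is closedAt.
  closedAt : (Quad → Bool) → (Quad → Bool) → Quad → Bool
  closedAt S T z = (T z ⇒ (S (inc₁ z) ∧ S (inc₂ z))) ∧ ((S (inc₃ z) ∨ S (inc₄ z)) ⇒ T z)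

  -- The last argument says whether the upper r-neighbour is in T. In an ideal that neighbour forces
  -- v into S, so its weight can be charged to v.
  factor : Carrier → Carrier → Bool → Bool → Carrier
  factor a b true true = a
  factor a b true false = b
  factor a b false _ = 1#

  term : ℕ → (A B : Quad → Carrier) → (S T : Quad → Bool) → Carrier
  term n A B S T = ∏ (layer n) (λ z → ind (closedAt S T z))
                 * ∏ (layer (suc n)) (λ v → factor (A v) (B v) (S v) (dec₁ false T v))

  Z : ℕ → (A B : Quad → Carrier) → Carrier
  Z n A B = ∑⊆ (layer (suc n)) λ S → ∑⊆ (layer n) λ T → term n A B S T

  factor-cong : ∀ {a a′ b b′} s t → a ≈ a′ → b ≈ b′ → factor a b s t ≈ factor a′ b′ s t
  factor-cong true true e _ = e
  factor-cong true false _ e = e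
  factor-cong false _ _ _ = refl

  Z-cong : ∀ n {A A′ B B′ : Quad → Carrier} → (∀ q → A q ≈ A′ q) → (∀ q → B q ≈ B′ q) → Z n A B ≈ Z n A′ B′
  Z-cong n eA eB = ∑⊆-cong (layer (suc n)) λ S _ → ∑⊆-cong (layer n) λ T _ →
    *-congˡ (∏-cong (layer (suc n)) λ {v} _ → factor-cong (S v) (dec₁ false T v) (eA v) (eB v))

  module _ (n : ℕ) (S : Quad → Bool) where

    -- For x in Q_{n+2} these are the states of the elements of Q_{n+1} covering x (`A`, in
    -- direction r) and covered by x (`B`, in direction s). A missing cover counts as absent and a
    -- missing lower neighbour as present, so neither restricts x.
    A₁ A₂ B₁ B₂ : Quad → Bool
    A₁ = dec₁ false S
    A₂ = dec₂ false S
    B₁ = dec₃ true S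
    B₂ = dec₄ true S

    someA allB : Quad → Bool
    someA x = A₁ x ∨ A₂ x
    allB x = B₁ x ∧ B₂ x

    closedBelow : Quad → Bool → Bool
    closedBelow x σ = (σ ⇒ (B₁ x ∧ B₂ x)) ∧ ((A₁ x ∨ A₂ x) ⇒ σ)

    -- Each covering relation between Q_{n+1} and Q_{n+2} is counted once, whether it is grouped at
    -- its end in Q_{n+1} or at its end in Q_{n+2}.
    ∏-closedBelow : ∀ S′ → ∏ (layer (suc n)) (λ v → ind (closedAt S′ S v)) ≈
                           ∏ (layer (suc (suc n))) (λ x → ind (closedBelow x (S′ x)))
    ∏-closedBelow S′ = begin
      ∏ (layer (suc n)) (λ v → ind (closedAt S′ S v))
        ≈⟨ ∏-cong (layer (suc n)) (λ {v} _ → ind-closed (S v) _ _ (S′ (inc₃ v)) _) ⟩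
      ∏ (layer (suc n)) (λ v → (u₁ v * u₂ v) * (u₃ v * u₄ v))
        ≈⟨ trans (∏-* (layer (suc n))) (*-cong (∏-* (layer (suc n))) (∏-* (layer (suc n)))) ⟩
      (∏ (layer (suc n)) u₁ * ∏ (layer (suc n)) u₂) * (∏ (layer (suc n)) u₃ * ∏ (layer (suc n)) u₄)
        ≈⟨ *-cong (*-cong (∏-dec₁ (suc n) u₁) (∏-dec₂ (suc n) u₂)) (*-cong (∏-dec₃ (suc n) u₃) (∏-dec₄ (suc n) u₄)) ⟩
      (∏ L (dec₁ 1# u₁) * ∏ L (dec₂ 1# u₂)) * (∏ L (dec₃ 1# u₃) * ∏ L (dec₄ 1# u₄))
        ≈⟨ trans (∏-* L) (*-cong (∏-* L) (∏-* L)) ⟨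
      ∏ L (λ x → (dec₁ 1# u₁ x * dec₂ 1# u₂ x) * (dec₃ 1# u₃ x * dec₄ 1# u₄ x))
        ≈⟨ ∏-cong L (λ {x} _ → *-cong (reflexive (cong₂ _*_ (e₁ x) (e₂ x))) (reflexive (cong₂ _*_ (e₃ x) (e₄ x)))) ⟩
      ∏ L (λ x → (ind (A₁ x ⇒ S′ x) * ind (A₂ x ⇒ S′ x)) * (ind (S′ x ⇒ B₁ x) * ind (S′ x ⇒ B₂ x)))
        ≈⟨ ∏-cong L (λ {x} _ → trans (*-comm _ _) (sym (ind-closed (S′ x) _ _ (A₁ x) _))) ⟩
      ∏ L (λ x → ind (closedBelow x (S′ x))) ∎
      where
      L = layer (suc (suc n))
      u₁ u₂ u₃ u₄ : Quad → Carrier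
      u₁ v = ind (S v ⇒ S′ (inc₁ v))
      u₂ v = ind (S v ⇒ S′ (inc₂ v))
      u₃ v = ind (S′ (inc₃ v) ⇒ S v)
      u₄ v = ind (S′ (inc₄ v) ⇒ S v)
      e₁ : ∀ x → dec₁ 1# u₁ x ≡ ind (A₁ x ⇒ S′ x)
      e₁ (zero , _) = ≡.refl
      e₁ (suc _ , _) = ≡.refl
      e₂ : ∀ x → dec₂ 1# u₂ x ≡ ind (A₂ x ⇒ S′ x)
      e₂ (_ , zero , _) = ≡.refl
      e₂ (_ , suc _ , _) = ≡.refl
      e₃ : ∀ x → dec₃ 1# u₃ x ≡ ind (S′ x ⇒ B₁ x)
      e₃ x@(_ , _ , zero , _) = cong ind (≡.sym (⇒-true (S′ x)))
      e₃ (_ , _ , suc _ , _) = ≡.refl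
      e₄ : ∀ x → dec₄ 1# u₄ x ≡ ind (S′ x ⇒ B₂ x)
      e₄ x@(_ , _ , _ , zero) = cong ind (≡.sym (⇒-true (S′ x)))
      e₄ (_ , _ , _ , suc _) = ≡.refl

    -- The first summand is x left out of the ideal, which no element of S above x may forbid; the
    -- second is x put in, which needs everything below x.
    upper : (A B : Quad → Carrier) → Quad → Carrier
    upper A B x = ind (not (someA x)) + ind (allB x) * (if A₁ x then A x else B x)

    ∑-upper : ∀ A B → ∑⊆ (layer (suc (suc n))) (λ S′ → term (suc n) A B S′ S) ≈
                      ∏ (layer (suc (suc n))) (upper A B)
    ∑-upper A B = begin
      ∑⊆ L (λ S′ → term (suc n) A B S′ S)
        ≈⟨ ∑⊆-cong L (λ S′ _ → trans (*-congʳ (∏-closedBelow S′)) (sym (∏-* L))) ⟩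
      ∑⊆ L (λ S′ → ∏ L (λ x → ζ x (S′ x)))
        ≈⟨ ∑⊆-∏ (layer-unique _) ζ ⟩
      ∏ L (λ x → ζ x false + ζ x true)
        ≈⟨ ∏-cong L (λ {x} _ → +-cong (trans (*-identityʳ _) (out (A₁ x) (A₂ x))) (*-cong (inn (allB x) (someA x)) (fac (A₁ x)))) ⟩
      ∏ L (upper A B) ∎
      where
      L = layer (suc (suc n))
      ζ : Quad → Bool → Carrier
      ζ x σ = ind (closedBelow x σ) * factor (A x) (B x) σ (A₁ x)
      out : ∀ p q → ind ((p ∨ q) ⇒ false) ≈ ind (not (p ∨ q))
      out true q = refl
      out false true = refl
      out false false = refl
      inn : ∀ p q → ind (p ∧ (q ⇒ true)) ≈ ind p
      inn true true = refl
      inn true false = refl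
      inn false _ = refl
      fac : ∀ {a b} p → factor a b true p ≈ (if p then a else b)
      fac true = refl
      fac false = refl

    allA someB : Quad → Bool
    allA z = S (inc₁ z) ∧ S (inc₂ z)
    someB z = S (inc₃ z) ∨ S (inc₄ z)

    -- The part of the weight due to v ∈ Q_{n+1} whose neighbour v − (a₁-step) is not in Q_n.
    boundary : (B : Quad → Carrier) → Quad → Carrier
    boundary B = a₁=0 1# (λ v → B (inc₂ v) when S v)

    -- What z contributes once `A′ v` has been taken out for every v in S: leaving z out turns the
    -- weight of `inc₁ z` from `A′` into `B′`, which costs the ratio `B (inc₂ (inc₁ z))`.
    lower : (B : Quad → Carrier) → Quad → Carrier
    lower B z = ind (not (someB z)) * B (inc₂ (inc₁ z)) when S (inc₁ z) + ind (allA z)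

    -- Since `B′` is a multiple of `A′`, the factor `A′ v` occurs for every v in S whatever T is.
    -- The ratio left over depends on T only through the single z with `v = inc₁ z`, so the sum over
    -- T becomes local.
    ∑-lower : ∀ (A′ B′ B : Quad → Carrier) → (∀ v → B′ v ≈ A′ v * B (inc₂ v)) →
              ∑⊆ (layer n) (λ T → term n A′ B′ S T) ≈
              (∏ (layer (suc n)) (λ v → A′ v when S v) * ∏ (layer (suc n)) (boundary B)) * ∏ (layer n) (lower B)
    ∑-lower A′ B′ B B′≈ = begin
      ∑⊆ (layer n) (λ T → term n A′ B′ S T)
        ≈⟨ ∑⊆-cong (layer n) (λ T _ → termT T) ⟩
      ∑⊆ (layer n) (λ T → c₀ * ∏ (layer n) (λ z → ζ z (T z)))
        ≈⟨ ∑⊆-*ˡ (layer n) c₀ _ ⟩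
      c₀ * ∑⊆ (layer n) (λ T → ∏ (layer n) (λ z → ζ z (T z)))
        ≈⟨ *-congˡ (∑⊆-∏ (layer-unique n) ζ) ⟩
      c₀ * ∏ (layer n) (λ z → ζ z false + ζ z true)
        ≈⟨ *-congˡ (∏-cong (layer n) λ {z} _ → +-cong (out (someB z) (S (inc₁ z))) (inn (allA z) (someB z) (S (inc₁ z)))) ⟩
      c₀ * ∏ (layer n) (lower B) ∎
      where
      c₀ = ∏ (layer (suc n)) (λ v → A′ v when S v) * ∏ (layer (suc n)) (boundary B)
      w : (Quad → Bool) → Quad → Carrier
      w T z = B (inc₂ (inc₁ z)) when (S (inc₁ z) ∧ not (T z))
      ζ : Quad → Bool → Carrier
      ζ z τ = ind ((τ ⇒ allA z) ∧ (someB z ⇒ τ)) * B (inc₂ (inc₁ z)) when (S (inc₁ z) ∧ not τ)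
      out : ∀ {b} p s → ind (p ⇒ false) * b when (s ∧ true) ≈ ind (not p) * b when s
      out true true = refl
      out true false = refl
      out false true = refl
      out false false = refl
      inn : ∀ {b} p q s → ind (p ∧ (q ⇒ true)) * b when (s ∧ false) ≈ ind p
      inn false q true = *-identityʳ _
      inn false q false = *-identityʳ _
      inn true true true = *-identityʳ _
      inn true true false = *-identityʳ _
      inn true false true = *-identityʳ _
      inn true false false = *-identityʳ _
      split-factor : ∀ {a b′ b} → b′ ≈ a * b → ∀ s t → factor a b′ s t ≈ a when s * b when (s ∧ not t)
      split-factor e true true = sym (*-identityʳ _)
      split-factor e true false = e
      split-factor e false t = sym (*-identityˡ _)
      split-boundary : ∀ T v → B (inc₂ v) when (S v ∧ not (dec₁ false T v)) ≈ boundary B v * dec₁ 1# (w T) v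
      split-boundary T v@(zero , _) with S v
      ... | true = sym (*-identityʳ _)
      ... | false = sym (*-identityʳ _)
      split-boundary T (suc _ , _) = sym (*-identityˡ _)
      termT : ∀ T → term n A′ B′ S T ≈ c₀ * ∏ (layer n) (λ z → ζ z (T z))
      termT T = begin
        I * ∏ M (λ v → factor (A′ v) (B′ v) (S v) (dec₁ false T v))
          ≈⟨ *-congˡ (∏-cong M (λ {v} _ → trans (split-factor (B′≈ v) (S v) _) (*-congˡ (split-boundary T v)))) ⟩
        I * ∏ M (λ v → A′ v when S v * (boundary B v * dec₁ 1# (w T) v))
          ≈⟨ *-congˡ (trans (∏-* M) (*-congˡ (∏-* M))) ⟩
        I * (∏ M (λ v → A′ v when S v) * (∏ M (boundary B) * ∏ M (dec₁ 1# (w T))))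
          ≈⟨ *-congˡ (*-congˡ (*-congˡ (sym (∏-dec₁ n (w T))))) ⟩
        I * (∏ M (λ v → A′ v when S v) * (∏ M (boundary B) * ∏ (layer n) (w T)))
          ≈⟨ solve 4 (λ i a b d → i :* (a :* (b :* d)) := (a :* b) :* (i :* d)) refl I _ _ _ ⟩
        c₀ * (I * ∏ (layer n) (w T))
          ≈⟨ *-congˡ (sym (∏-* (layer n))) ⟩
        c₀ * ∏ (layer n) (λ z → ζ z (T z)) ∎
        where
        M = layer (suc n)
        I = ∏ (layer n) (λ z → ind (closedAt S T z))

  module _ (n : ℕ) (S : Quad → Bool) where

    ∏-when₁ : ∀ (H : Quad → Carrier) → ∏ (layer n) (λ v → H (inc₁ v) when S v) ≈ ∏ (layer (suc n)) (λ x → H x when dec₁ false S x)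
    ∏-when₁ H = trans (∏-dec₁ n _) (∏-cong (layer (suc n)) λ {x} _ → reflexive (e x))
      where
      e : ∀ x → dec₁ 1# (λ v → H (inc₁ v) when S v) x ≡ H x when dec₁ false S x
      e (zero , _) = ≡.refl
      e (suc _ , _) = ≡.refl
    ∏-when₂ : ∀ (H : Quad → Carrier) → ∏ (layer n) (λ v → H (inc₂ v) when S v) ≈ ∏ (layer (suc n)) (λ x → H x when dec₂ false S x)
    ∏-when₂ H = trans (∏-dec₂ n _) (∏-cong (layer (suc n)) λ {x} _ → reflexive (e x))
      where
      e : ∀ x → dec₂ 1# (λ v → H (inc₂ v) when S v) x ≡ H x when dec₂ false S x
      e (_ , zero , _) = ≡.refl
      e (_ , suc _ , _) = ≡.refl
    ∏-when₃ : ∀ (H : Quad → Carrier) → ∏ (layer n) (λ v → H (inc₃ v) when S v) ≈ ∏ (layer (suc n)) (λ x → H x when dec₃ false S x)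
    ∏-when₃ H = trans (∏-dec₃ n _) (∏-cong (layer (suc n)) λ {x} _ → reflexive (e x))
      where
      e : ∀ x → dec₃ 1# (λ v → H (inc₃ v) when S v) x ≡ H x when dec₃ false S x
      e (_ , _ , zero , _) = ≡.refl
      e (_ , _ , suc _ , _) = ≡.refl
    ∏-when₄ : ∀ (H : Quad → Carrier) → ∏ (layer n) (λ v → H (inc₄ v) when S v) ≈ ∏ (layer (suc n)) (λ x → H x when dec₄ false S x)
    ∏-when₄ H = trans (∏-dec₄ n _) (∏-cong (layer (suc n)) λ {x} _ → reflexive (e x))
      where
      e : ∀ x → dec₄ 1# (λ v → H (inc₄ v) when S v) x ≡ H x when dec₄ false S x
      e (_ , _ , _ , zero) = ≡.refl
      e (_ , _ , _ , suc _) = ≡.refl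

  when-* : ∀ a b s → (a * b) when s ≈ a when s * b when s
  when-* a b true = refl
  when-* a b false = sym (*-identityˡ _)

  when-cong : ∀ {a b} s → a ≈ b → a when s ≈ b when s
  when-cong true e = e
  when-cong false e = refl

  -- `C` is the inverse of `E`, supplied as data. The formula for `A′` is the mutation rule:
  -- r-neighbours contribute `1 / E`, s-neighbours contribute `E`. `E-level` will hold because the
  -- weights depend only on position, and a step forth and back in direction r or in direction s
  -- restores the position.
  module Reduction
    (A B A′ B′ E C : Quad → Carrier)
    (E≈1+B : ∀ x → E x ≈ 1# + B x)
    (C*E≈1 : ∀ x → C x * E x ≈ 1#)
    (E-level : ∀ z → E (inc₂ (inc₁ z)) ≈ E (inc₄ (inc₃ z)))
    (A′≈ : ∀ v → A′ v ≈ ((A (inc₁ v) * C (inc₁ v)) * C (inc₂ v)) * (E (inc₃ v) * E (inc₄ v)))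
    (B′≈ : ∀ v → B′ v ≈ A′ v * B (inc₂ v))
    (n : ℕ) where

    private
      L₂ : List Quad
      L₂ = layer (suc (suc n))

    corner : Quad → Carrier
    corner = b=0 1# E

    module _ (S : Quad → Bool) where

      lowerA lowerB : Quad → Carrier
      lowerA z = B (inc₂ (inc₁ z)) when (S (inc₁ z) ∧ not (S (inc₂ z))) * E (inc₂ (inc₁ z)) when allA n S z
      lowerB z = C (inc₄ (inc₃ z)) when someB n S z

      upperA : Quad → Carrier
      upperA x = C x when someA n S x * (A x when A₁ n S x * B x when (A₂ n S x ∧ not (A₁ n S x)))

      -- If nothing above x is in S and everything below is, x is free and contributes
      -- `1 + B x = E x`. If x is forced in, the factor `E x` is introduced and cancelled by `C x`.
      -- Now `E` depends on the s-neighbours alone, and the rest on the r-neighbours alone.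
      upper-factors : ∀ x → (someA n S x ⇒ allB n S x) ≡ true →
                      upper n S A B x ≈ upperA x * E x when allB n S x
      upper-factors x = go (A₁ n S x) (A₂ n S x) (allB n S x)
        where
        1+b : 1# + 1# * B x ≈ (1# * (1# * 1#)) * E x
        1+b = trans (solve 1 (λ b → con 1 :+ con 1 :* b := (con 1 :* (con 1 :* con 1)) :* (con 1 :+ b)) refl (B x))
                    (*-congˡ (sym (E≈1+B x)))
        cancel : ∀ a → 0# + 1# * a ≈ (C x * (a * 1#)) * E x
        cancel a = trans (solve 1 (λ a → con 0 :+ con 1 :* a := con 1 :* a) refl a)
                       (trans (*-congʳ (sym (C*E≈1 x)))
                       (solve 3 (λ a c e → c :* e :* a := (c :* (a :* con 1)) :* e) refl a (C x) (E x)))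
        cancel′ : ∀ b → 0# + 1# * b ≈ (C x * (1# * b)) * E x
        cancel′ b = trans (solve 1 (λ a → con 0 :+ con 1 :* a := con 1 :* a) refl b)
                    (trans (*-congʳ (sym (C*E≈1 x)))
                    (solve 3 (λ a c e → c :* e :* a := (c :* (con 1 :* a)) :* e) refl b (C x) (E x)))
        go : ∀ p q m → ((p ∨ q) ⇒ m) ≡ true →
             ind (not (p ∨ q)) + ind m * (if p then A x else B x) ≈
             (C x when (p ∨ q) * (A x when p * B x when (q ∧ not p))) * E x when m
        go true true true _ = cancel (A x)
        go true false true _ = cancel (A x)
        go true true false ()
        go true false false ()
        go false true true _ = cancel′ (B x)
        go false true false ()
        go false false true _ = 1+b
        go false false false _ = solve 1 (λ b → con 1 :+ con 0 :* b := con 1 :* (con 1 :* con 1) :* con 1) refl (B x)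

      -- The same separation at z, with the roles exchanged: a free z contributes `1 + B` at
      -- `inc₂ (inc₁ z)`, and a forced z contributes 1, written as `C` times `E`.
      lower-factors : ∀ z → (someB n S z ⇒ allA n S z) ≡ true → lower n S B z ≈ lowerA z * lowerB z
      lower-factors z = go (S (inc₁ z)) (S (inc₂ z)) (someB n S z)
        where
        b = B (inc₂ (inc₁ z))
        e = E (inc₂ (inc₁ z))
        c′ = C (inc₄ (inc₃ z))
        go : ∀ p q m → (m ⇒ (p ∧ q)) ≡ true →
             ind (not m) * b when p + ind (p ∧ q) ≈ (b when (p ∧ not q) * e when (p ∧ q)) * c′ when m
        go true true true _ = begin
          0# * b + 1#         ≈⟨ solve 1 (λ b → con 0 :* b :+ con 1 := con 1) refl b ⟩
          1#                  ≈⟨ C*E≈1 _ ⟨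
          -- The cancelling factors sit at different elements: `C` must be at `inc₄ (inc₃ z)` for
          -- `pointwise-B` and `E` at `inc₂ (inc₁ z)` for `pointwise-A`.
          c′ * E (inc₄ (inc₃ z)) ≈⟨ *-congˡ (E-level z) ⟨
          c′ * e              ≈⟨ solve 2 (λ c e → c :* e := con 1 :* e :* c) refl c′ e ⟩
          1# * e * c′         ∎
        go true true false _ = begin
          1# * b + 1#     ≈⟨ solve 1 (λ b → con 1 :* b :+ con 1 := con 1 :* (con 1 :+ b) :* con 1) refl b ⟩
          1# * (1# + b) * 1# ≈⟨ *-congʳ (*-congˡ (sym (E≈1+B _))) ⟩
          1# * e * 1#     ∎
        go true false true ()
        go true false false _ = solve 1 (λ b → con 1 :* b :+ con 0 := b :* con 1 :* con 1) refl b
        go false q true ()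
        go false q false _ = solve 0 (con 1 :* con 1 :+ con 0 := con 1 :* con 1 :* con 1) refl

      -- With p and q for the two covers of x, this is inclusion and exclusion: `C` to the power p
      -- or q equals `C` to the power p plus q, corrected by `E` when both hold. The correction
      -- belongs to the z with `x = inc₂ (inc₁ z)`; on the boundary no such z exists and p, q cannot
      -- both hold.
      pointwise-A : ∀ x → upperA x ≈
        ((A x when dec₁ false S x * C x when dec₁ false S x) * C x when dec₂ false S x)
        * (dec₂ 1# (boundary n S B) x * dec₂ 1# (dec₁ 1# lowerA) x)
      pointwise-A x@(zero , zero , _) = solve 0 (con 1 :* (con 1 :* con 1) := con 1 :* con 1 :* con 1 :* (con 1 :* con 1)) refl
      pointwise-A x@(zero , suc a₂ , b₁ , b₂) with S (zero , a₂ , b₁ , b₂)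
      ... | true = solve 2 (λ c b → c :* (con 1 :* b) := con 1 :* con 1 :* c :* (b :* con 1)) refl (C x) (B x)
      ... | false = solve 0 (con 1 :* (con 1 :* con 1) := con 1 :* con 1 :* con 1 :* (con 1 :* con 1)) refl
      pointwise-A x@(suc a₁ , zero , b₁ , b₂) with S (a₁ , zero , b₁ , b₂)
      ... | true = solve 2 (λ c a → c :* (a :* con 1) := a :* c :* con 1 :* (con 1 :* con 1)) refl (C x) (A x)
      ... | false = solve 0 (con 1 :* (con 1 :* con 1) := con 1 :* con 1 :* con 1 :* (con 1 :* con 1)) refl
      pointwise-A x@(suc a₁ , suc a₂ , b₁ , b₂) = go (S (a₁ , suc a₂ , b₁ , b₂)) (S (suc a₁ , a₂ , b₁ , b₂))
        where
        go : ∀ p q → C x when (p ∨ q) * (A x when p * B x when (q ∧ not p)) ≈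
             ((A x when p * C x when p) * C x when q) * (1# * (B x when (q ∧ not p) * E x when (q ∧ p)))
        go true true = begin
          C x * (A x * 1#) ≈⟨ solve 2 (λ c a → c :* (a :* con 1) := c :* a :* con 1) refl (C x) (A x) ⟩
          C x * A x * 1#   ≈⟨ *-congˡ (sym (C*E≈1 x)) ⟩
          C x * A x * (C x * E x) ≈⟨ solve 3 (λ c a e → c :* a :* (c :* e) := a :* c :* c :* (con 1 :* (con 1 :* e))) refl (C x) (A x) (E x) ⟩
          ((A x * C x) * C x) * (1# * (1# * E x)) ∎
        go true false = solve 2 (λ c a → c :* (a :* con 1) := a :* c :* con 1 :* (con 1 :* (con 1 :* con 1))) refl (C x) (A x)
        go false true = solve 2 (λ c b → c :* (con 1 :* b) := con 1 :* con 1 :* c :* (con 1 :* (b :* con 1))) refl (C x) (B x)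
        go false false = solve 0 (con 1 :* (con 1 :* con 1) := con 1 :* con 1 :* con 1 :* (con 1 :* (con 1 :* con 1))) refl

      -- Dual to `pointwise-A`: `E` when both lower neighbours are present is `E` for each one,
      -- corrected by `C` when at least one is. If x has no lower neighbours, `allB` is vacuously
      -- true and `E x` has nothing to match it; this is `corner`.
      pointwise-B : ∀ x → E x when allB n S x ≈
        (corner x * (E x when dec₃ false S x * E x when dec₄ false S x)) * dec₄ 1# (dec₃ 1# lowerB) x
      pointwise-B x@(_ , _ , zero , zero) = solve 1 (λ e → e := e :* (con 1 :* con 1) :* con 1) refl (E x)
      pointwise-B x@(a₁ , a₂ , zero , suc b₂) with S (a₁ , a₂ , zero , b₂)
      ... | true = solve 1 (λ e → e := con 1 :* (con 1 :* e) :* con 1) refl (E x)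
      ... | false = solve 0 (con 1 := con 1 :* (con 1 :* con 1) :* con 1) refl
      pointwise-B x@(a₁ , a₂ , suc b₁ , zero) with S (a₁ , a₂ , b₁ , zero)
      ... | true = solve 1 (λ e → e := con 1 :* (e :* con 1) :* con 1) refl (E x)
      ... | false = solve 0 (con 1 := con 1 :* (con 1 :* con 1) :* con 1) refl
      pointwise-B x@(a₁ , a₂ , suc b₁ , suc b₂) = go (S (a₁ , a₂ , b₁ , suc b₂)) (S (a₁ , a₂ , suc b₁ , b₂))
        where
        drop : 1# ≈ E x * C x
        drop = trans (sym (C*E≈1 x)) (*-comm _ _)
        go : ∀ p q → E x when (p ∧ q) ≈ (1# * (E x when p * E x when q)) * C x when (q ∨ p)
        go true true = begin
          E x             ≈⟨ *-identityʳ _ ⟨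
          E x * 1#        ≈⟨ *-congˡ drop ⟩
          E x * (E x * C x) ≈⟨ solve 2 (λ e c → e :* (e :* c) := con 1 :* (e :* e) :* c) refl (E x) (C x) ⟩
          (1# * (E x * E x)) * C x ∎
        go true false = trans drop (solve 2 (λ e c → e :* c := con 1 :* (e :* con 1) :* c) refl (E x) (C x))
        go false true = trans drop (solve 2 (λ e c → e :* c := con 1 :* (con 1 :* e) :* c) refl (E x) (C x))
        go false false = solve 0 (con 1 := con 1 :* (con 1 :* con 1) :* con 1) refl

      module _ (closed : ∀ {x} → x ∈ L₂ → (someA n S x ⇒ allB n S x) ≡ true) where

        -- The implications at z run from `inc₃ z` or `inc₄ z` to `inc₁ z` or `inc₂ z`. Each such
        -- pair consists of neighbours of one of the four elements of Q_{n+2} reached from z by one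
        -- r-step and one s-step, where the implication is known.
        closed-lower : ∀ {z} → z ∈ layer n → (someB n S z ⇒ allA n S z) ≡ true
        closed-lower {z} z∈ = combine (S (inc₃ z)) (S (inc₄ z)) (S (inc₁ z)) (S (inc₂ z))
          {o₄ = A₁ n S (inc₂ (inc₄ z))} {m₄ = B₁ n S (inc₂ (inc₄ z))}
          (closed (∈-layer-inc⁺ inc₁ total-inc₁ (∈-layer-inc⁺ inc₃ total-inc₃ z∈)))
          (closed (∈-layer-inc⁺ inc₂ total-inc₂ (∈-layer-inc⁺ inc₃ total-inc₃ z∈)))
          (closed (∈-layer-inc⁺ inc₁ total-inc₁ (∈-layer-inc⁺ inc₄ total-inc₄ z∈)))
          (closed (∈-layer-inc⁺ inc₂ total-inc₂ (∈-layer-inc⁺ inc₄ total-inc₄ z∈)))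
          where
          ∧-false : ∀ {o} → (o ∧ false) ≡ true → (false ≡ true)
          ∧-false {true} ()
          ∧-false {false} ()
          ∨-true : ∀ o {m} → ((o ∨ true) ⇒ m) ≡ true → m ≡ true
          ∨-true true e = e
          ∨-true false e = e
          combine : ∀ p₃ p₄ q₁ q₂ {o₁ o₂ o₃ o₄ m₁ m₂ m₃ m₄} →
            ((p₃ ∨ o₁) ⇒ (q₁ ∧ m₁)) ≡ true → ((o₂ ∨ p₃) ⇒ (q₂ ∧ m₂)) ≡ true →
            ((p₄ ∨ o₃) ⇒ (m₃ ∧ q₁)) ≡ true → ((o₄ ∨ p₄) ⇒ (m₄ ∧ q₂)) ≡ true →
            ((p₃ ∨ p₄) ⇒ (q₁ ∧ q₂)) ≡ true
          combine false false q₁ q₂ _ _ _ _ = ≡.refl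
          combine true p₄ true true _ _ _ _ = ≡.refl
          combine true p₄ true false {o₂ = o₂} _ e _ _ = ∨-true o₂ e
          combine true p₄ false q₂ () _ _ _
          combine false true true true _ _ _ _ = ≡.refl
          combine false true true false {o₄ = o₄} _ _ _ e = ∧-false (∨-true o₄ e)
          combine false true false q₂ _ _ e _ = ∧-false e

        closed-identity : ∏ L₂ (upper n S A B) ≈
          ∏ L₂ corner * ((∏ (layer (suc n)) (λ v → A′ v when S v) * ∏ (layer (suc n)) (boundary n S B)) * ∏ (layer n) (lower n S B))
        closed-identity = begin
          ∏ L₂ (upper n S A B)
            ≈⟨ trans (∏-cong L₂ (λ {x} x∈ → upper-factors x (closed x∈))) (∏-* L₂) ⟩
          ∏ L₂ upperA * ∏ L₂ (λ x → E x when allB n S x)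
            ≈⟨ *-cong (∏-cong L₂ λ {x} _ → pointwise-A x) (∏-cong L₂ λ {x} _ → pointwise-B x) ⟩
          ∏ L₂ (λ x → ((a₁ x * c₁ x) * c₂ x) * (dec₂ 1# (boundary n S B) x * dec₂ 1# (dec₁ 1# lowerA) x))
            * ∏ L₂ (λ x → (corner x * (e₃ x * e₄ x)) * dec₄ 1# (dec₃ 1# lowerB) x)
            ≈⟨ *-cong (trans (∏-* L₂) (*-cong (trans (∏-* L₂) (*-congʳ (∏-* L₂))) (∏-* L₂)))
                      (trans (∏-* L₂) (*-congʳ (trans (∏-* L₂) (*-congˡ (∏-* L₂))))) ⟩
          (((∏ L₂ a₁ * ∏ L₂ c₁) * ∏ L₂ c₂) * (∏ L₂ (dec₂ 1# (boundary n S B)) * ∏ L₂ (dec₂ 1# (dec₁ 1# lowerA))))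
            * ((∏ L₂ corner * (∏ L₂ e₃ * ∏ L₂ e₄)) * ∏ L₂ (dec₄ 1# (dec₃ 1# lowerB)))
            ≈⟨ *-cong (*-cong (*-cong (*-cong (∏-when₁ M S A) (∏-when₁ M S C)) (∏-when₂ M S C))
                              (*-cong (∏-dec₂ M _) (trans (∏-dec₁ n _) (∏-dec₂ M _))))
                      (*-cong (*-congˡ (*-cong (∏-when₃ M S E) (∏-when₄ M S E))) (trans (∏-dec₃ n _) (∏-dec₄ M _))) ⟨
          (((∏ (layer M) (λ v → A (inc₁ v) when S v) * ∏ (layer M) (λ v → C (inc₁ v) when S v)) * ∏ (layer M) (λ v → C (inc₂ v) when S v))
            * (∏ (layer M) (boundary n S B) * ∏ (layer n) lowerA))
            * ((∏ L₂ corner * (∏ (layer M) (λ v → E (inc₃ v) when S v) * ∏ (layer M) (λ v → E (inc₄ v) when S v))) * ∏ (layer n) lowerB)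
            ≈⟨ solve 9 (λ a c₁ c₂ bd la k e₃ e₄ lb →
                 (((a :* c₁) :* c₂) :* (bd :* la)) :* ((k :* (e₃ :* e₄)) :* lb) :=
                 k :* (((((a :* c₁) :* c₂) :* (e₃ :* e₄)) :* bd) :* (la :* lb))) refl _ _ _ _ _ _ _ _ _ ⟩
          ∏ L₂ corner * (((((∏ (layer M) (λ v → A (inc₁ v) when S v) * ∏ (layer M) (λ v → C (inc₁ v) when S v)) * ∏ (layer M) (λ v → C (inc₂ v) when S v))
            * (∏ (layer M) (λ v → E (inc₃ v) when S v) * ∏ (layer M) (λ v → E (inc₄ v) when S v)))
            * ∏ (layer M) (boundary n S B)) * (∏ (layer n) lowerA * ∏ (layer n) lowerB))
            ≈⟨ *-congˡ (*-cong (*-congʳ ∏A′) (trans (∏-cong (layer n) (λ {z} z∈ → lower-factors z (closed-lower z∈))) (∏-* (layer n)))) ⟨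
          ∏ L₂ corner * ((∏ (layer M) (λ v → A′ v when S v) * ∏ (layer M) (boundary n S B)) * ∏ (layer n) (lower n S B)) ∎
          where
          M = suc n
          a₁ c₁ c₂ e₃ e₄ : Quad → Carrier
          a₁ x = A x when dec₁ false S x
          c₁ x = C x when dec₁ false S x
          c₂ x = C x when dec₂ false S x
          e₃ x = E x when dec₃ false S x
          e₄ x = E x when dec₄ false S x
          ∏A′ : ∏ (layer M) (λ v → A′ v when S v) ≈
                ((∏ (layer M) (λ v → A (inc₁ v) when S v) * ∏ (layer M) (λ v → C (inc₁ v) when S v)) * ∏ (layer M) (λ v → C (inc₂ v) when S v))
                * (∏ (layer M) (λ v → E (inc₃ v) when S v) * ∏ (layer M) (λ v → E (inc₄ v) when S v))
          ∏A′ = begin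
            ∏ (layer M) (λ v → A′ v when S v)
              ≈⟨ ∏-cong (layer M) (λ {v} _ → trans (when-cong (S v) (A′≈ v)) (trans (when-* _ _ (S v))
                   (*-cong (trans (when-* _ _ (S v)) (*-congʳ (when-* _ _ (S v)))) (when-* _ _ (S v))))) ⟩
            ∏ (layer M) (λ v → ((A (inc₁ v) when S v * C (inc₁ v) when S v) * C (inc₂ v) when S v) * (E (inc₃ v) when S v * E (inc₄ v) when S v))
              ≈⟨ trans (∏-* (layer M)) (*-cong (trans (∏-* (layer M)) (*-congʳ (∏-* (layer M)))) (∏-* (layer M))) ⟩
            _ ∎

      Violation : Set
      Violation = ∃ λ z → z ∈ layer n × someB n S z ≡ true × allA n S z ≡ false

      -- A violated condition at x needs an actual cover in S and an actual lower neighbour outside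
      -- S, as the default values never violate. So x has both an r-step and an s-step to remove,
      -- which leads to z.
      violation : ∀ x → x ∈ L₂ → (someA n S x ⇒ allB n S x) ≡ false → Violation
      violation x x∈ e = go (A₁ n S x) (A₂ n S x) (B₁ n S x) (B₂ n S x) ≡.refl ≡.refl ≡.refl ≡.refl e
        where
        pred : ∀ {inc inc′} → (∀ q → total (inc q) ≡ suc (total q)) → (∀ q → total (inc′ q) ≡ suc (total q)) →
               ∀ {z} → inc (inc′ z) ∈ L₂ → z ∈ layer n
        pred {inc} {inc′} t t′ m = ∈-layer-inc⁻ inc′ t′ (∈-layer-inc⁻ inc t m)
        ∨-right : ∀ p {q} → q ≡ true → (p ∨ q) ≡ true
        ∨-right true _ = ≡.refl
        ∨-right false e = e
        ∧-right : ∀ p {q} → q ≡ false → (p ∧ q) ≡ false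
        ∧-right true e = e
        ∧-right false _ = ≡.refl
        v₁₃ : ∀ x → x ∈ L₂ → A₁ n S x ≡ true → B₁ n S x ≡ false → Violation
        v₁₃ (suc a₁ , a₂ , suc b₁ , b₂) m p q = (a₁ , a₂ , b₁ , b₂) , pred {inc₁} {inc₃} total-inc₁ total-inc₃ m
          , cong (_∨ S (a₁ , a₂ , b₁ , suc b₂)) p , cong (_∧ S (a₁ , suc a₂ , b₁ , b₂)) q
        v₁₄ : ∀ x → x ∈ L₂ → A₁ n S x ≡ true → B₂ n S x ≡ false → Violation
        v₁₄ (suc a₁ , a₂ , b₁ , suc b₂) m p q = (a₁ , a₂ , b₁ , b₂) , pred {inc₁} {inc₄} total-inc₁ total-inc₄ m
          , ∨-right (S (a₁ , a₂ , suc b₁ , b₂)) p , cong (_∧ S (a₁ , suc a₂ , b₁ , b₂)) q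
        v₂₃ : ∀ x → x ∈ L₂ → A₂ n S x ≡ true → B₁ n S x ≡ false → Violation
        v₂₃ (a₁ , suc a₂ , suc b₁ , b₂) m p q = (a₁ , a₂ , b₁ , b₂) , pred {inc₂} {inc₃} total-inc₂ total-inc₃ m
          , cong (_∨ S (a₁ , a₂ , b₁ , suc b₂)) p , ∧-right (S (suc a₁ , a₂ , b₁ , b₂)) q
        v₂₄ : ∀ x → x ∈ L₂ → A₂ n S x ≡ true → B₂ n S x ≡ false → Violation
        v₂₄ (a₁ , suc a₂ , b₁ , suc b₂) m p q = (a₁ , a₂ , b₁ , b₂) , pred {inc₂} {inc₄} total-inc₂ total-inc₄ m
          , ∨-right (S (a₁ , a₂ , suc b₁ , b₂)) p , ∧-right (S (suc a₁ , a₂ , b₁ , b₂)) q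
        go : ∀ p₁ p₂ q₁ q₂ → A₁ n S x ≡ p₁ → A₂ n S x ≡ p₂ → B₁ n S x ≡ q₁ → B₂ n S x ≡ q₂ →
             ((p₁ ∨ p₂) ⇒ (q₁ ∧ q₂)) ≡ false → Violation
        go true p₂ false q₂ e₁ e₂ e₃ e₄ _ = v₁₃ x x∈ e₁ e₃
        go true p₂ true false e₁ e₂ e₃ e₄ _ = v₁₄ x x∈ e₁ e₄
        go false true false q₂ e₁ e₂ e₃ e₄ _ = v₂₃ x x∈ e₂ e₃
        go false true true false e₁ e₂ e₃ e₄ _ = v₂₄ x x∈ e₂ e₄
        go true p₂ true true e₁ e₂ e₃ e₄ ()
        go false true true true e₁ e₂ e₃ e₄ ()
        go false false q₁ q₂ e₁ e₂ e₃ e₄ ()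

      upper-violated : ∀ x → (someA n S x ⇒ allB n S x) ≡ false → upper n S A B x ≈ 0#
      upper-violated x = go (someA n S x) (allB n S x)
        where
        go : ∀ p q {d} → (p ⇒ q) ≡ false → ind (not p) + ind q * d ≈ 0#
        go true false _ = trans (+-identityˡ _) (zeroˡ _)

      lower-violated : ∀ z → someB n S z ≡ true → allA n S z ≡ false → lower n S B z ≈ 0#
      lower-violated z = go (someB n S z) (allA n S z)
        where
        go : ∀ p q {d} → p ≡ true → q ≡ false → ind (not p) * d + ind q ≈ 0#
        go true false _ _ = trans (+-identityʳ _) (zeroˡ _)

      -- If S is not closed, then both sides vanish, because of the factors at x and at z.
      layer-identity : ∏ L₂ (upper n S A B) ≈
          ∏ L₂ corner * ((∏ (layer (suc n)) (λ v → A′ v when S v) * ∏ (layer (suc n)) (boundary n S B)) * ∏ (layer n) (lower n S B))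
      layer-identity with findFalse L₂ (λ x → someA n S x ⇒ allB n S x)
      ... | inj₁ closed = closed-identity closed
      ... | inj₂ (x , x∈ , e) with violation x x∈ e
      ... | z , z∈ , p , q = trans (∏-0 x∈ (upper-violated x e))
              (sym (trans (*-congˡ (trans (*-congˡ (∏-0 z∈ (lower-violated z p q))) (zeroʳ _))) (zeroʳ _)))

    reduction : Z (suc n) A B ≈ ∏ L₂ corner * Z n A′ B′
    reduction = begin
      Z (suc n) A B
        ≈⟨ ∑⊆-swap L₂ (layer (suc n)) (term (suc n) A B) ⟩
      ∑⊆ (layer (suc n)) (λ S → ∑⊆ L₂ (λ S′ → term (suc n) A B S′ S))
        ≈⟨ ∑⊆-cong (layer (suc n)) (λ S _ → trans (∑-upper n S A B) (trans (layer-identity S) (*-congˡ (sym (∑-lower n S A′ B′ B B′≈))))) ⟩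
      ∑⊆ (layer (suc n)) (λ S → ∏ L₂ corner * ∑⊆ (layer n) (λ T → term n A′ B′ S T))
        ≈⟨ ∑⊆-*ˡ (layer (suc n)) _ _ ⟩
      ∏ L₂ corner * Z n A′ B′ ∎

-- The recurrence

pos : ℤ → Quad → ℤ
pos j (a₁ , a₂ , b₁ , b₂) = (+ 3) ℤ.* (+ a₂ ℤ.- + a₁) ℤ.+ (+ b₂ ℤ.- + b₁) ℤ.+ j

pos-inc₁ : ∀ j q → pos j (inc₁ q) ≡ pos j q ℤ.+ -[1+ 2 ]
pos-inc₁ j (a₁ , a₂ , b₁ , b₂) = e j (+ a₁) (+ a₂) (+ b₁) (+ b₂)
  where
  e : ∀ j a₁ a₂ b₁ b₂ → (+ 3) ℤ.* (a₂ ℤ.- (+ 1 ℤ.+ a₁)) ℤ.+ (b₂ ℤ.- b₁) ℤ.+ j ≡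
                        (+ 3) ℤ.* (a₂ ℤ.- a₁) ℤ.+ (b₂ ℤ.- b₁) ℤ.+ j ℤ.+ -[1+ 2 ]
  e = solve-∀
pos-inc₂ : ∀ j q → pos j (inc₂ q) ≡ pos j q ℤ.+ + 3
pos-inc₂ j (a₁ , a₂ , b₁ , b₂) = e j (+ a₁) (+ a₂) (+ b₁) (+ b₂)
  where
  e : ∀ j a₁ a₂ b₁ b₂ → (+ 3) ℤ.* ((+ 1 ℤ.+ a₂) ℤ.- a₁) ℤ.+ (b₂ ℤ.- b₁) ℤ.+ j ≡
                        (+ 3) ℤ.* (a₂ ℤ.- a₁) ℤ.+ (b₂ ℤ.- b₁) ℤ.+ j ℤ.+ + 3
  e = solve-∀
pos-inc₃ : ∀ j q → pos j (inc₃ q) ≡ pos j q ℤ.+ -[1+ 0 ]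
pos-inc₃ j (a₁ , a₂ , b₁ , b₂) = e j (+ a₁) (+ a₂) (+ b₁) (+ b₂)
  where
  e : ∀ j a₁ a₂ b₁ b₂ → (+ 3) ℤ.* (a₂ ℤ.- a₁) ℤ.+ (b₂ ℤ.- (+ 1 ℤ.+ b₁)) ℤ.+ j ≡
                        (+ 3) ℤ.* (a₂ ℤ.- a₁) ℤ.+ (b₂ ℤ.- b₁) ℤ.+ j ℤ.+ -[1+ 0 ]
  e = solve-∀
pos-inc₄ : ∀ j q → pos j (inc₄ q) ≡ pos j q ℤ.+ + 1
pos-inc₄ j (a₁ , a₂ , b₁ , b₂) = e j (+ a₁) (+ a₂) (+ b₁) (+ b₂)
  where
  e : ∀ j a₁ a₂ b₁ b₂ → (+ 3) ℤ.* (a₂ ℤ.- a₁) ℤ.+ ((+ 1 ℤ.+ b₂) ℤ.- b₁) ℤ.+ j ≡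
                        (+ 3) ℤ.* (a₂ ℤ.- a₁) ℤ.+ (b₂ ℤ.- b₁) ℤ.+ j ℤ.+ + 1
  e = solve-∀

pos-origin : ∀ j → pos j (0 , 0 , 0 , 0) ≡ j
pos-origin j = ℤP.+-identityˡ j

shift-back : ∀ p a → p ℤ.+ ℤ.- a ℤ.+ a ≡ p
shift-back = solve-∀

pos-inc₁+3 : ∀ j q → pos j (inc₁ q) ℤ.+ + 3 ≡ pos j q
pos-inc₁+3 j q = ≡.trans (cong (ℤ._+ + 3) (pos-inc₁ j q)) (shift-back (pos j q) (+ 3))

pos-inc₂-inc₁ : ∀ j q → pos j (inc₂ (inc₁ q)) ≡ pos j q
pos-inc₂-inc₁ j q = ≡.trans (pos-inc₂ j (inc₁ q)) (pos-inc₁+3 j q)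

pos-inc₄-inc₃ : ∀ j q → pos j (inc₄ (inc₃ q)) ≡ pos j q
pos-inc₄-inc₃ j q = ≡.trans (pos-inc₄ j (inc₃ q)) (≡.trans (cong (ℤ._+ + 1) (pos-inc₃ j q)) (shift-back (pos j q) (+ 1)))

module Condensation {c ℓ : Level} (K : CommutativeRing c ℓ) where
  open CommutativeRing K hiding (zero)
  open ProductsAndSums K
  open Subsets _≟Q_
  open Weights K
  open import Relation.Binary.Reasoning.Setoid setoid
  open import Algebra.Solver.Ring.NaturalCoefficients.Default commutativeSemiring
    using (solve; _:+_; _:*_; _:=_; con)
  open import Algebra.Properties.CommutativeSemigroup *-commutativeSemigroup
    using () renaming (interchange to *-interchange)

  units : ∀ {s t u v} → s ≈ 1# → t ≈ 1# → u ≈ 1# → v ≈ 1# → (s * t) * (u * v) ≈ 1#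
  units s t u v = trans (*-cong (trans (*-cong s t) (*-identityˡ 1#)) (trans (*-cong u v) (*-identityˡ 1#))) (*-identityˡ 1#)

  module _ (j : ℤ) where

    -- The product of H over the row s = 0, r ∈ {−(n−2), −(n−4), …, n−2}, at position 3r + j.
    row : ℕ → (ℤ → Carrier) → Carrier
    row n H = ∏ (layer n) (b=0 1# (H ∘ pos j))

    b=0-cong : ∀ {g h : Quad → Carrier} → (∀ x → g x ≈ h x) → ∀ x → b=0 1# g x ≈ b=0 1# h x
    b=0-cong e x@(_ , _ , zero , zero) = e x
    b=0-cong e (_ , _ , zero , suc _) = refl
    b=0-cong e (_ , _ , suc _ , _) = refl

    row-cong : ∀ n {G H : ℤ → Carrier} → (∀ p → G p ≈ H p) → row n G ≈ row n H
    row-cong n e = ∏-cong (layer n) (λ {x} _ → b=0-cong (λ x → e (pos j x)) x)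

    row-* : ∀ n (G H : ℤ → Carrier) → row n (λ p → G p * H p) ≈ row n G * row n H
    row-* n G H = trans (∏-cong (layer n) (λ {x} _ → e x)) (∏-* (layer n))
      where
      e : ∀ x → b=0 1# (λ x → G (pos j x) * H (pos j x)) x ≈ b=0 1# (G ∘ pos j) x * b=0 1# (H ∘ pos j) x
      e (_ , _ , zero , zero) = refl
      e (_ , _ , zero , suc _) = sym (*-identityˡ _)
      e (_ , _ , suc _ , _) = sym (*-identityˡ _)

    row-1 : ∀ n {H : ℤ → Carrier} → (∀ p → H p ≈ 1#) → row n H ≈ 1#
    row-1 n e = ∏-1 (layer n) (λ {x} _ → trans (b=0-cong (λ x → e (pos j x)) x) (e′ x))
      where
      e′ : ∀ x → b=0 1# (λ _ → 1#) x ≈ 1#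
      e′ (_ , _ , zero , zero) = refl
      e′ (_ , _ , zero , suc _) = refl
      e′ (_ , _ , suc _ , _) = refl

    -- Shifting the row of length n + 1 by one step to either side covers the row of length n + 2
    -- once and its interior, the row of length n, a second time. The right endpoint, with a₁ = 0,
    -- is split off the long row and attached to the short one.
    row-condensation : ∀ n (H : ℤ → Carrier) →
      row (3 ℕ.+ n) H * row (1 ℕ.+ n) H ≈
      row (2 ℕ.+ n) (λ p → H (p ℤ.+ -[1+ 2 ])) * row (2 ℕ.+ n) (λ p → H (p ℤ.+ + 3))
    row-condensation n H = begin
      ∏ (layer (3 ℕ.+ n)) (b=0 1# h) * ∏ (layer (1 ℕ.+ n)) (b=0 1# h)
        ≈⟨ *-cong (trans (∏-cong (layer (3 ℕ.+ n)) (λ {x} x∈ → e x (∈-layer⁻ x∈)))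
                  (trans (∏-* (layer (3 ℕ.+ n))) (*-cong (sym (∏-dec₁ (2 ℕ.+ n) left)) (sym (∏-dec₂ (2 ℕ.+ n) end)))))
                  (trans (∏-cong (layer (1 ℕ.+ n)) (λ {x} _ → b=0-cong (λ x → reflexive (cong H (≡.sym (pos-inc₂-inc₁ j x)))) x)) (∏-dec₁ (1 ℕ.+ n) mid)) ⟩
      (∏ M left * ∏ M end) * ∏ M (dec₁ 1# mid)
        ≈⟨ solve 3 (λ l e m → l :* e :* m := l :* (m :* e)) refl _ _ _ ⟩
      ∏ M left * (∏ M (dec₁ 1# mid) * ∏ M end)
        ≈⟨ *-congˡ (sym (trans (∏-cong M (λ {x} _ → e′ x)) (∏-* M))) ⟩
      ∏ M left * ∏ M (b=0 1# (h ∘ inc₂))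
        ≈⟨ *-cong (∏-cong M λ {x} _ → b=0-cong (λ x → reflexive (cong H (pos-inc₁ j x))) x)
                  (∏-cong M λ {x} _ → b=0-cong (λ x → reflexive (cong H (pos-inc₂ j x))) x) ⟩
      row (2 ℕ.+ n) (λ p → H (p ℤ.+ -[1+ 2 ])) * row (2 ℕ.+ n) (λ p → H (p ℤ.+ + 3)) ∎
      where
      M = layer (2 ℕ.+ n)
      h left end mid : Quad → Carrier
      h = H ∘ pos j
      left = b=0 1# (h ∘ inc₁)
      end = a₁=0 1# (b=0 1# (h ∘ inc₂))
      mid = b=0 1# (h ∘ inc₂ ∘ inc₁)
      1*1 : 1# ≈ 1# * 1#
      1*1 = sym (*-identityˡ 1#)
      e : ∀ x → 2 ℕ.+ total x ≡ 3 ℕ.+ n → b=0 1# h x ≈ dec₁ 1# left x * dec₂ 1# end x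
      -- The origin has no step to remove, so the decomposition would fail there; it lies only in
      -- layer 2.
      e (zero , zero , zero , zero) ()
      e (zero , zero , zero , suc _) _ = 1*1
      e (zero , zero , suc _ , _) _ = 1*1
      e (zero , suc _ , zero , zero) _ = sym (*-identityˡ _)
      e (zero , suc _ , zero , suc _) _ = 1*1
      e (zero , suc _ , suc _ , _) _ = 1*1
      e (suc _ , zero , zero , zero) _ = sym (*-identityʳ _)
      e (suc _ , suc _ , zero , zero) _ = sym (*-identityʳ _)
      e (suc _ , zero , zero , suc _) _ = 1*1
      e (suc _ , suc _ , zero , suc _) _ = 1*1
      e (suc _ , zero , suc _ , _) _ = 1*1
      e (suc _ , suc _ , suc _ , _) _ = 1*1
      e′ : ∀ x → b=0 1# (h ∘ inc₂) x ≈ dec₁ 1# mid x * end x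
      e′ (zero , _ , zero , zero) = sym (*-identityˡ _)
      e′ (zero , _ , zero , suc _) = 1*1
      e′ (zero , _ , suc _ , _) = 1*1
      e′ (suc _ , _ , zero , zero) = sym (*-identityʳ _)
      e′ (suc _ , _ , zero , suc _) = 1*1
      e′ (suc _ , _ , suc _ , _) = 1*1

  module Recurrence
    (y : ℤ → Carrier)
    (f f⁻ : ℕ → ℤ → Carrier)
    (f*f⁻ : ∀ m p → f m p * f⁻ m p ≈ 1#)
    (f₀≈1 : ∀ p → f 0 p ≈ 1#)
    (f₁≈1 : ∀ p → f 1 p ≈ 1#)
    (f-rec : ∀ m p → f (2 ℕ.+ m) p * f m p ≈
       f (1 ℕ.+ m) (p ℤ.- + 3) * f (1 ℕ.+ m) (p ℤ.+ + 3)
       + (coeffProd K y p m * f (1 ℕ.+ m) (p ℤ.- + 1)) * f (1 ℕ.+ m) (p ℤ.+ + 1)) where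

    -- The weights after m steps. `b m` is the second term of the recurrence divided by the first.
    -- `E m` is `1 + b m` written as a quotient of values of `f`, so that its inverse `C m` is
    -- explicit. By `b-suc`, b over a at stage m + 1 is the previous b at `p + 3`; `α` is what is
    -- left of the y in `a` after cancelling, so no y is inverted.
    V V⁻ α a b E C : ℕ → ℤ → Carrier
    V m p = (f m (p ℤ.- + 1) * f m (p ℤ.+ + 1)) * (f⁻ m (p ℤ.- + 3) * f⁻ m (p ℤ.+ + 3))
    V⁻ m p = (f m (p ℤ.- + 3) * f m (p ℤ.+ + 3)) * (f⁻ m (p ℤ.- + 1) * f⁻ m (p ℤ.+ + 1))
    α zero p = y p * y (p ℤ.+ + 3)
    α (suc m) p = α m (p ℤ.- + 3)
    a m p = (α m p * V (suc m) p) * V⁻ m (p ℤ.+ + 3)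
    b m p = coeffProd K y p m * V (suc m) p
    E m p = (f (2 ℕ.+ m) p * f m p) * (f⁻ (1 ℕ.+ m) (p ℤ.- + 3) * f⁻ (1 ℕ.+ m) (p ℤ.+ + 3))
    C m p = (f (1 ℕ.+ m) (p ℤ.- + 3) * f (1 ℕ.+ m) (p ℤ.+ + 3)) * (f⁻ (2 ℕ.+ m) p * f⁻ m p)

    V*V⁻ : ∀ m p → V m p * V⁻ m p ≈ 1#
    V*V⁻ m p = begin
      V m p * V⁻ m p
        ≈⟨ solve 8 (λ a b c d a′ b′ c′ d′ → ((a :* b) :* (c′ :* d′)) :* ((c :* d) :* (a′ :* b′)) :=
             ((a :* a′) :* (b :* b′)) :* ((c :* c′) :* (d :* d′))) refl _ _ _ _ _ _ _ _ ⟩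
      ((f m (p ℤ.- + 1) * f⁻ m (p ℤ.- + 1)) * (f m (p ℤ.+ + 1) * f⁻ m (p ℤ.+ + 1)))
        * ((f m (p ℤ.- + 3) * f⁻ m (p ℤ.- + 3)) * (f m (p ℤ.+ + 3) * f⁻ m (p ℤ.+ + 3)))
        ≈⟨ units (f*f⁻ _ _) (f*f⁻ _ _) (f*f⁻ _ _) (f*f⁻ _ _) ⟩
      1# ∎

    E≈1+b : ∀ m p → E m p ≈ 1# + b m p
    E≈1+b m p = begin
      (f (2 ℕ.+ m) p * f m p) * (l⁻ * r⁻)  ≈⟨ *-congʳ (f-rec m p) ⟩
      (l * r + (Y * u) * v) * (l⁻ * r⁻)
        ≈⟨ solve 7 (λ l r Y u v l⁻ r⁻ → (l :* r :+ (Y :* u) :* v) :* (l⁻ :* r⁻) :=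
             (l :* l⁻) :* (r :* r⁻) :+ Y :* ((u :* v) :* (l⁻ :* r⁻))) refl l r Y u v l⁻ r⁻ ⟩
      (l * l⁻) * (r * r⁻) + b m p          ≈⟨ +-congʳ (trans (*-cong (f*f⁻ _ _) (f*f⁻ _ _)) (*-identityˡ 1#)) ⟩
      1# + b m p                           ∎
      where
      l r l⁻ r⁻ u v Y : Carrier
      l = f (1 ℕ.+ m) (p ℤ.- + 3)
      r = f (1 ℕ.+ m) (p ℤ.+ + 3)
      l⁻ = f⁻ (1 ℕ.+ m) (p ℤ.- + 3)
      r⁻ = f⁻ (1 ℕ.+ m) (p ℤ.+ + 3)
      u = f (1 ℕ.+ m) (p ℤ.- + 1)
      v = f (1 ℕ.+ m) (p ℤ.+ + 1)
      Y = coeffProd K y p m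

    C*E≈1 : ∀ m p → C m p * E m p ≈ 1#
    C*E≈1 m p = begin
      C m p * E m p
        ≈⟨ solve 8 (λ a b c d a′ b′ c′ d′ → ((a :* b) :* (c′ :* d′)) :* ((c :* d) :* (a′ :* b′)) :=
             ((a :* a′) :* (b :* b′)) :* ((c :* c′) :* (d :* d′))) refl _ _ _ _ _ _ _ _ ⟩
      _ ≈⟨ units (f*f⁻ _ _) (f*f⁻ _ _) (f*f⁻ _ _) (f*f⁻ _ _) ⟩
      1# ∎

    V-shift : ∀ m p d → V m (p ℤ.+ d) ≡
      (f m (p ℤ.+ (d ℤ.- + 1)) * f m (p ℤ.+ (d ℤ.+ + 1))) * (f⁻ m (p ℤ.+ (d ℤ.- + 3)) * f⁻ m (p ℤ.+ (d ℤ.+ + 3)))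
    V-shift m p d = cong₂ _*_ (cong₂ (λ u v → f m u * f m v) (ℤP.+-assoc p d _) (ℤP.+-assoc p d _))
                              (cong₂ (λ u v → f⁻ m u * f⁻ m v) (ℤP.+-assoc p d _) (ℤP.+-assoc p d _))

    V⁻-shift : ∀ m p d → V⁻ m (p ℤ.+ d) ≡
      (f m (p ℤ.+ (d ℤ.- + 3)) * f m (p ℤ.+ (d ℤ.+ + 3))) * (f⁻ m (p ℤ.+ (d ℤ.- + 1)) * f⁻ m (p ℤ.+ (d ℤ.+ + 1)))
    V⁻-shift m p d = cong₂ _*_ (cong₂ (λ u v → f m u * f m v) (ℤP.+-assoc p d _) (ℤP.+-assoc p d _))
                               (cong₂ (λ u v → f⁻ m u * f⁻ m v) (ℤP.+-assoc p d _) (ℤP.+-assoc p d _))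

    E-shift : ∀ m p d → E m (p ℤ.+ d) ≡
      (f (2 ℕ.+ m) (p ℤ.+ d) * f m (p ℤ.+ d)) * (f⁻ (1 ℕ.+ m) (p ℤ.+ (d ℤ.- + 3)) * f⁻ (1 ℕ.+ m) (p ℤ.+ (d ℤ.+ + 3)))
    E-shift m p d = cong ((f (2 ℕ.+ m) (p ℤ.+ d) * f m (p ℤ.+ d)) *_) (cong₂ (λ u v → f⁻ (1 ℕ.+ m) u * f⁻ (1 ℕ.+ m) v) (ℤP.+-assoc p d _) (ℤP.+-assoc p d _))

    C-shift : ∀ m p d → C m (p ℤ.+ d) ≡
      (f (1 ℕ.+ m) (p ℤ.+ (d ℤ.- + 3)) * f (1 ℕ.+ m) (p ℤ.+ (d ℤ.+ + 3))) * (f⁻ (2 ℕ.+ m) (p ℤ.+ d) * f⁻ m (p ℤ.+ d))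
    C-shift m p d = cong (_* (f⁻ (2 ℕ.+ m) (p ℤ.+ d) * f⁻ m (p ℤ.+ d))) (cong₂ (λ u v → f (1 ℕ.+ m) u * f (1 ℕ.+ m) v) (ℤP.+-assoc p d _) (ℤP.+-assoc p d _))

    -- The part of the mutation rule for `a` that is free of y: a monomial identity in values of `f`
    -- at levels m, m + 1 and m + 2.
    V-mutation : ∀ m p → V (2 ℕ.+ m) p * V⁻ (1 ℕ.+ m) (p ℤ.+ + 3) ≈
      (V (1 ℕ.+ m) (p ℤ.- + 3) * V⁻ m p)
      * ((C m (p ℤ.- + 3) * C m (p ℤ.+ + 3)) * (E m (p ℤ.- + 1) * E m (p ℤ.+ + 1)))
    V-mutation m p = begin
      V (2 ℕ.+ m) p * V⁻ (1 ℕ.+ m) (p ℤ.+ + 3)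
        ≡⟨ cong (V (2 ℕ.+ m) p *_) (V⁻-shift (1 ℕ.+ m) p (+ 3)) ⟩
      V (2 ℕ.+ m) p * ((h (+ 0) * h (+ 6)) * (h⁻ (+ 2) * h⁻ (+ 4)))
        ≈⟨ *-identityʳ _ ⟨
      (V (2 ℕ.+ m) p * ((h (+ 0) * h (+ 6)) * (h⁻ (+ 2) * h⁻ (+ 4)))) * 1#
        -- The eight products of a value with its inverse are exactly those that cancel on the
        -- right-hand side. Once they are inserted, the two sides are rearrangements of each other.
        ≈⟨ *-congˡ (sym (trans (*-cong (units (f*f⁻ _ _) (f*f⁻ _ _) (f*f⁻ _ _) (f*f⁻ _ _)) (units (f*f⁻ _ _) (f*f⁻ _ _) (f*f⁻ _ _) (f*f⁻ _ _))) (*-identityˡ 1#))) ⟩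
      (V (2 ℕ.+ m) p * ((h (+ 0) * h (+ 6)) * (h⁻ (+ 2) * h⁻ (+ 4))))
        * (((h -[1+ 3 ] * h⁻ -[1+ 3 ]) * (h -[1+ 1 ] * h⁻ -[1+ 1 ])) * ((h -[1+ 5 ] * h⁻ -[1+ 5 ]) * (h (+ 0) * h⁻ (+ 0)))
          * (((k -[1+ 2 ] * k⁻ -[1+ 2 ]) * (k (+ 3) * k⁻ (+ 3))) * ((k -[1+ 0 ] * k⁻ -[1+ 0 ]) * (k (+ 1) * k⁻ (+ 1)))))
        ≈⟨ CM.solve 23
             (λ g₋₁ g₁ g⁻₋₃ g⁻₃ h₋₆ h₋₄ h₋₂ h₀ h₆ h⁻₋₆ h⁻₋₄ h⁻₋₂ h⁻₀ h⁻₂ h⁻₄ k₋₃ k₋₁ k₁ k₃ k⁻₋₃ k⁻₋₁ k⁻₁ k⁻₃ →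
               ((((g₋₁ ⊕ g₁) ⊕ (g⁻₋₃ ⊕ g⁻₃)) ⊕ ((h₀ ⊕ h₆) ⊕ (h⁻₂ ⊕ h⁻₄)))
                 ⊕ ((((h₋₄ ⊕ h⁻₋₄) ⊕ (h₋₂ ⊕ h⁻₋₂)) ⊕ ((h₋₆ ⊕ h⁻₋₆) ⊕ (h₀ ⊕ h⁻₀)))
                   ⊕ (((k₋₃ ⊕ k⁻₋₃) ⊕ (k₃ ⊕ k⁻₃)) ⊕ ((k₋₁ ⊕ k⁻₋₁) ⊕ (k₁ ⊕ k⁻₁)))))
               ⊜
               ((((h₋₄ ⊕ h₋₂) ⊕ (h⁻₋₆ ⊕ h⁻₀)) ⊕ ((k₋₃ ⊕ k₃) ⊕ (k⁻₋₁ ⊕ k⁻₁)))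
                 ⊕ ((((h₋₆ ⊕ h₀) ⊕ (g⁻₋₃ ⊕ k⁻₋₃)) ⊕ ((h₀ ⊕ h₆) ⊕ (g⁻₃ ⊕ k⁻₃)))
                   ⊕ (((g₋₁ ⊕ k₋₁) ⊕ (h⁻₋₄ ⊕ h⁻₂)) ⊕ ((g₁ ⊕ k₁) ⊕ (h⁻₋₂ ⊕ h⁻₄))))))
             refl
             (g -[1+ 0 ]) (g (+ 1)) (g⁻ -[1+ 2 ]) (g⁻ (+ 3))
             (h -[1+ 5 ]) (h -[1+ 3 ]) (h -[1+ 1 ]) (h (+ 0)) (h (+ 6))
             (h⁻ -[1+ 5 ]) (h⁻ -[1+ 3 ]) (h⁻ -[1+ 1 ]) (h⁻ (+ 0)) (h⁻ (+ 2)) (h⁻ (+ 4))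
             (k -[1+ 2 ]) (k -[1+ 0 ]) (k (+ 1)) (k (+ 3)) (k⁻ -[1+ 2 ]) (k⁻ -[1+ 0 ]) (k⁻ (+ 1)) (k⁻ (+ 3)) ⟩
      (((h -[1+ 3 ] * h -[1+ 1 ]) * (h⁻ -[1+ 5 ] * h⁻ (+ 0))) * V⁻ m p)
      * ((((h -[1+ 5 ] * h (+ 0)) * (g⁻ -[1+ 2 ] * k⁻ -[1+ 2 ])) * ((h (+ 0) * h (+ 6)) * (g⁻ (+ 3) * k⁻ (+ 3))))
        * (((g -[1+ 0 ] * k -[1+ 0 ]) * (h⁻ -[1+ 3 ] * h⁻ (+ 2))) * ((g (+ 1) * k (+ 1)) * (h⁻ -[1+ 1 ] * h⁻ (+ 4)))))
        ≡⟨ cong₂ (λ u v → (u * V⁻ m p) * v) (V-shift (1 ℕ.+ m) p -[1+ 2 ])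
             (cong₂ _*_ (cong₂ _*_ (C-shift m p -[1+ 2 ]) (C-shift m p (+ 3))) (cong₂ _*_ (E-shift m p -[1+ 0 ]) (E-shift m p (+ 1)))) ⟨
      (V (1 ℕ.+ m) (p ℤ.- + 3) * V⁻ m p)
      * ((C m (p ℤ.- + 3) * C m (p ℤ.+ + 3)) * (E m (p ℤ.- + 1) * E m (p ℤ.+ + 1))) ∎
      where
      import Algebra.Solver.CommutativeMonoid *-commutativeMonoid as CM
      open CM using (_⊕_; _⊜_)
      g g⁻ h h⁻ k k⁻ : ℤ → Carrier
      g d = f (2 ℕ.+ m) (p ℤ.+ d)
      g⁻ d = f⁻ (2 ℕ.+ m) (p ℤ.+ d)
      h d = f (1 ℕ.+ m) (p ℤ.+ d)
      h⁻ d = f⁻ (1 ℕ.+ m) (p ℤ.+ d)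
      k d = f m (p ℤ.+ d)
      k⁻ d = f⁻ m (p ℤ.+ d)

    α-explicit : ∀ m p → α m p ≡ y (p ℤ.+ (+ 3) ℤ.* (+ 0 ℤ.- + m)) * y (p ℤ.+ (+ 3) ℤ.* (+ 1 ℤ.- + m))
    α-explicit zero p = cong (λ q → y q * y (p ℤ.+ + 3)) (≡.sym (ℤP.+-identityʳ p))
    α-explicit (suc m) p = ≡.trans (α-explicit m (p ℤ.- + 3)) (cong₂ (λ u v → y u * y v) (e p (+ 0) (+ m)) (e p (+ 1) (+ m)))
      where
      e : ∀ p i m → p ℤ.- + 3 ℤ.+ (+ 3) ℤ.* (i ℤ.- m) ≡ p ℤ.+ (+ 3) ℤ.* (i ℤ.- (+ 1 ℤ.+ m))
      e = solve-∀

    -- The two leftmost of the `2m + 3` factors form `α (suc m) p`; the remaining `2m + 1` are again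
    -- symmetric, about `p + 3`.
    coeffProd-suc : ∀ m p → coeffProd K y p (suc m) ≈ α (suc m) p * coeffProd K y (p ℤ.+ + 3) m
    coeffProd-suc m p = begin
      prodK K (map u (upTo (suc (2 ℕ.* suc m))))
        ≡⟨ cong (λ n → prodK K (map u (upTo (suc n)))) (cong suc (ℕP.+-suc m (m ℕ.+ 0))) ⟩
      u 0 * (u 1 * prodK K (map u (applyUpTo (suc ∘ suc) (suc (2 ℕ.* m)))))
        ≡⟨ cong (λ xs → u 0 * (u 1 * prodK K xs)) tails ⟩
      u 0 * (u 1 * coeffProd K y (p ℤ.+ + 3) m)
        ≈⟨ *-assoc _ _ _ ⟨
      (u 0 * u 1) * coeffProd K y (p ℤ.+ + 3) m
        ≡⟨ cong (_* coeffProd K y (p ℤ.+ + 3) m) (α-explicit (suc m) p) ⟨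
      α (suc m) p * coeffProd K y (p ℤ.+ + 3) m ∎
      where
      u : ℕ → Carrier
      u i = y (p ℤ.+ (+ 3) ℤ.* (+ i ℤ.- + suc m))
      e : ∀ p i m → p ℤ.+ (+ 3) ℤ.* ((+ 2 ℤ.+ i) ℤ.- (+ 1 ℤ.+ m)) ≡ p ℤ.+ + 3 ℤ.+ (+ 3) ℤ.* (i ℤ.- m)
      e = solve-∀
      tails : map u (applyUpTo (suc ∘ suc) (suc (2 ℕ.* m))) ≡
              map (λ i → y (p ℤ.+ + 3 ℤ.+ (+ 3) ℤ.* (+ i ℤ.- + m))) (upTo (suc (2 ℕ.* m)))
      tails = ≡.trans (ListP.map-applyUpTo (suc ∘ suc) u (suc (2 ℕ.* m)))
             (≡.trans (≡.sym (ListP.map-upTo (u ∘ suc ∘ suc) (suc (2 ℕ.* m))))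
                      (ListP.map-cong (λ i → cong y (e p (+ i) (+ m))) (upTo (suc (2 ℕ.* m)))))

    a-suc : ∀ m p → a (suc m) p ≈
      ((a m (p ℤ.- + 3) * C m (p ℤ.- + 3)) * C m (p ℤ.+ + 3)) * (E m (p ℤ.- + 1) * E m (p ℤ.+ + 1))
    a-suc m p = begin
      (α (suc m) p * V (2 ℕ.+ m) p) * V⁻ (1 ℕ.+ m) (p ℤ.+ + 3)
        ≈⟨ *-assoc _ _ _ ⟩
      α (suc m) p * (V (2 ℕ.+ m) p * V⁻ (1 ℕ.+ m) (p ℤ.+ + 3))
        ≈⟨ *-congˡ (V-mutation m p) ⟩
      α (suc m) p * ((V (1 ℕ.+ m) (p ℤ.- + 3) * V⁻ m p) * ((C m (p ℤ.- + 3) * C m (p ℤ.+ + 3)) * (E m (p ℤ.- + 1) * E m (p ℤ.+ + 1))))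
        ≈⟨ solve 7 (λ α v v⁻ c₁ c₂ e₁ e₂ → α :* ((v :* v⁻) :* ((c₁ :* c₂) :* (e₁ :* e₂))) :=
             (((α :* v) :* v⁻) :* c₁) :* c₂ :* (e₁ :* e₂)) refl _ _ _ _ _ _ _ ⟩
      ((((α m (p ℤ.- + 3) * V (1 ℕ.+ m) (p ℤ.- + 3)) * V⁻ m p) * C m (p ℤ.- + 3)) * C m (p ℤ.+ + 3)) * (E m (p ℤ.- + 1) * E m (p ℤ.+ + 1))
        ≡⟨ cong (λ q → ((((α m (p ℤ.- + 3) * V (1 ℕ.+ m) (p ℤ.- + 3)) * V⁻ m q) * C m (p ℤ.- + 3)) * C m (p ℤ.+ + 3)) * (E m (p ℤ.- + 1) * E m (p ℤ.+ + 1)))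
             (shift-back p (+ 3)) ⟨
      ((a m (p ℤ.- + 3) * C m (p ℤ.- + 3)) * C m (p ℤ.+ + 3)) * (E m (p ℤ.- + 1) * E m (p ℤ.+ + 1)) ∎

    b-suc : ∀ m p → b (suc m) p ≈ a (suc m) p * b m (p ℤ.+ + 3)
    b-suc m p = begin
      coeffProd K y p (suc m) * V (2 ℕ.+ m) p
        ≈⟨ *-congʳ (coeffProd-suc m p) ⟩
      (α (suc m) p * Y) * V (2 ℕ.+ m) p
        ≈⟨ *-identityʳ _ ⟨
      ((α (suc m) p * Y) * V (2 ℕ.+ m) p) * 1#
        -- The inserted unit splits into the factor `V⁻` missing from `a (suc m) p` and the factor
        -- `V` missing from `b m q`.
        ≈⟨ *-congˡ (V*V⁻ (1 ℕ.+ m) q) ⟨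
      ((α (suc m) p * Y) * V (2 ℕ.+ m) p) * (V (1 ℕ.+ m) q * V⁻ (1 ℕ.+ m) q)
        ≈⟨ solve 5 (λ α Y v w w⁻ → ((α :* Y) :* v) :* (w :* w⁻) := ((α :* v) :* w⁻) :* (Y :* w)) refl _ _ _ _ _ ⟩
      a (suc m) p * b m q ∎
      where
      q = p ℤ.+ + 3
      Y = coeffProd K y q m

    module _ (j : ℤ) where

      Zₘ : ℕ → ℕ → Carrier
      Zₘ m n = Z n (a m ∘ pos j) (b m ∘ pos j)

      Zₘ-reduction : ∀ m n → Zₘ m (suc n) ≈ row j (2 ℕ.+ n) (E m) * Zₘ (suc m) n
      Zₘ-reduction m n = Reduction.reduction (a m ∘ pos j) (b m ∘ pos j) (a (suc m) ∘ pos j) (b (suc m) ∘ pos j)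
        (E m ∘ pos j) (C m ∘ pos j) (λ x → E≈1+b m (pos j x)) (λ x → C*E≈1 m (pos j x))
        (λ z → reflexive (cong (E m) (≡.trans (pos-inc₂-inc₁ j z) (≡.sym (pos-inc₄-inc₃ j z)))))
        (λ v → trans (a-suc m (pos j v)) (reflexive (cong₂ _*_
          (cong₂ _*_ (cong₂ _*_ (cong (a m) (≡.sym (pos-inc₁ j v))) (cong (C m) (≡.sym (pos-inc₁ j v)))) (cong (C m) (≡.sym (pos-inc₂ j v))))
          (cong₂ _*_ (cong (E m) (≡.sym (pos-inc₃ j v))) (cong (E m) (≡.sym (pos-inc₄ j v)))))))
        (λ v → trans (b-suc m (pos j v)) (*-congˡ (reflexive (cong (b m) (≡.sym (pos-inc₂ j v))))))
        n

      row-unit : ∀ m n → row j n (f m) * row j n (f⁻ m) ≈ 1#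
      row-unit m n = trans (sym (row-* j n (f m) (f⁻ m))) (row-1 j n {λ p → f m p * f⁻ m p} (f*f⁻ m))

      -- `E m` has the values of `f (1 + m)` at `p - 3` and `p + 3` in its denominator; by
      -- `row-condensation` their rows amount to one longer and one shorter row at p itself.
      row-E : ∀ m n → row j (2 ℕ.+ n) (E m) * row j (3 ℕ.+ n) (f (1 ℕ.+ m)) ≈
              row j (2 ℕ.+ n) (f (2 ℕ.+ m)) * row j (2 ℕ.+ n) (f m) * row j (1 ℕ.+ n) (f⁻ (1 ℕ.+ m))
      row-E m n = begin
        row j (2 ℕ.+ n) (E m) * X
          ≈⟨ *-identityʳ _ ⟨
        row j (2 ℕ.+ n) (E m) * X * 1#
          ≈⟨ *-congˡ (row-unit (1 ℕ.+ m) (1 ℕ.+ n)) ⟨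
        row j (2 ℕ.+ n) (E m) * X * (W * W⁻)
          ≈⟨ solve 4 (λ e x w w⁻ → e :* x :* (w :* w⁻) := e :* (x :* w) :* w⁻) refl _ X W W⁻ ⟩
        row j (2 ℕ.+ n) (E m) * (X * W) * W⁻
          ≈⟨ *-congʳ (*-congˡ (trans (row-condensation j n (f (1 ℕ.+ m))) (sym (row-* j (2 ℕ.+ n) ends₋ ends₊)))) ⟩
        row j (2 ℕ.+ n) (E m) * row j (2 ℕ.+ n) (λ p → f (1 ℕ.+ m) (p ℤ.- + 3) * f (1 ℕ.+ m) (p ℤ.+ + 3)) * W⁻
          ≈⟨ *-congʳ (row-* j (2 ℕ.+ n) (E m) (λ p → ends₋ p * ends₊ p)) ⟨
        row j (2 ℕ.+ n) (λ p → E m p * (f (1 ℕ.+ m) (p ℤ.- + 3) * f (1 ℕ.+ m) (p ℤ.+ + 3))) * W⁻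
          ≈⟨ *-congʳ (row-cong j (2 ℕ.+ n) clear) ⟩
        row j (2 ℕ.+ n) (λ p → f (2 ℕ.+ m) p * f m p) * W⁻
          ≈⟨ *-congʳ (row-* j (2 ℕ.+ n) (f (2 ℕ.+ m)) (f m)) ⟩
        row j (2 ℕ.+ n) (f (2 ℕ.+ m)) * row j (2 ℕ.+ n) (f m) * W⁻ ∎
        where
        X W W⁻ : Carrier
        X = row j (3 ℕ.+ n) (f (1 ℕ.+ m))
        W = row j (1 ℕ.+ n) (f (1 ℕ.+ m))
        W⁻ = row j (1 ℕ.+ n) (f⁻ (1 ℕ.+ m))
        ends₋ ends₊ : ℤ → Carrier
        ends₋ p = f (1 ℕ.+ m) (p ℤ.- + 3)
        ends₊ p = f (1 ℕ.+ m) (p ℤ.+ + 3)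
        clear : ∀ p → E m p * (f (1 ℕ.+ m) (p ℤ.- + 3) * f (1 ℕ.+ m) (p ℤ.+ + 3)) ≈ f (2 ℕ.+ m) p * f m p
        clear p = begin
          _ ≈⟨ solve 5 (λ g l⁻ r⁻ l r → (g :* (l⁻ :* r⁻)) :* (l :* r) := g :* ((l :* l⁻) :* (r :* r⁻))) refl _ _ _ _ _ ⟩
          _ ≈⟨ *-congˡ (trans (*-cong (f*f⁻ (1 ℕ.+ m) (p ℤ.- + 3)) (f*f⁻ (1 ℕ.+ m) (p ℤ.+ + 3))) (*-identityˡ 1#)) ⟩
          (f (2 ℕ.+ m) p * f m p) * 1# ≈⟨ *-identityʳ _ ⟩
          f (2 ℕ.+ m) p * f m p ∎

      -- Carrying two rows makes the constants telescope: by `row-E`, one step replaces the pair of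
      -- rows of `f (1 + m)` and `f m` by the pair, each shorter by one, of `f (2 + m)` and
      -- `f (1 + m)`. At m = 0 both rows consist of ones.
      Zₘ-value : ∀ n m → Zₘ m n * row j (2 ℕ.+ n) (f (1 ℕ.+ m)) ≈
                 f (1 ℕ.+ (n ℕ.+ m)) j * row j (1 ℕ.+ n) (f m)
      Zₘ-value zero m = begin
        Zₘ m 0 * row j 2 (f (1 ℕ.+ m))
          ≈⟨ *-cong Z₀ row₂ ⟩
        1# * f (1 ℕ.+ m) j
          ≈⟨ *-comm _ _ ⟩
        f (1 ℕ.+ m) j * 1#
          ≈⟨ *-congˡ row₁ ⟨
        f (1 ℕ.+ m) j * row j 1 (f m) ∎
        where
        Z₀ : Zₘ m 0 ≈ 1#
        -- P_0 is empty, so only the empty ideal contributes.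
        Z₀ rewrite layer-0 | layer-1 = *-identityˡ 1#
        row₂ : row j 2 (f (1 ℕ.+ m)) ≈ f (1 ℕ.+ m) j
        row₂ rewrite layer-2 = trans (*-identityʳ _) (reflexive (cong (f (1 ℕ.+ m)) (pos-origin j)))
        row₁ : row j 1 (f m) ≈ 1#
        row₁ rewrite layer-1 = refl
      Zₘ-value (suc n) m = begin
        Zₘ m (suc n) * row j (3 ℕ.+ n) (f (1 ℕ.+ m))
          ≈⟨ *-congʳ (Zₘ-reduction m n) ⟩
        row j (2 ℕ.+ n) (E m) * Zₘ (suc m) n * row j (3 ℕ.+ n) (f (1 ℕ.+ m))
          ≈⟨ solve 3 (λ e z r → e :* z :* r := z :* (e :* r)) refl _ _ _ ⟩
        Zₘ (suc m) n * (row j (2 ℕ.+ n) (E m) * row j (3 ℕ.+ n) (f (1 ℕ.+ m)))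
          ≈⟨ *-congˡ (row-E m n) ⟩
        Zₘ (suc m) n * (row j (2 ℕ.+ n) (f (2 ℕ.+ m)) * row j (2 ℕ.+ n) (f m) * W⁻)
          ≈⟨ solve 4 (λ z g h w → z :* (g :* h :* w) := (z :* g) :* h :* w) refl _ _ _ _ ⟩
        (Zₘ (suc m) n * row j (2 ℕ.+ n) (f (2 ℕ.+ m))) * row j (2 ℕ.+ n) (f m) * W⁻
          ≈⟨ *-congʳ (*-congʳ (Zₘ-value n (suc m))) ⟩
        (f (1 ℕ.+ (n ℕ.+ suc m)) j * W) * row j (2 ℕ.+ n) (f m) * W⁻
          ≈⟨ solve 4 (λ g w h w⁻ → (g :* w) :* h :* w⁻ := g :* h :* (w :* w⁻)) refl _ W _ W⁻ ⟩
        f (1 ℕ.+ (n ℕ.+ suc m)) j * row j (2 ℕ.+ n) (f m) * (W * W⁻)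
          ≈⟨ trans (*-congˡ (row-unit (1 ℕ.+ m) (1 ℕ.+ n))) (*-identityʳ _) ⟩
        f (1 ℕ.+ (n ℕ.+ suc m)) j * row j (2 ℕ.+ n) (f m)
          ≡⟨ cong (λ k → f (1 ℕ.+ k) j * row j (2 ℕ.+ n) (f m)) (ℕP.+-suc n m) ⟩
        f (2 ℕ.+ (n ℕ.+ m)) j * row j (2 ℕ.+ n) (f m) ∎
        where
        W W⁻ : Carrier
        W = row j (1 ℕ.+ n) (f (1 ℕ.+ m))
        W⁻ = row j (1 ℕ.+ n) (f⁻ (1 ℕ.+ m))

      f-as-Z : ∀ n → f (suc n) j ≈ Z n (λ q → y (pos j q) * y (pos j q ℤ.+ + 3)) (y ∘ pos j)
      f-as-Z n = begin
        f (1 ℕ.+ n) j                                 ≡⟨ cong (λ k → f (1 ℕ.+ k) j) (ℕP.+-identityʳ n) ⟨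
        f (1 ℕ.+ (n ℕ.+ 0)) j                         ≈⟨ *-identityʳ _ ⟨
        f (1 ℕ.+ (n ℕ.+ 0)) j * 1#                    ≈⟨ *-congˡ (row-1 j (1 ℕ.+ n) f₀≈1) ⟨
        f (1 ℕ.+ (n ℕ.+ 0)) j * row j (1 ℕ.+ n) (f 0) ≈⟨ Zₘ-value n 0 ⟨
        Zₘ 0 n * row j (2 ℕ.+ n) (f 1)                ≈⟨ *-congˡ (row-1 j (2 ℕ.+ n) f₁≈1) ⟩
        Zₘ 0 n * 1#                                   ≈⟨ *-identityʳ _ ⟩
        Zₘ 0 n                                        ≈⟨ Z-cong n (λ q → a₀ (pos j q)) (λ q → b₀ (pos j q)) ⟩
        Z n (λ q → y (pos j q) * y (pos j q ℤ.+ + 3)) (y ∘ pos j) ∎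
        where
        f⁻≈1 : ∀ m → (∀ p → f m p ≈ 1#) → ∀ p → f⁻ m p ≈ 1#
        f⁻≈1 m e p = trans (sym (*-identityˡ _)) (trans (*-congʳ (sym (e p))) (f*f⁻ m p))
        V₁ : ∀ p → V 1 p ≈ 1#
        V₁ p = units (f₁≈1 _) (f₁≈1 _) (f⁻≈1 1 f₁≈1 _) (f⁻≈1 1 f₁≈1 _)
        V⁻₀ : ∀ p → V⁻ 0 p ≈ 1#
        V⁻₀ p = units (f₀≈1 _) (f₀≈1 _) (f⁻≈1 0 f₀≈1 _) (f⁻≈1 0 f₀≈1 _)
        a₀ : ∀ p → a 0 p ≈ y p * y (p ℤ.+ + 3)
        a₀ p = trans (*-cong (trans (*-congˡ (V₁ p)) (*-identityʳ _)) (V⁻₀ (p ℤ.+ + 3))) (*-identityʳ _)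
        b₀ : ∀ p → b 0 p ≈ y p
        b₀ p = trans (*-cong (*-identityʳ _) (V₁ p)) (trans (*-identityʳ _) (reflexive (cong y (ℤP.+-identityʳ p))))

-- Integer coordinates

_≟T_ : DecidableEquality Triple
_≟T_ = ×P.≡-dec ℤP._≟_ (×P.≡-dec ℤP._≟_ ℤP._≟_)

toTriple : Quad → Triple
toTriple (a₁ , a₂ , b₁ , b₂) = + a₂ ℤ.- + a₁ , + b₂ ℤ.- + b₁ , + (b₁ ℕ.+ b₂) ℤ.- + (a₁ ℕ.+ a₂)

difference-cong : ∀ {a b c d e f} → + a ℤ.- + b ≡ + c ℤ.- + d ℤ.+ (+ e ℤ.- + f) → a ℕ.+ (d ℕ.+ f) ≡ c ℕ.+ (b ℕ.+ e)
difference-cong {a} {b} {c} {d} {e} {f} eq = ℤP.+-injective (begin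
  + a ℤ.+ (+ d ℤ.+ + f)                              ≡⟨ l (+ a) (+ b) (+ d) (+ f) ⟩
  + a ℤ.- + b ℤ.+ (+ b ℤ.+ + d ℤ.+ + f)                          ≡⟨ cong (ℤ._+ _) eq ⟩
  + c ℤ.- + d ℤ.+ (+ e ℤ.- + f) ℤ.+ (+ b ℤ.+ + d ℤ.+ + f) ≡⟨ r (+ b) (+ c) (+ d) (+ e) (+ f) ⟩
  + c ℤ.+ (+ b ℤ.+ + e)                              ∎)
  where
  open ≡-Reasoning
  l : ∀ a b d f → a ℤ.+ (d ℤ.+ f) ≡ a ℤ.- b ℤ.+ (b ℤ.+ d ℤ.+ f)
  l = solve-∀
  r : ∀ b c d e f → c ℤ.- d ℤ.+ (e ℤ.- f) ℤ.+ (b ℤ.+ d ℤ.+ f) ≡ c ℤ.+ (b ℤ.+ e)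
  r = solve-∀

double-injective : ∀ m n → m ℕ.+ m ≡ n ℕ.+ n → m ≡ n
double-injective zero zero _ = ≡.refl
double-injective (suc m) (suc n) e = cong suc (double-injective m n (ℕP.suc-injective
  (≡.trans (≡.sym (ℕP.+-suc m m)) (≡.trans (ℕP.suc-injective e) (ℕP.+-suc n n)))))

even≢odd : ∀ m n → m ℕ.+ m ≢ suc (n ℕ.+ n)
even≢odd (suc m) zero e with () ← ≡.trans (≡.sym (ℕP.+-suc m m)) (ℕP.suc-injective e)
even≢odd (suc m) (suc n) e = even≢odd m n (ℕP.suc-injective
  (≡.trans (≡.sym (ℕP.+-suc m m)) (≡.trans (ℕP.suc-injective e) (cong suc (ℕP.+-suc n n)))))

-- With x = a₁ + a₂ and u = b₁ + b₂, the coordinate t is u − x.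
same-level : ∀ {x u x′ u′} → u ℕ.+ x′ ≡ u′ ℕ.+ x → x ℕ.+ u ≡ x′ ℕ.+ u′ → x ≡ x′ × u ≡ u′
same-level {x} {u} {x′} {u′} e f = ℕP.+-cancelʳ-≡ u x x′ (≡.trans f (cong (x′ ℕ.+_) (≡.sym u≡u′))) , u≡u′
  where
  l : ∀ x u x′ → (u ℕ.+ u) ℕ.+ (x ℕ.+ x′) ≡ (u ℕ.+ x′) ℕ.+ (x ℕ.+ u)
  l = ℕSolver.solve-∀
  r : ∀ x x′ u′ → (u′ ℕ.+ x) ℕ.+ (x′ ℕ.+ u′) ≡ (u′ ℕ.+ u′) ℕ.+ (x ℕ.+ x′)
  r = ℕSolver.solve-∀
  u≡u′ : u ≡ u′
  u≡u′ = double-injective u u′ (ℕP.+-cancelʳ-≡ (x ℕ.+ x′) _ _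
    (≡.trans (l x u x′) (≡.trans (cong₂ ℕ._+_ e f) (r x x′ u′))))

-- Parity: `x + u` is congruent to `u - x` modulo 2, so elements of consecutive layers never have
-- the same t.
different-level : ∀ {x u x′ u′} → u ℕ.+ x′ ≡ u′ ℕ.+ x → x ℕ.+ u ≢ suc (x′ ℕ.+ u′)
different-level {x} {u} {x′} {u′} e f = even≢odd u u′ (ℕP.+-cancelʳ-≡ (x ℕ.+ x′) _ _
    (≡.trans (l x u x′) (≡.trans (cong₂ ℕ._+_ e f) (r x x′ u′))))
  where
  l : ∀ x u x′ → (u ℕ.+ u) ℕ.+ (x ℕ.+ x′) ≡ (u ℕ.+ x′) ℕ.+ (x ℕ.+ u)
  l = ℕSolver.solve-∀
  r : ∀ x x′ u′ → (u′ ℕ.+ x) ℕ.+ suc (x′ ℕ.+ u′) ≡ suc (u′ ℕ.+ u′) ℕ.+ (x ℕ.+ x′)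
  r = ℕSolver.solve-∀

PairDistance : (a₁ a₂ a₁′ a₂′ : ℕ) → ℕ
PairDistance a₁ a₂ a₁′ a₂′ = ∣ (+ a₂′ ℤ.- + a₁′) ℤ.- (+ a₂ ℤ.- + a₁) ∣

private
  2+≰1 : ∀ {n} → ¬ (suc (suc n) ℕ.≤ 1)
  2+≰1 (ℕ.s≤s ())

-- With the sum fixed, moving the first entry by `1 + o` moves the difference by `2 + 2o`, which is
-- more than 1.
same-sum : ∀ a₁ a₂ a₁′ a₂′ → a₁′ ℕ.+ a₂′ ≡ a₁ ℕ.+ a₂ → PairDistance a₁ a₂ a₁′ a₂′ ℕ.≤ 1 →
           a₁′ ≡ a₁ × a₂′ ≡ a₂
same-sum a₁ a₂ a₁′ a₂′ sum near with ℕP.<-cmp a₁ a₁′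
... | tri≈ _ ≡.refl _ = ≡.refl , ℕP.+-cancelˡ-≡ a₁ a₂′ a₂ sum
... | tri< lt _ _ with ℕP.m≤n⇒∃[o]m+o≡n lt
... | o , ≡.refl = ⊥-elim (2+≰1 (subst (ℕ._≤ 1) far near))
  where
  i : ∀ a o b → suc a ℕ.+ o ℕ.+ b ≡ a ℕ.+ (suc o ℕ.+ b)
  i = ℕSolver.solve-∀
  a₂≡ : a₂ ≡ suc o ℕ.+ a₂′
  a₂≡ = ℕP.+-cancelˡ-≡ a₁ _ _ (≡.trans (≡.sym sum) (i a₁ o a₂′))
  z : ∀ a o b → (b ℤ.- ((+ 1 ℤ.+ a) ℤ.+ o)) ℤ.- (((+ 1 ℤ.+ o) ℤ.+ b) ℤ.- a) ≡ ℤ.- (+ 2 ℤ.+ (o ℤ.+ o))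
  z = solve-∀
  far : PairDistance a₁ a₂ a₁′ a₂′ ≡ suc (suc (o ℕ.+ o))
  far = ≡.trans (cong (λ a₂ → PairDistance a₁ a₂ a₁′ a₂′) a₂≡) (cong ∣_∣ (z (+ a₁) (+ o) (+ a₂′)))
same-sum a₁ a₂ a₁′ a₂′ sum near | tri> _ _ gt with ℕP.m≤n⇒∃[o]m+o≡n gt
... | o , ≡.refl = ⊥-elim (2+≰1 (subst (ℕ._≤ 1) far near))
  where
  i : ∀ a o b → suc a ℕ.+ o ℕ.+ b ≡ a ℕ.+ (suc o ℕ.+ b)
  i = ℕSolver.solve-∀
  a₂′≡ : a₂′ ≡ suc o ℕ.+ a₂
  a₂′≡ = ℕP.+-cancelˡ-≡ a₁′ _ _ (≡.trans sum (i a₁′ o a₂))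
  z : ∀ a o b → (((+ 1 ℤ.+ o) ℤ.+ b) ℤ.- a) ℤ.- (b ℤ.- ((+ 1 ℤ.+ a) ℤ.+ o)) ≡ + 2 ℤ.+ (o ℤ.+ o)
  z = solve-∀
  far : PairDistance a₁ a₂ a₁′ a₂′ ≡ suc (suc (o ℕ.+ o))
  far = ≡.trans (cong (λ a₂′ → PairDistance a₁ a₂ a₁′ a₂′) a₂′≡) (cong ∣_∣ (z (+ a₁′) (+ o) (+ a₂)))

-- The sum changes by an odd amount, hence so does the difference. Any choice other than raising
-- exactly one entry by 1 moves the difference by at least 3.
suc-sum : ∀ b₁ b₂ b₁′ b₂′ → b₁′ ℕ.+ b₂′ ≡ suc (b₁ ℕ.+ b₂) → PairDistance b₁ b₂ b₁′ b₂′ ℕ.≤ 1 →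
          (b₁′ ≡ suc b₁ × b₂′ ≡ b₂) ⊎ (b₁′ ≡ b₁ × b₂′ ≡ suc b₂)
suc-sum b₁ b₂ b₁′ b₂′ sum near with ℕP.<-cmp b₁ b₁′
... | tri≈ _ ≡.refl _ = inj₂ (≡.refl , ℕP.+-cancelˡ-≡ b₁ _ _ (≡.trans sum (≡.sym (ℕP.+-suc b₁ b₂))))
... | tri< lt _ _ with ℕP.m≤n⇒∃[o]m+o≡n lt
... | zero , ≡.refl = inj₁ (cong suc (ℕP.+-identityʳ b₁) , ℕP.+-cancelˡ-≡ (suc b₁ ℕ.+ 0) _ _ (≡.trans sum (cong (λ b → suc (b ℕ.+ b₂)) (≡.sym (ℕP.+-identityʳ b₁)))))
... | suc o , ≡.refl = ⊥-elim (2+≰1 (subst (ℕ._≤ 1) far near))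
  where
  i : ∀ a o b → suc a ℕ.+ suc o ℕ.+ b ≡ suc (a ℕ.+ (suc o ℕ.+ b))
  i = ℕSolver.solve-∀
  b₂≡ : b₂ ≡ suc o ℕ.+ b₂′
  b₂≡ = ℕP.+-cancelˡ-≡ b₁ _ _ (ℕP.suc-injective (≡.trans (≡.sym sum) (i b₁ o b₂′)))
  z : ∀ a o b → (b ℤ.- ((+ 1 ℤ.+ a) ℤ.+ (+ 1 ℤ.+ o))) ℤ.- (((+ 1 ℤ.+ o) ℤ.+ b) ℤ.- a) ≡ ℤ.- (+ 3 ℤ.+ (o ℤ.+ o))
  z = solve-∀
  far : PairDistance b₁ b₂ b₁′ b₂′ ≡ suc (suc (suc (o ℕ.+ o)))
  far = ≡.trans (cong (λ b₂ → PairDistance b₁ b₂ b₁′ b₂′) b₂≡) (cong ∣_∣ (z (+ b₁) (+ o) (+ b₂′)))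
suc-sum b₁ b₂ b₁′ b₂′ sum near | tri> _ _ gt with ℕP.m≤n⇒∃[o]m+o≡n gt
... | o , ≡.refl = ⊥-elim (2+≰1 (subst (ℕ._≤ 1) far near))
  where
  i : ∀ a o b → suc (suc a ℕ.+ o ℕ.+ b) ≡ a ℕ.+ (suc (suc o) ℕ.+ b)
  i = ℕSolver.solve-∀
  b₂′≡ : b₂′ ≡ suc (suc o) ℕ.+ b₂
  b₂′≡ = ℕP.+-cancelˡ-≡ b₁′ _ _ (≡.trans sum (i b₁′ o b₂))
  z : ∀ a o b → (((+ 2 ℤ.+ o) ℤ.+ b) ℤ.- a) ℤ.- (b ℤ.- ((+ 1 ℤ.+ a) ℤ.+ o)) ≡ + 3 ℤ.+ (o ℤ.+ o)
  z = solve-∀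
  far : PairDistance b₁ b₂ b₁′ b₂′ ≡ suc (suc (suc (o ℕ.+ o)))
  far = ≡.trans (cong (λ b₂′ → PairDistance b₁ b₂ b₁′ b₂′) b₂′≡) (cong ∣_∣ (z (+ b₁′) (+ o) (+ b₂)))

2+-injective : ∀ {i k} → 2 ℕ.+ i ≡ 2 ℕ.+ k → i ≡ k
2+-injective ≡.refl = ≡.refl

poset : ℕ → List Quad
poset m = layer (suc m) ++ layer m

toTriple-injective : ∀ m {q q′} → q ∈ poset m → q′ ∈ poset m → toTriple q ≡ toTriple q′ → q ≡ q′
toTriple-injective m {q@(a₁ , a₂ , b₁ , b₂)} {q′@(a₁′ , a₂′ , b₁′ , b₂′)} q∈ q′∈ eq =
  go (∈-++⁻ (layer (suc m)) q∈) (∈-++⁻ (layer (suc m)) q′∈)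
  where
  x = a₁ ℕ.+ a₂
  x′ = a₁′ ℕ.+ a₂′
  u = b₁ ℕ.+ b₂
  u′ = b₁′ ℕ.+ b₂′
  t-eq : u ℕ.+ x′ ≡ u′ ℕ.+ x
  t-eq = ≡.trans (cong (u ℕ.+_) (≡.sym (ℕP.+-identityʳ x′)))
    (≡.trans (difference-cong {u} {x} {u′} {x′} {0} {0} (≡.trans (cong (proj₂ ∘ proj₂) eq) (≡.sym (ℤP.+-identityʳ _))))
             (cong (u′ ℕ.+_) (ℕP.+-identityʳ x)))
  zero-distance : ∀ {i k} → i ≡ k → ∣ k ℤ.- i ∣ ℕ.≤ 1
  zero-distance {i} ≡.refl = subst (ℕ._≤ 1) (cong ∣_∣ (≡.sym (ℤP.+-inverseʳ i))) ℕ.z≤n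
  conclude : x ℕ.+ u ≡ x′ ℕ.+ u′ → q ≡ q′
  conclude f with same-level {x} {u} {x′} {u′} t-eq f
  ... | ex , eu with same-sum a₁ a₂ a₁′ a₂′ (≡.sym ex) (zero-distance (cong proj₁ eq))
                   | same-sum b₁ b₂ b₁′ b₂′ (≡.sym eu) (zero-distance (cong (proj₁ ∘ proj₂) eq))
  ... | ≡.refl , ≡.refl | ≡.refl , ≡.refl = ≡.refl
  go : q ∈ layer (suc m) ⊎ q ∈ layer m → q′ ∈ layer (suc m) ⊎ q′ ∈ layer m → q ≡ q′
  go (inj₁ m₁) (inj₁ m₂) = conclude (2+-injective (≡.trans (∈-layer⁻ m₁) (≡.sym (∈-layer⁻ m₂))))
  go (inj₂ m₁) (inj₂ m₂) = conclude (2+-injective (≡.trans (∈-layer⁻ m₁) (≡.sym (∈-layer⁻ m₂))))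
  go (inj₁ m₁) (inj₂ m₂) = ⊥-elim (different-level {x} {u} {x′} {u′} t-eq
    (2+-injective (≡.trans (∈-layer⁻ m₁) (cong suc (≡.sym (∈-layer⁻ m₂))))))
  go (inj₂ m₁) (inj₁ m₂) = ⊥-elim (different-level {x′} {u′} {x} {u} (≡.sym t-eq)
    (2+-injective (≡.trans (∈-layer⁻ m₂) (cong suc (≡.sym (∈-layer⁻ m₁))))))

data CoverView (m : ℕ) : Quad → Quad → Set where
  up₃ : ∀ {z} → z ∈ layer m → CoverView m (inc₃ z) z
  up₄ : ∀ {z} → z ∈ layer m → CoverView m (inc₄ z) z
  down₁ : ∀ {z} → z ∈ layer m → CoverView m z (inc₁ z)
  down₂ : ∀ {z} → z ∈ layer m → CoverView m z (inc₂ z)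

-- Parity of t excludes two elements of the same layer. Across layers, the changes of t and of the
-- total show which of the sums a₁ + a₂ and b₁ + b₂ changes, and the bound on the distance in r and
-- s then determines the entries.
coverView : ∀ m {q′ q} → q ∈ poset m → q′ ∈ poset m → Covers (toTriple q′) (toTriple q) → CoverView m q′ q
coverView m {q′@(a₁′ , a₂′ , b₁′ , b₂′)} {q@(a₁ , a₂ , b₁ , b₂)} q∈ q′∈ (eq , near) =
  go (∈-++⁻ (layer (suc m)) q∈) (∈-++⁻ (layer (suc m)) q′∈)
  where
  x = a₁ ℕ.+ a₂
  x′ = a₁′ ℕ.+ a₂′
  u = b₁ ℕ.+ b₂
  u′ = b₁′ ℕ.+ b₂′
  t-eq : u′ ℕ.+ x ≡ suc (u ℕ.+ x′)
  t-eq = ≡.trans (cong (u′ ℕ.+_) (≡.sym (ℕP.+-identityʳ x)))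
    (≡.trans (difference-cong {u′} {x′} {u} {x} {1} {0} eq)
             (≡.trans (cong (u ℕ.+_) (ℕP.+-comm x′ 1)) (ℕP.+-suc u x′)))
  near-r : PairDistance a₁ a₂ a₁′ a₂′ ℕ.≤ 1
  near-r = subst (PairDistance a₁ a₂ a₁′ a₂′ ℕ.≤_) near (ℕP.m≤m+n _ _)
  near-s : PairDistance b₁ b₂ b₁′ b₂′ ℕ.≤ 1
  near-s = subst (PairDistance b₁ b₂ b₁′ b₂′ ℕ.≤_) near (ℕP.m≤n+m _ (PairDistance a₁ a₂ a₁′ a₂′))
  flip : ∀ {i k} → ∣ i ℤ.- k ∣ ℕ.≤ 1 → ∣ k ℤ.- i ∣ ℕ.≤ 1
  flip {i} {k} = subst (ℕ._≤ 1) (ℤP.∣i-j∣≡∣j-i∣ i k)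
  -- u′ + x = 1 + u + x′ says that moving the 1 to the side of u puts both elements on one t-level.
  go : q ∈ layer (suc m) ⊎ q ∈ layer m → q′ ∈ layer (suc m) ⊎ q′ ∈ layer m → CoverView m q′ q
  go (inj₁ m₁) (inj₁ m₂) = ⊥-elim (different-level {x} {suc u} {x′} {u′} (≡.sym t-eq)
    (≡.trans (ℕP.+-suc x u) (cong suc (2+-injective (≡.trans (∈-layer⁻ m₁) (≡.sym (∈-layer⁻ m₂)))))))
  go (inj₂ m₁) (inj₂ m₂) = ⊥-elim (different-level {x} {suc u} {x′} {u′} (≡.sym t-eq)
    (≡.trans (ℕP.+-suc x u) (cong suc (2+-injective (≡.trans (∈-layer⁻ m₁) (≡.sym (∈-layer⁻ m₂)))))))
  go (inj₂ m₁) (inj₁ m₂)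
    with same-level {x} {suc u} {x′} {u′} (≡.sym t-eq)
           (≡.trans (ℕP.+-suc x u) (2+-injective (≡.trans (cong suc (∈-layer⁻ m₁)) (≡.sym (∈-layer⁻ m₂)))))
  ... | ex , eu with same-sum a₁ a₂ a₁′ a₂′ (≡.sym ex) near-r | suc-sum b₁ b₂ b₁′ b₂′ (≡.sym eu) near-s
  ... | ≡.refl , ≡.refl | inj₁ (≡.refl , ≡.refl) = up₃ m₁
  ... | ≡.refl , ≡.refl | inj₂ (≡.refl , ≡.refl) = up₄ m₁
  go (inj₁ m₁) (inj₂ m₂)
    with same-level {x} {u} {suc x′} {u′} (≡.trans (ℕP.+-suc u x′) (≡.sym t-eq))
           (2+-injective (≡.trans (∈-layer⁻ m₁) (cong suc (≡.sym (∈-layer⁻ m₂)))))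
  ... | ex , eu with suc-sum a₁′ a₂′ a₁ a₂ ex (flip {+ a₂′ ℤ.- + a₁′} near-r) | same-sum b₁ b₂ b₁′ b₂′ (≡.sym eu) near-s
  ... | inj₁ (≡.refl , ≡.refl) | ≡.refl , ≡.refl = down₁ m₂
  ... | inj₂ (≡.refl , ≡.refl) | ≡.refl , ≡.refl = down₂ m₂

covers₁ : ∀ z → Covers (toTriple z) (toTriple (inc₁ z))
covers₁ (a₁ , a₂ , b₁ , b₂) = t (+ (b₁ ℕ.+ b₂)) (+ (a₁ ℕ.+ a₂)) ,
  cong₂ ℕ._+_ (cong ∣_∣ (r (+ a₁) (+ a₂))) (cong ∣_∣ (ℤP.+-inverseʳ (+ b₂ ℤ.- + b₁)))
  where
  t : ∀ u x → u ℤ.- x ≡ u ℤ.- (+ 1 ℤ.+ x) ℤ.+ + 1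
  t = solve-∀
  r : ∀ a₁ a₂ → (a₂ ℤ.- a₁) ℤ.- (a₂ ℤ.- (+ 1 ℤ.+ a₁)) ≡ + 1
  r = solve-∀
covers₂ : ∀ z → Covers (toTriple z) (toTriple (inc₂ z))
covers₂ (a₁ , a₂ , b₁ , b₂) =
  ≡.trans (t (+ (b₁ ℕ.+ b₂)) (+ (a₁ ℕ.+ a₂))) (cong (λ x → + (b₁ ℕ.+ b₂) ℤ.- + x ℤ.+ + 1) (≡.sym (ℕP.+-suc a₁ a₂))) ,
  cong₂ ℕ._+_ (cong ∣_∣ (r (+ a₁) (+ a₂))) (cong ∣_∣ (ℤP.+-inverseʳ (+ b₂ ℤ.- + b₁)))
  where
  t : ∀ u x → u ℤ.- x ≡ u ℤ.- (+ 1 ℤ.+ x) ℤ.+ + 1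
  t = solve-∀
  r : ∀ a₁ a₂ → (a₂ ℤ.- a₁) ℤ.- ((+ 1 ℤ.+ a₂) ℤ.- a₁) ≡ -[1+ 0 ]
  r = solve-∀
covers₃ : ∀ z → Covers (toTriple (inc₃ z)) (toTriple z)
covers₃ (a₁ , a₂ , b₁ , b₂) = t (+ (b₁ ℕ.+ b₂)) (+ (a₁ ℕ.+ a₂)) ,
  cong₂ ℕ._+_ (cong ∣_∣ (ℤP.+-inverseʳ (+ a₂ ℤ.- + a₁))) (cong ∣_∣ (s (+ b₁) (+ b₂)))
  where
  t : ∀ u x → (+ 1 ℤ.+ u) ℤ.- x ≡ u ℤ.- x ℤ.+ + 1
  t = solve-∀
  s : ∀ b₁ b₂ → (b₂ ℤ.- (+ 1 ℤ.+ b₁)) ℤ.- (b₂ ℤ.- b₁) ≡ -[1+ 0 ]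
  s = solve-∀
covers₄ : ∀ z → Covers (toTriple (inc₄ z)) (toTriple z)
covers₄ (a₁ , a₂ , b₁ , b₂) =
  ≡.trans (cong (λ u → + u ℤ.- + (a₁ ℕ.+ a₂)) (ℕP.+-suc b₁ b₂)) (t (+ (b₁ ℕ.+ b₂)) (+ (a₁ ℕ.+ a₂))) ,
  cong₂ ℕ._+_ (cong ∣_∣ (ℤP.+-inverseʳ (+ a₂ ℤ.- + a₁))) (cong ∣_∣ (s (+ b₁) (+ b₂)))
  where
  t : ∀ u x → (+ 1 ℤ.+ u) ℤ.- x ≡ u ℤ.- x ℤ.+ + 1
  t = solve-∀
  s : ∀ b₁ b₂ → ((+ 1 ℤ.+ b₂) ℤ.- b₁) ℤ.- (b₂ ℤ.- b₁) ≡ + 1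
  s = solve-∀

-- Congruences modulo 4 and the inequalities defining Q_k

mod-unique : ∀ {r r′ q q′} → r ℕ.< 4 → r′ ℕ.< 4 → + r ℤ.+ q ℤ.* + 4 ≡ + r′ ℤ.+ q′ ℤ.* + 4 → r ≡ r′
mod-unique {r} {r′} {q} {q′} r< r′< eq = ℤP.+-injective (ℤP.i-j≡0⇒i≡j (+ r) (+ r′)
  (≡.trans diff (≡.trans (cong (ℤ._* + 4) (ℤP.∣i∣≡0⇒i≡0 {d} d≡0)) (ℤP.*-zeroˡ (+ 4)))))
  where
  d = q′ ℤ.- q
  l : ∀ r r′ q → r ℤ.- r′ ≡ (r ℤ.+ q ℤ.* + 4) ℤ.- (r′ ℤ.+ q ℤ.* + 4)
  l = solve-∀
  k : ∀ r′ q q′ → (r′ ℤ.+ q′ ℤ.* + 4) ℤ.- (r′ ℤ.+ q ℤ.* + 4) ≡ (q′ ℤ.- q) ℤ.* + 4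
  k = solve-∀
  diff : + r ℤ.- + r′ ≡ d ℤ.* + 4
  diff = ≡.trans (l (+ r) (+ r′) q) (≡.trans (cong (ℤ._- (+ r′ ℤ.+ q ℤ.* + 4)) eq) (k (+ r′) q q′))
  small : ∣ d ∣ ℕ.* 4 ℕ.< 4
  small = subst (ℕ._< 4) (≡.trans (cong ∣_∣ (≡.trans (≡.sym (ℤP.m-n≡m⊖n r r′)) diff)) (ℤP.∣i*j∣≡∣i∣*∣j∣ d (+ 4)))
    (ℕP.≤-<-trans (ℤP.∣m⊝n∣≤m⊔n r r′) (ℕP.⊔-pres-<m r< r′<))
  d≡0 : ∣ d ∣ ≡ 0
  d≡0 = ℕP.n<1⇒n≡0 (ℕP.*-cancelʳ-< 4 ∣ d ∣ 1 small)

≡-mod4⁺ : ∀ {u v} A → v ≡ u ℤ.+ + 4 ℤ.* + A → u ℤ.≤ v × u % + 4 ≡ v % + 4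
≡-mod4⁺ {u} {v} A eq =
  subst (u ℤ.≤_) (≡.sym (≡.trans eq (cong (λ w → u ℤ.+ w) (≡.sym (ℤP.pos-* 4 A))))) (ℤP.i≤i+j u (+ (4 ℕ.* A))) ,
  mod-unique {q = u / + 4 ℤ.+ + A} {q′ = v / + 4} (ℤD.n%d<d u (+ 4)) (ℤD.n%d<d v (+ 4))
    (≡.trans (k (+ (u % + 4)) (u / + 4) (+ A))
    (≡.trans (cong (ℤ._+ + 4 ℤ.* + A) (≡.sym (ℤD.a≡a%n+[a/n]*n u (+ 4))))
    (≡.trans (≡.sym eq) (ℤD.a≡a%n+[a/n]*n v (+ 4)))))
  where
  k : ∀ r q A → r ℤ.+ (q ℤ.+ A) ℤ.* + 4 ≡ (r ℤ.+ q ℤ.* + 4) ℤ.+ + 4 ℤ.* A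
  k = solve-∀

≡-mod4⁻ : ∀ {u v} → u ℤ.≤ v → u % + 4 ≡ v % + 4 → ∃ λ A → v ≡ u ℤ.+ + 4 ℤ.* + A
≡-mod4⁻ {u} {v} u≤v eq = quotient (v / + 4 ℤ.- u / + 4) diff
  where
  k : ∀ r q q′ → (r ℤ.+ q′ ℤ.* + 4) ℤ.- (r ℤ.+ q ℤ.* + 4) ≡ (q′ ℤ.- q) ℤ.* + 4
  k = solve-∀
  l : ∀ u v → v ≡ u ℤ.+ (v ℤ.- u)
  l = solve-∀
  diff : v ℤ.- u ≡ (v / + 4 ℤ.- u / + 4) ℤ.* + 4
  diff = ≡.trans (cong₂ ℤ._-_ (ℤD.a≡a%n+[a/n]*n v (+ 4))
           (≡.trans (ℤD.a≡a%n+[a/n]*n u (+ 4)) (cong (λ r → + r ℤ.+ u / + 4 ℤ.* + 4) eq)))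
         (k (+ (v % + 4)) (u / + 4) (v / + 4))
  quotient : ∀ d → v ℤ.- u ≡ d ℤ.* + 4 → ∃ λ A → v ≡ u ℤ.+ + 4 ℤ.* + A
  quotient (+ A) e = A , ≡.trans (l u v) (cong (λ w → u ℤ.+ w) (≡.trans e (ℤP.*-comm (+ A) (+ 4))))
  quotient -[1+ n ] e with () ← subst (ℤ.0ℤ ℤ.≤_) e (ℤP.i≤j⇒0≤j-i u≤v)

-- In pair and unpair, A is the minimum of a₁ and a₂.
pair : ∀ r A → ∃₂ λ a₁ a₂ → + a₂ ℤ.- + a₁ ≡ r × + (a₁ ℕ.+ a₂) ≡ + 2 ℤ.* + A ℤ.+ + ∣ r ∣
pair (+ ρ) A = A , ρ ℕ.+ A , l (+ A) (+ ρ) , k (+ A) (+ ρ)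
  where
  l : ∀ A ρ → ρ ℤ.+ A ℤ.- A ≡ ρ
  l = solve-∀
  k : ∀ A ρ → A ℤ.+ (ρ ℤ.+ A) ≡ + 2 ℤ.* A ℤ.+ ρ
  k = solve-∀
pair -[1+ ρ ] A = suc ρ ℕ.+ A , A , l (+ A) (+ suc ρ) , k (+ A) (+ suc ρ)
  where
  l : ∀ A ρ → A ℤ.- (ρ ℤ.+ A) ≡ ℤ.- ρ
  l = solve-∀
  k : ∀ A ρ → ρ ℤ.+ A ℤ.+ A ≡ + 2 ℤ.* A ℤ.+ ρ
  k = solve-∀

unpair : ∀ a₁ a₂ → ∃ λ A → + (a₁ ℕ.+ a₂) ≡ + 2 ℤ.* + A ℤ.+ + ∣ + a₂ ℤ.- + a₁ ∣
unpair a₁ a₂ with ℕP.≤-total a₁ a₂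
... | inj₁ a₁≤a₂ with ℕP.m≤n⇒∃[o]m+o≡n a₁≤a₂
... | o , ≡.refl = a₁ , ≡.trans (k (+ a₁) (+ o)) (cong (λ d → + 2 ℤ.* + a₁ ℤ.+ + d) (≡.sym (cong ∣_∣ (l (+ a₁) (+ o)))))
  where
  l : ∀ a o → a ℤ.+ o ℤ.- a ≡ o
  l = solve-∀
  k : ∀ a o → a ℤ.+ (a ℤ.+ o) ≡ + 2 ℤ.* a ℤ.+ o
  k = solve-∀
unpair a₁ a₂ | inj₂ a₂≤a₁ with ℕP.m≤n⇒∃[o]m+o≡n a₂≤a₁
... | o , ≡.refl = a₂ , ≡.trans (k (+ a₂) (+ o)) (cong (λ d → + 2 ℤ.* + a₂ ℤ.+ + d)
                     (≡.sym (≡.trans (cong ∣_∣ (l (+ a₂) (+ o))) (ℤP.∣-i∣≡∣i∣ (+ o)))))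
  where
  l : ∀ a o → a ℤ.- (a ℤ.+ o) ≡ ℤ.- o
  l = solve-∀
  k : ∀ a o → a ℤ.+ o ℤ.+ a ≡ + 2 ℤ.* a ℤ.+ o
  k = solve-∀

-- The inequalities and congruences say that `t - low = 4B` and `high - t = 4A`; here A and B are
-- the minima of the two pairs, and r and s are their differences.
InQ⇒layer : ∀ n x → InQ (+ n) x → ∃ λ q → q ∈ layer n × toTriple q ≡ x
InQ⇒layer n (r , s , t) (lo≤t , t≤hi , lo-mod , hi-mod)
  with ≡-mod4⁻ lo≤t lo-mod | ≡-mod4⁻ t≤hi hi-mod
... | B , t-eq | A , hi-eq with pair r A | pair s B
... | a₁ , a₂ , r-eq , a-sum | b₁ , b₂ , s-eq , b-sum =
  (a₁ , a₂ , b₁ , b₂) , ∈-layer⁺ (ℤP.+-injective level) , cong₂ _,_ r-eq (cong₂ _,_ s-eq height)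
  where
  open ≡-Reasoning
  ρ = + ∣ r ∣
  σ = + ∣ s ∣
  N = + n
  -- The conditions determine twice each sum, so both coordinates are checked after doubling: each
  -- side differs by two brackets that vanish by `hi-eq` and `t-eq`.
  e₁ : ∀ N ρ σ A B t → + 2 ℤ.* (+ 2 ℤ.+ ((+ 2 ℤ.* A ℤ.+ ρ) ℤ.+ (+ 2 ℤ.* B ℤ.+ σ))) ≡
        + 2 ℤ.* N ℤ.+ ((t ℤ.+ + 4 ℤ.* A) ℤ.- ((N ℤ.- + 2) ℤ.- + 2 ℤ.* ρ)) ℤ.+ (((+ 2 ℤ.* σ ℤ.- (N ℤ.- + 2)) ℤ.+ + 4 ℤ.* B) ℤ.- t)
  e₁ = solve-∀
  e₂ : ∀ N ρ σ A B t → + 2 ℤ.* ((+ 2 ℤ.* B ℤ.+ σ) ℤ.- (+ 2 ℤ.* A ℤ.+ ρ)) ≡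
        + 2 ℤ.* t ℤ.+ (((N ℤ.- + 2) ℤ.- + 2 ℤ.* ρ) ℤ.- (t ℤ.+ + 4 ℤ.* A)) ℤ.+ (((+ 2 ℤ.* σ ℤ.- (N ℤ.- + 2)) ℤ.+ + 4 ℤ.* B) ℤ.- t)
  e₂ = solve-∀
  drop : ∀ w u v → u ≡ ℤ.0ℤ → v ≡ ℤ.0ℤ → w ℤ.+ u ℤ.+ v ≡ w
  drop w _ _ ≡.refl ≡.refl = ≡.trans (ℤP.+-identityʳ _) (ℤP.+-identityʳ w)
  level : + (2 ℕ.+ ((a₁ ℕ.+ a₂) ℕ.+ (b₁ ℕ.+ b₂))) ≡ N
  level = ℤP.*-cancelˡ-≡ (+ 2) _ _ (begin
    + 2 ℤ.* (+ 2 ℤ.+ (+ (a₁ ℕ.+ a₂) ℤ.+ + (b₁ ℕ.+ b₂)))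
      ≡⟨ cong₂ (λ u v → + 2 ℤ.* (+ 2 ℤ.+ (u ℤ.+ v))) a-sum b-sum ⟩
    + 2 ℤ.* (+ 2 ℤ.+ ((+ 2 ℤ.* + A ℤ.+ ρ) ℤ.+ (+ 2 ℤ.* + B ℤ.+ σ)))
      ≡⟨ e₁ N ρ σ (+ A) (+ B) t ⟩
    _ ≡⟨ drop (+ 2 ℤ.* N) _ _ (ℤP.i≡j⇒i-j≡0 (≡.sym hi-eq)) (ℤP.i≡j⇒i-j≡0 (≡.sym t-eq)) ⟩
    + 2 ℤ.* N ∎)
  height : + (b₁ ℕ.+ b₂) ℤ.- + (a₁ ℕ.+ a₂) ≡ t
  height = ℤP.*-cancelˡ-≡ (+ 2) _ _ (begin
    + 2 ℤ.* (+ (b₁ ℕ.+ b₂) ℤ.- + (a₁ ℕ.+ a₂))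
      ≡⟨ cong₂ (λ u v → + 2 ℤ.* (u ℤ.- v)) b-sum a-sum ⟩
    + 2 ℤ.* ((+ 2 ℤ.* + B ℤ.+ σ) ℤ.- (+ 2 ℤ.* + A ℤ.+ ρ))
      ≡⟨ e₂ N ρ σ (+ A) (+ B) t ⟩
    _ ≡⟨ drop (+ 2 ℤ.* t) _ _ (ℤP.i≡j⇒i-j≡0 hi-eq) (ℤP.i≡j⇒i-j≡0 (≡.sym t-eq)) ⟩
    + 2 ℤ.* t ∎)

layer⇒InQ : ∀ {n q} → q ∈ layer n → InQ (+ n) (toTriple q)
layer⇒InQ {n} {q@(a₁ , a₂ , b₁ , b₂)} q∈ = proj₁ l , proj₁ h , proj₂ l , proj₂ h
  where
  A B : ℕ
  A = proj₁ (unpair a₁ a₂)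
  B = proj₁ (unpair b₁ b₂)
  N x u ρ σ lo t hi : ℤ
  N = + n
  x = + (a₁ ℕ.+ a₂)
  u = + (b₁ ℕ.+ b₂)
  ρ = + ∣ + a₂ ℤ.- + a₁ ∣
  σ = + ∣ + b₂ ℤ.- + b₁ ∣
  lo = lowQ N (toTriple q)
  t = u ℤ.- x
  hi = highQ N (toTriple q)
  N≡ : N ≡ + 2 ℤ.+ (x ℤ.+ u)
  N≡ = cong +_ (≡.sym (∈-layer⁻ q∈))
  e₁ : ∀ x σ B → (+ 2 ℤ.* B ℤ.+ σ) ℤ.- x ≡ (+ 2 ℤ.* σ ℤ.- ((+ 2 ℤ.+ (x ℤ.+ (+ 2 ℤ.* B ℤ.+ σ))) ℤ.- + 2)) ℤ.+ + 4 ℤ.* B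
  e₁ = solve-∀
  e₂ : ∀ u ρ A → ((+ 2 ℤ.+ ((+ 2 ℤ.* A ℤ.+ ρ) ℤ.+ u)) ℤ.- + 2) ℤ.- + 2 ℤ.* ρ ≡ u ℤ.- (+ 2 ℤ.* A ℤ.+ ρ) ℤ.+ + 4 ℤ.* A
  e₂ = solve-∀
  low : ∀ N x u B σ → N ≡ + 2 ℤ.+ (x ℤ.+ u) → u ≡ + 2 ℤ.* B ℤ.+ σ → u ℤ.- x ≡ (+ 2 ℤ.* σ ℤ.- (N ℤ.- + 2)) ℤ.+ + 4 ℤ.* B
  low _ x _ B σ ≡.refl ≡.refl = e₁ x σ B
  high : ∀ N x u A ρ → N ≡ + 2 ℤ.+ (x ℤ.+ u) → x ≡ + 2 ℤ.* A ℤ.+ ρ → (N ℤ.- + 2) ℤ.- + 2 ℤ.* ρ ≡ (u ℤ.- x) ℤ.+ + 4 ℤ.* A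
  high _ _ u A ρ ≡.refl ≡.refl = e₂ u ρ A
  l : lo ℤ.≤ t × lo % + 4 ≡ t % + 4
  l = ≡-mod4⁺ B (low N x u (+ B) σ N≡ (proj₂ (unpair b₁ b₂)))
  h : t ℤ.≤ hi × t % + 4 ≡ hi % + 4
  h = ≡-mod4⁺ A (high N x u (+ A) ρ N≡ (proj₂ (unpair a₁ a₂)))

-- The enumeration of P_k inside a box

unique-concatMap : {X Y : Set} (f : X → List Y) (xs : List X) → Unique xs → (∀ x → Unique (f x)) →
                   (∀ {x x′ y} → y ∈ f x → y ∈ f x′ → x ≡ x′) → Unique (concatMap f xs)
unique-concatMap f [] _ _ _ = []
unique-concatMap f (x ∷ xs) (x∉ ∷ u) uf sep = UniqueP.++⁺ (uf x) (unique-concatMap f xs u uf sep)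
  λ { (y∈ , y∈′) → let x′ , x′∈ , y∈f = find (∈-concatMap⁻ f {xs = xs} y∈′) in All.lookup x∉ x′∈ (sep y∈ y∈f) }

range-unique : ∀ B → Unique (range B)
range-unique B = UniqueP.map⁺ (λ {i} {k} e → ℤP.+-injective (∙-cancelʳ (ℤ.- + B) (+ i) (+ k) e)) (UniqueP.upTo⁺ (suc (2 ℕ.* B)))

∈-range : ∀ {B} z → ∣ z ∣ ℕ.≤ B → z ∈ range B
∈-range {B} (+ n) n≤B = subst (_∈ range B) (l (+ n) (+ B))
  (∈-map⁺ (λ i → + i ℤ.- + B) (∈-upTo⁺ (ℕ.s≤s (ℕP.+-mono-≤ n≤B (ℕP.≤-reflexive (≡.sym (ℕP.+-identityʳ B)))))))
  where
  l : ∀ n B → n ℤ.+ B ℤ.- B ≡ n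
  l = solve-∀
∈-range {B} -[1+ n ] n<B with ℕP.m≤n⇒∃[o]m+o≡n n<B
... | o , ≡.refl = subst (_∈ range B) (l (+ suc n) (+ o))
  (∈-map⁺ (λ i → + i ℤ.- + B) (∈-upTo⁺ (ℕ.s≤s (ℕP.≤-trans (ℕP.m≤n+m o (suc n)) (ℕP.m≤m+n B (B ℕ.+ 0))))))
  where
  l : ∀ n o → o ℤ.- (n ℤ.+ o) ≡ ℤ.- n
  l = solve-∀

line : ℕ → ℤ → ℤ → List Triple
line B r s = map (λ t → r , s , t) (range B)

plane : ℕ → ℤ → List Triple
plane B r = concatMap (line B r) (range B)

∈-line⁻ : ∀ B r s {y} → y ∈ line B r s → proj₁ y ≡ r × proj₁ (proj₂ y) ≡ s
∈-line⁻ B r s y∈ with ∈-map⁻ (λ t → r , s , t) y∈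
... | _ , _ , ≡.refl = ≡.refl , ≡.refl

∈-plane⁻ : ∀ B r {y} → y ∈ plane B r → proj₁ y ≡ r
∈-plane⁻ B r y∈ with find (∈-concatMap⁻ (line B r) {xs = range B} y∈)
... | s , _ , y∈′ = proj₁ (∈-line⁻ B r s y∈′)

box-unique : ∀ B → Unique (box B)
box-unique B = unique-concatMap (plane B) (range B) (range-unique B)
  (λ r → unique-concatMap (line B r) (range B) (range-unique B) (λ s → UniqueP.map⁺ (λ { ≡.refl → ≡.refl }) (range-unique B))
    λ {s} {s′} y∈ y∈′ → ≡.trans (≡.sym (proj₂ (∈-line⁻ B r s y∈))) (proj₂ (∈-line⁻ B r s′ y∈′)))
  λ {r} {r′} y∈ y∈′ → ≡.trans (≡.sym (∈-plane⁻ B r y∈)) (∈-plane⁻ B r′ y∈′)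

∈-box : ∀ {B r s t} → ∣ r ∣ ℕ.≤ B → ∣ s ∣ ℕ.≤ B → ∣ t ∣ ℕ.≤ B → (r , s , t) ∈ box B
∈-box {B} {r} {s} {t} r≤ s≤ t≤ = ∈-concatMap⁺ (plane B) (lose (∈-range r r≤)
  (∈-concatMap⁺ (line B r) (lose (∈-range s s≤) (∈-map⁺ (λ t → r , s , t) (∈-range t t≤)))))

toTriple-bound : ∀ {m q} → q ∈ poset m → toTriple q ∈ box (m ℕ.+ 3)
toTriple-bound {m} {q@(a₁ , a₂ , b₁ , b₂)} q∈ = ∈-box
  (bd a₂ a₁ (ℕP.≤-trans (ℕP.≤-reflexive (ℕP.+-comm a₂ a₁)) (ℕP.m≤m+n (a₁ ℕ.+ a₂) (b₁ ℕ.+ b₂))))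
  (bd b₂ b₁ (ℕP.≤-trans (ℕP.≤-reflexive (ℕP.+-comm b₂ b₁)) (ℕP.m≤n+m (b₁ ℕ.+ b₂) (a₁ ℕ.+ a₂))))
  (bd (b₁ ℕ.+ b₂) (a₁ ℕ.+ a₂) (ℕP.≤-reflexive (ℕP.+-comm (b₁ ℕ.+ b₂) (a₁ ℕ.+ a₂))))
  where
  total≤ : total q ℕ.≤ m ℕ.+ 3
  total≤ with ∈-++⁻ (layer (suc m)) q∈
  ... | inj₁ h = ℕP.≤-trans (ℕP.≤-trans (ℕP.m≤n+m (total q) 2) (ℕP.≤-reflexive (∈-layer⁻ h))) (ℕP.≤-trans (ℕP.≤-reflexive (ℕP.+-comm 1 m)) (ℕP.+-monoʳ-≤ m (ℕ.s≤s ℕ.z≤n)))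
  ... | inj₂ h = ℕP.≤-trans (ℕP.≤-trans (ℕP.m≤n+m (total q) 2) (ℕP.≤-reflexive (∈-layer⁻ h))) (ℕP.m≤m+n m 3)
  bd : ∀ x y → x ℕ.+ y ℕ.≤ total q → ∣ + x ℤ.- + y ∣ ℕ.≤ m ℕ.+ 3
  bd x y le = ℕP.≤-trans (ℤP.∣i-j∣≤∣i∣+∣j∣ (+ x) (+ y)) (ℕP.≤-trans le total≤)

layers-disjoint : ∀ {n q} → q ∈ layer (suc n) → q ∉ layer n
layers-disjoint q∈ q∈′ = ℕP.1+n≢n (≡.trans (≡.sym (∈-layer⁻ q∈)) (∈-layer⁻ q∈′))

poset-unique : ∀ m → Unique (poset m)
poset-unique m = UniqueP.++⁺ (layer-unique (suc m)) (layer-unique m) λ { (q∈ , q∈′) → layers-disjoint q∈ q∈′ }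

PList-unique : ∀ k → Unique (PList k)
PList-unique k = UniqueP.filter⁺ (InP? k) (box-unique (∣ k ∣ ℕ.+ 3))

∈-PList⁺ : ∀ k {x} → x ∈ box (∣ k ∣ ℕ.+ 3) → InP k x → x ∈ PList k
∈-PList⁺ k = ∈-filter⁺ (InP? k)

∈-PList⁻ : ∀ k {x} → x ∈ PList k → InP k x
∈-PList⁻ k x∈ = proj₂ (∈-filter⁻ (InP? k) {xs = box (∣ k ∣ ℕ.+ 3)} x∈)

poset⇒InP : ∀ m q → q ∈ poset m → InP (+ m) (toTriple q)
poset⇒InP m q q∈ = go (∈-++⁻ (layer (suc m)) q∈)
  where
  go : q ∈ layer (suc m) ⊎ q ∈ layer m → InP (+ m) (toTriple q)
  go (inj₁ h) = inj₁ (layer⇒InQ {m ℕ.+ 1} {q} (subst (λ n → q ∈ layer n) (ℕP.+-comm 1 m) h))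
  go (inj₂ h) = inj₂ (layer⇒InQ {m} {q} h)

InP⇒poset : ∀ m x → InP (+ m) x → ∃ λ q → q ∈ poset m × toTriple q ≡ x
InP⇒poset m x (inj₁ h) =
  let q , q∈ , e = InQ⇒layer (m ℕ.+ 1) x h
  in q , ∈-++⁺ˡ (subst (λ n → q ∈ layer n) (ℕP.+-comm m 1) q∈) , e
InP⇒poset m x (inj₂ h) =
  let q , q∈ , e = InQ⇒layer m x h
  in q , ∈-++⁺ʳ (layer (suc m)) q∈ , e

poset⇒PList : ∀ m q → q ∈ poset m → toTriple q ∈ PList (+ m)
poset⇒PList m q q∈ = ∈-PList⁺ (+ m) (toTriple-bound {m} q∈) (poset⇒InP m q q∈)

PList⇒poset : ∀ m x → x ∈ PList (+ m) → ∃ λ q → q ∈ poset m × toTriple q ≡ x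
PList⇒poset m x x∈ = InP⇒poset m x (∈-PList⁻ (+ m) x∈)

unique-map : {X Y : Set} (f : X → Y) {xs : List X} → Unique xs →
             (∀ {x x′} → x ∈ xs → x′ ∈ xs → f x ≡ f x′ → x ≡ x′) → Unique (map f xs)
unique-map f [] inj = []
unique-map f {x ∷ xs} (x∉ ∷ u) inj =
  All.tabulate (λ y∈ e → let x′ , x′∈ , e′ = ∈-map⁻ f y∈ in All.lookup x∉ x′∈ (inj (here ≡.refl) (there x′∈) (≡.trans e e′)))
  ∷ unique-map f u (λ a b → inj (there a) (there b))

PList-↭ : ∀ m → PList (+ m) ↭ map toTriple (poset m)
PList-↭ m = unique-↭ (PList-unique (+ m)) (unique-map toTriple (poset-unique m) (toTriple-injective m))
  (λ {x} x∈ → let q , q∈ , e = PList⇒poset m x x∈ in subst (_∈ map toTriple (poset m)) e (∈-map⁺ toTriple q∈))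
  (λ {x} x∈ → let q , q∈ , e = ∈-map⁻ toTriple x∈ in subst (_∈ PList (+ m)) (≡.sym e) (poset⇒PList m q q∈))

-- Order ideals

module OrderIdeals {c ℓ : Level} (K : CommutativeRing c ℓ) where
  open CommutativeRing K hiding (zero)
  open ProductsAndSums K
  open Weights K
  open Subsets _≟Q_ using (Supported) renaming (∑⊆ to ∑⊆Q; insert to insertQ; ∑⊆-cong to ∑⊆Q-cong; ∑⊆-++ to ∑⊆Q-++)
  open Subsets _≟T_
  open import Relation.Binary.Reasoning.Setoid setoid

  -- `M` stays fixed while `L` shrinks: `toTriple` is injective only on the poset, and `U` and `S`
  -- need to agree only there, which each insertion preserves.
  ∑⊆-map : ∀ {M : List Quad} (Φ : (Triple → Bool) → Carrier) (Ψ : (Quad → Bool) → Carrier) →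
           (∀ {x y} → x ∈ M → y ∈ M → toTriple x ≡ toTriple y → x ≡ y) →
           (∀ U S → (∀ {x} → x ∈ M → U (toTriple x) ≡ S x) → Φ U ≈ Ψ S) →
           ∀ L → (∀ {x} → x ∈ L → x ∈ M) → ∑⊆ (map toTriple L) Φ ≈ ∑⊆Q L Ψ
  ∑⊆-map Φ Ψ inj e [] sub = e _ _ (λ _ → ≡.refl)
  ∑⊆-map Φ Ψ inj e (x ∷ L) sub = +-cong (∑⊆-map Φ Ψ inj e L (sub ∘ there))
    (∑⊆-map (Φ ∘ insert (toTriple x)) (Ψ ∘ insertQ x) inj
      (λ U S h → e _ _ λ {y} y∈ → cong₂ _∨_ (same y y∈) (h y∈)) L (sub ∘ there))
    where
    same : ∀ y → y ∈ _ → does (toTriple y ≟T toTriple x) ≡ does (y ≟Q x)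
    same y y∈ with toTriple y ≟T toTriple x | y ≟Q x
    ... | yes _ | yes _ = ≡.refl
    ... | no _ | no _ = ≡.refl
    ... | yes h | no y≢x = ⊥-elim (y≢x (inj y∈ (sub (here ≡.refl)) h))
    ... | no h | yes ≡.refl = ⊥-elim (h ≡.refl)

  term-cong : ∀ n A B {S S′ T T′ : Quad → Bool} →
              (∀ {q} → q ∈ layer (suc n) → S q ≡ S′ q) → (∀ {q} → q ∈ layer n → T q ≡ T′ q) →
              term n A B S T ≈ term n A B S′ T′
  term-cong n A B {S} {S′} {T} {T′} eS eT = *-cong
    (∏-cong (layer n) λ {z} z∈ → reflexive (cong ind (cong₂ _∧_
      (cong₂ _⇒_ (eT z∈) (cong₂ _∧_ (eS (∈-layer-inc⁺ inc₁ total-inc₁ z∈)) (eS (∈-layer-inc⁺ inc₂ total-inc₂ z∈))))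
      (cong₂ _⇒_ (cong₂ _∨_ (eS (∈-layer-inc⁺ inc₃ total-inc₃ z∈)) (eS (∈-layer-inc⁺ inc₄ total-inc₄ z∈))) (eT z∈)))))
    (∏-cong (layer (suc n)) λ {v} v∈ → reflexive (cong₂ (factor (A v) (B v)) (eS v∈) (below v v∈)))
    where
    below : ∀ v → v ∈ layer (suc n) → dec₁ false T v ≡ dec₁ false T′ v
    below (zero , _) _ = ≡.refl
    below (suc _ , _) v∈ = eT (∈-layer-inc⁻ inc₁ total-inc₁ v∈)

  -- A single subset of the poset plays both roles. As the layers are disjoint, its restrictions to
  -- them are independent and give back S and T.
  Z-poset : ∀ n A B → ∑⊆Q (poset n) (λ S → term n A B S S) ≈ Z n A B
  Z-poset n A B = trans
    (∑⊆Q-++ (layer (suc n)) (layer n) {λ S → term n A B S S} (λ e → term-cong n A B (λ {q} _ → e q) (λ {q} _ → e q)))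
    (∑⊆Q-cong (layer (suc n)) λ S suppS → ∑⊆Q-cong (layer n) λ T suppT → term-cong n A B
      (λ {q} q∈ → ≡.trans (cong (S q ∨_) (suppT (layers-disjoint q∈))) (∨-identityʳ (S q)))
      (λ {q} q∈ → cong (_∨ T q) (suppS (λ q∈′ → layers-disjoint q∈′ q∈))))

  closed-intro : ∀ t p q r s → (t ≡ true → p ≡ true) → (t ≡ true → q ≡ true) → (r ≡ true → t ≡ true) → (s ≡ true → t ≡ true) →
                 ((t ⇒ (p ∧ q)) ∧ ((r ∨ s) ⇒ t)) ≡ true
  closed-intro true p q r s tp tq _ _ with ≡.refl ← tp ≡.refl | ≡.refl ← tq ≡.refl = ⇒-true (r ∨ s)
  closed-intro false p q false false _ _ _ _ = ≡.refl
  closed-intro false p q true s _ _ rt _ = rt ≡.refl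
  closed-intro false p q false true _ _ _ st = st ≡.refl

  closed-elim : ∀ t p q r s → ((t ⇒ (p ∧ q)) ∧ ((r ∨ s) ⇒ t)) ≡ true →
                (t ≡ true → p ≡ true) × (t ≡ true → q ≡ true) × (r ≡ true → t ≡ true) × (s ≡ true → t ≡ true)
  closed-elim true true true r s _ = (λ _ → ≡.refl) , (λ _ → ≡.refl) , (λ _ → ≡.refl) , (λ _ → ≡.refl)
  closed-elim true true false r s ()
  closed-elim true false q r s ()
  closed-elim false p q false false _ = (λ ()) , (λ ()) , (λ ()) , (λ ())
  closed-elim false p q true s ()
  closed-elim false p q false true ()

  module _ (m : ℕ) (L : List Triple) (L-unique : Unique L) (L-↭ : L ↭ map toTriple (poset m))
           (y : ℤ → Carrier) (j : ℤ) where

    at : Triple → Carrier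
    at (r , s , t) = y ((+ 3) ℤ.* r ℤ.+ s ℤ.+ j)

    A₀ B₀ : Quad → Carrier
    A₀ q = y (pos j q) * y (pos j q ℤ.+ + 3)
    B₀ q = y (pos j q)

    listWeight : Vec Bool (length L) → Carrier
    listWeight I = prodK K (map (λ a → if Vec.lookup I a then at (List.lookup L a) else 1#) (allFin (length L)))

    IsIdeal : Vec Bool (length L) → Set
    IsIdeal I = ∀ a b → Star (λ a b → Covers (List.lookup L b) (List.lookup L a)) a b → b Subset.∈ I → a Subset.∈ I

    private
      ∈L : ∀ {q} → q ∈ poset m → toTriple q ∈ L
      ∈L q∈ = ∈-resp-↭ (↭-sym L-↭) (∈-map⁺ toTriple q∈)
      inUpper : ∀ {q} → q ∈ layer (suc m) → q ∈ poset m
      inUpper = ∈-++⁺ˡ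
      inLower : ∀ {q} → q ∈ layer m → q ∈ poset m
      inLower = ∈-++⁺ʳ (layer (suc m))

    module _ (I : Vec Bool (length L)) where

      U : Triple → Bool
      U = subsetOf L I

      S : Quad → Bool
      S = U ∘ toTriple

      ∈⇒U : ∀ a → a Subset.∈ I → U (List.lookup L a) ≡ true
      ∈⇒U a a∈ = ≡.trans (subsetOf-lookup L-unique I a) (VecP.[]=⇒lookup a∈)

      U⇒∈ : ∀ a → U (List.lookup L a) ≡ true → a Subset.∈ I
      U⇒∈ a e = VecP.lookup⇒[]= a I (≡.trans (≡.sym (subsetOf-lookup L-unique I a)) e)

      -- Triples are turned back into indices of `L`, and the ideal property is applied to a chain
      -- of length one.
      ideal-step : IsIdeal I → ∀ {x x′} → x ∈ L → x′ ∈ L → Covers x x′ → U x ≡ true → U x′ ≡ true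
      ideal-step ideal {x} {x′} x∈ x′∈ cov e = ≡.trans (cong U x′-at) (∈⇒U a
        (ideal a b (≡.subst₂ Covers x-at x′-at cov ◅ ε) (U⇒∈ b (≡.trans (cong U (≡.sym x-at)) e))))
        where
        a = Any.index x′∈
        b = Any.index x∈
        x-at : x ≡ List.lookup L b
        x-at = AnyP.lookup-index x∈
        x′-at : x′ ≡ List.lookup L a
        x′-at = AnyP.lookup-index x′∈

      ideal⇒closed : IsIdeal I → ∀ {z} → z ∈ layer m → closedAt S S z ≡ true
      ideal⇒closed ideal {z} z∈ = closed-intro (S z) (S (inc₁ z)) (S (inc₂ z)) (S (inc₃ z)) (S (inc₄ z))
        (ideal-step ideal z∈L (∈L (inUpper (∈-layer-inc⁺ inc₁ total-inc₁ z∈))) (covers₁ z))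
        (ideal-step ideal z∈L (∈L (inUpper (∈-layer-inc⁺ inc₂ total-inc₂ z∈))) (covers₂ z))
        (ideal-step ideal (∈L (inUpper (∈-layer-inc⁺ inc₃ total-inc₃ z∈))) z∈L (covers₃ z))
        (ideal-step ideal (∈L (inUpper (∈-layer-inc⁺ inc₄ total-inc₄ z∈))) z∈L (covers₄ z))
        where
        z∈L = ∈L (inLower z∈)

      module _ (closed : ∀ {z} → z ∈ layer m → closedAt S S z ≡ true) where

        private
          elim : ∀ {z} → z ∈ layer m → _
          elim {z} z∈ = closed-elim (S z) (S (inc₁ z)) (S (inc₂ z)) (S (inc₃ z)) (S (inc₄ z)) (closed z∈)

        closed-view : ∀ {q′ q} → CoverView m q′ q → S q′ ≡ true → S q ≡ true
        closed-view (up₃ z∈) = proj₁ (proj₂ (proj₂ (elim z∈)))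
        closed-view (up₄ z∈) = proj₂ (proj₂ (proj₂ (elim z∈)))
        closed-view (down₁ z∈) = proj₁ (elim z∈)
        closed-view (down₂ z∈) = proj₁ (proj₂ (elim z∈))

        closed-step : ∀ {x x′} → x ∈ L → x′ ∈ L → Covers x x′ → U x ≡ true → U x′ ≡ true
        closed-step x∈ x′∈ cov e with ∈-map⁻ toTriple (∈-resp-↭ L-↭ x∈) | ∈-map⁻ toTriple (∈-resp-↭ L-↭ x′∈)
        ... | q , q∈ , ≡.refl | q′ , q′∈ , ≡.refl = closed-view (coverView m q′∈ q∈ cov) e

        closed⇒ideal : IsIdeal I
        closed⇒ideal a .a ε b∈ = b∈
        closed⇒ideal a b (_◅_ {j = d} cov rest) b∈ = U⇒∈ a
          (closed-step (∈-lookup d) (∈-lookup a) cov (∈⇒U d (closed⇒ideal d b rest b∈)))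

        weight-as-term : listWeight I ≈ term m A₀ B₀ S S
        weight-as-term = begin
          listWeight I
            ≡⟨ cong (prodK K) (ListP.map-cong (λ a → ≡.trans (if-when (Vec.lookup I a))
                 (cong (at (List.lookup L a) when_) (≡.sym (subsetOf-lookup L-unique I a)))) (allFin (length L))) ⟩
          prodK K (map ((λ x → at x when U x) ∘ List.lookup L) (allFin (length L)))
            ≡⟨ cong (prodK K) (≡.trans (ListP.map-∘ (allFin (length L)))
                 (cong (map (λ x → at x when U x)) (≡.trans (ListP.map-tabulate id (List.lookup L)) (ListP.tabulate-lookup L)))) ⟩
          ∏ L (λ x → at x when U x)
            ≈⟨ ∏-↭ L-↭ ⟩
          ∏ (map toTriple (poset m)) (λ x → at x when U x)
            ≡⟨ ∏-map toTriple (poset m) ⟩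
          ∏ (poset m) (λ q → B₀ q when S q)
            ≈⟨ ∏-++ (layer (suc m)) (layer m) ⟩
          ∏ (layer (suc m)) (λ v → B₀ v when S v) * ∏ (layer m) (λ z → B₀ z when S z)
            -- The weight of z is written at `inc₁ z`, whose position is 3 smaller, and moved there;
            -- together with the weight of `inc₁ z` it becomes `A₀`.
            ≈⟨ *-congˡ (trans (∏-cong (layer m) (λ {z} _ → when-cong (S z) (reflexive (cong y (≡.sym (pos-inc₁+3 j z)))))) (∏-dec₁ m below)) ⟩
          ∏ (layer (suc m)) (λ v → B₀ v when S v) * ∏ (layer (suc m)) (dec₁ 1# below)
            ≈⟨ ∏-* (layer (suc m)) ⟨
          ∏ (layer (suc m)) (λ v → B₀ v when S v * dec₁ 1# below v)
            ≈⟨ ∏-cong (layer (suc m)) (λ {v} v∈ → combine v v∈) ⟩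
          ∏ (layer (suc m)) (λ v → factor (A₀ v) (B₀ v) (S v) (dec₁ false S v))
            ≈⟨ *-identityˡ _ ⟨
          1# * ∏ (layer (suc m)) (λ v → factor (A₀ v) (B₀ v) (S v) (dec₁ false S v))
            ≈⟨ *-congʳ (∏-1 (layer m) (λ {z} z∈ → reflexive (cong ind (closed z∈)))) ⟨
          term m A₀ B₀ S S ∎
          where
          if-when : ∀ {x} b → (if b then x else 1#) ≡ x when b
          if-when true = ≡.refl
          if-when false = ≡.refl
          below : Quad → Carrier
          below z = y (pos j (inc₁ z) ℤ.+ + 3) when S z
          -- The case of z present with `inc₁ z` absent would lose the weight of z; closedness
          -- excludes it.
          factor-split : ∀ {b d} s t → (t ≡ true → s ≡ true) → b when s * d when t ≈ factor (b * d) b s t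
          factor-split true true _ = refl
          factor-split true false _ = *-identityʳ _
          factor-split false true h with () ← h ≡.refl
          factor-split false false _ = *-identityˡ _
          combine : ∀ v → v ∈ layer (suc m) → B₀ v when S v * dec₁ 1# below v ≈ factor (A₀ v) (B₀ v) (S v) (dec₁ false S v)
          combine v@(zero , _) _ = factor-split (S v) false (λ ())
          combine v@(suc a₁ , a₂ , b₁ , b₂) v∈ = factor-split (S v) (S (a₁ , a₂ , b₁ , b₂))
            (proj₁ (elim (∈-layer-inc⁻ inc₁ total-inc₁ v∈)))

      -- For an ideal, the indicators in the term are all 1. Otherwise some z violates closedness
      -- and its indicator annihilates the term.
      term-of-subset : ∀ b → (b ≡ true → IsIdeal I) → (IsIdeal I → b ≡ true) →
                       (if b then listWeight I else 0#) ≈ term m A₀ B₀ S S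
      term-of-subset b sound complete with findFalse (layer m) (closedAt S S)
      ... | inj₁ closed with ≡.refl ← complete (closed⇒ideal closed) = weight-as-term closed
      term-of-subset false sound complete | inj₂ (z , z∈ , e) =
        sym (trans (*-congʳ (∏-0 z∈ (reflexive (cong ind e)))) (zeroˡ _))
      term-of-subset true sound complete | inj₂ (z , z∈ , e)
        with () ← ≡.trans (≡.sym e) (ideal⇒closed (sound ≡.refl) z∈)

    ∑-ideals : (ideals : List (Vec Bool (length L))) → Unique ideals → (∀ I → (I ∈ ideals) ⇔ IsIdeal I) →
               sumK K (map listWeight ideals) ≈ Z m A₀ B₀
    ∑-ideals ideals unique ideals-spec = begin
      sumK K (map listWeight ideals)
        ≈⟨ ∑V-unique unique listWeight ⟩
      ∑V (length L) (λ I → if member I ideals then listWeight I else 0#)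
        ≈⟨ ∑V-cong (length L) (λ I → term-of-subset I (member I ideals)
             (λ e → Equivalence.to (ideals-spec I) (member-sound I ideals e))
             (λ ideal → member-complete I (Equivalence.from (ideals-spec I) ideal))) ⟩
      ∑V (length L) (λ I → Φ (subsetOf L I))
        ≈⟨ ∑V-subsetOf L Φ ⟩
      ∑⊆ L Φ
        ≈⟨ ∑⊆-↭ L-↭ {Φ} (λ e → term-cong m A₀ B₀ (λ _ → e _) (λ _ → e _)) ⟩
      ∑⊆ (map toTriple (poset m)) Φ
        ≈⟨ ∑⊆-map Φ (λ S → term m A₀ B₀ S S) (toTriple-injective m)
             (λ U S e → term-cong m A₀ B₀ (λ q∈ → e (inUpper q∈)) (λ q∈ → e (inLower q∈))) (poset m) id ⟩
      ∑⊆Q (poset m) (λ S → term m A₀ B₀ S S)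
        ≈⟨ Z-poset m A₀ B₀ ⟩
      Z m A₀ B₀ ∎
      where
      Φ : (Triple → Bool) → Carrier
      Φ U = term m A₀ B₀ (U ∘ toTriple) (U ∘ toTriple)

-- The level k = -1 and the theorem

module _ {c ℓ : Level} (K : CommutativeRing c ℓ) where
  open CommutativeRing K hiding (zero)
  open ProductsAndSums K
  open import Relation.Binary.Reasoning.Setoid setoid

  empty-∑ : ∀ {n} → n ≡ 0 → (W : Vec Bool n → Carrier) → (∀ I → W I ≈ 1#) →
            (ideals : List (Vec Bool n)) → Unique ideals → (∀ I → I ∈ ideals) → sumK K (map W ideals) ≈ 1#
  empty-∑ ≡.refl W W≈1 ideals unique all = begin
    sumK K (map W ideals)                          ≈⟨ ∑V-unique unique W ⟩
    (if member [] ideals then W [] else 0#)        ≡⟨ cong (if_then W [] else 0#) (member-complete [] (all [])) ⟩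
    W []                                           ≈⟨ W≈1 [] ⟩
    1#                                             ∎

theorem6p6 : {c ℓ : Level} (K : CommutativeRing c ℓ) (isField : IsFieldOn K)
    → let open CommutativeRing K
          open IsFieldOn isField
      in (n : ℕ) → 1 ℕ.≤ n
      → (y : ℤ → Carrier) → (∀ j → y (j ℤ.+ + (2 ℕ.* n)) ≈ y j)
      → (F : ℤ → ℤ → Carrier)
      → (nz : ∀ (j : ℤ) (k : ℕ) → ¬ (F j (+ k ℤ.- + 1) ≈ 0#))
      → (∀ j → F j -[1+ 0 ] ≈ 1#)
      → (∀ j → F j (+ 0) ≈ 1#)
      → (∀ (j : ℤ) (k : ℕ) →
           F j (+ k ℤ.+ + 1)
             ≈ ((F (j ℤ.- + 3) (+ k) * F (j ℤ.+ + 3) (+ k)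
                  + (coeffProd K y j k * F (j ℤ.- + 1) (+ k)) * F (j ℤ.+ + 1) (+ k))
                * inv (F j (+ k ℤ.- + 1)) (nz j k)))
      → ∀ (j : ℤ) (k : ℕ)
      → (ideals : List (Subset (size (+ k ℤ.- + 1))))
      → Unique ideals
      → (∀ I → (I ∈ ideals) ⇔ IsOrderIdeal (+ k ℤ.- + 1) I)
      → F j (+ k ℤ.- + 1) ≈ sumK K (map (weight K y j (+ k ℤ.- + 1)) ideals)
-- ≡.refl: the enumeration of P_{−1} evaluates to the empty list.
theorem6p6 K isField n _ y _ F nz F₋₁≈1 F₀≈1 F-rec j zero ideals unique spec =
  trans (F₋₁≈1 j) (sym (empty-∑ K ≡.refl (weight K y j -[1+ 0 ])
    (λ _ → refl) ideals unique (λ I → Equivalence.from (spec I) (λ ()))))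
  where open CommutativeRing K
theorem6p6 K isField n _ y _ F nz F₋₁≈1 F₀≈1 F-rec j (suc m) ideals unique spec =
  trans (f-as-Z j m) (sym (∑-ideals m (PList (+ m)) (PList-unique (+ m)) (PList-↭ m) y j ideals unique spec))
  where
  open CommutativeRing K hiding (zero)
  open IsFieldOn isField
  -- Levels are shifted by one so that they start at 0: `f 0` and `f 1` are the two initial rows of
  -- ones, and `f (suc m)` is F at level m.
  f f⁻ : ℕ → ℤ → Carrier
  f i p = F p (+ i ℤ.- + 1)
  f⁻ i p = inv (F p (+ i ℤ.- + 1)) (nz p i)
  clear-denominator : ∀ {a b x} i p → a ≈ b → b ≈ x * f⁻ i p → a * f i p ≈ x
  clear-denominator i p a≈b b≈x/f = trans (*-congʳ (trans a≈b b≈x/f)) (trans (*-assoc _ _ _)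
    (trans (*-congˡ (trans (*-comm _ _) (inv-ʳ _ (nz p i)))) (*-identityʳ _)))
  open Condensation.Recurrence K y f f⁻ (λ i p → inv-ʳ (F p (+ i ℤ.- + 1)) (nz p i)) F₋₁≈1 F₀≈1
    (λ i p → clear-denominator i p (reflexive (cong (λ k → F p (+ k)) (ℕP.+-comm 1 i))) (F-rec p i))
  open OrderIdeals K
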